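{- Up to equivalence, there are exactly $166$ ternary self-dual $[24,12,6]$ codes, and exactly $170$ ternary self-dual $[24,12,3]$ codes.
   Context: A ternary code of length $n$ is an $\mathbb{F}_3$-linear subspace $C\subseteq\mathbb{F}_3^n$. Its dual is $C^\perp=\{x\in\mathbb{F}_3^n : x\cdot y=0 \text{ for all } y\in C\}$ with respect to the standard inner product, and $C$ is self-dual if $C=C^\perp$. An $[n,k,d]$ code is a code of length $n$, dimension $k$ and minimum (Hamming) weight $d$. Two codes $C,C'$ of length $n$ are equivalent if $C'=C\cdot P=\{xP : x\in C\}$ for some $n\times n$ monomial matrix $P$ over $\mathbb{F}_3$ (a permutation matrix whose nonzero entries may be $\pm1$). -}

module Defs where

open import Data.Nat using (ℕ; zero; suc; _≤_)
open import Data.Fin using (Fin)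
open import Data.Vec using (Vec; []; _∷_; lookup; tabulate; replicate; zipWith; map; foldr)
open import Data.Bool using (Bool; true)
open import Data.Product using (Σ; _×_; _,_; ∃)
open import Relation.Binary.PropositionalEquality using (_≡_; _≢_)
open import Relation.Nullary using (¬_)

data F3 : Set where
  𝟎 𝟏 𝟐 : F3

infixl 6 _+₃_
infixl 7 _*₃_

_+₃_ : F3 → F3 → F3
𝟎 +₃ y = y
𝟏 +₃ 𝟎 = 𝟏
𝟏 +₃ 𝟏 = 𝟐
𝟏 +₃ 𝟐 = 𝟎
𝟐 +₃ 𝟎 = 𝟐
𝟐 +₃ 𝟏 = 𝟎
𝟐 +₃ 𝟐 = 𝟏

_*₃_ : F3 → F3 → F3
𝟎 *₃ y = 𝟎
𝟏 *₃ y = y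
𝟐 *₃ 𝟎 = 𝟎
𝟐 *₃ 𝟏 = 𝟐
𝟐 *₃ 𝟐 = 𝟏

Word : ℕ → Set
Word n = Vec F3 n

zeroW : ∀ {n} → Word n
zeroW = replicate _ 𝟎

_⊕_ : ∀ {n} → Word n → Word n → Word n
_⊕_ = zipWith _+₃_

_·_ : ∀ {n} → F3 → Word n → Word n
a · x = map (a *₃_) x

sumF : ∀ {k} → Vec F3 k → F3
sumF = foldr _ _+₃_ 𝟎

dot : ∀ {n} → Word n → Word n → F3
dot x y = sumF (zipWith _*₃_ x y)

wt : ∀ {n} → Word n → ℕ
wt [] = 0
wt (𝟎 ∷ x) = wt x
wt (𝟏 ∷ x) = suc (wt x)
wt (𝟐 ∷ x) = suc (wt x)

Code : ℕ → Set
Code n = Word n → Bool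

_∈C_ : ∀ {n} → Word n → Code n → Set
x ∈C C = C x ≡ true

IsLinear : ∀ {n} → Code n → Set
IsLinear {n} C =
  (zeroW ∈C C) ×
  (∀ (x y : Word n) → x ∈C C → y ∈C C → (x ⊕ y) ∈C C) ×
  (∀ (a : F3) (x : Word n) → x ∈C C → (a · x) ∈C C)

linComb : ∀ {n k} → Vec F3 k → Vec (Word n) k → Word n
linComb [] [] = zeroW
linComb (a ∷ as) (b ∷ bs) = (a · b) ⊕ linComb as bs

HasDim : ∀ {n} → Code n → ℕ → Set
HasDim {n} C k = Σ (Vec (Word n) k) λ b →
  (∀ (a : Vec F3 k) → linComb a b ≡ zeroW → a ≡ replicate k 𝟎) ×
  (∀ (x : Word n) → (x ∈C C → Σ (Vec F3 k) λ a → x ≡ linComb a b)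
                  × (Σ (Vec F3 k) (λ a → x ≡ linComb a b) → x ∈C C))

HasMinWt : ∀ {n} → Code n → ℕ → Set
HasMinWt {n} C d =
  (Σ (Word n) λ x → x ∈C C × x ≢ zeroW × wt x ≡ d) ×
  (∀ (x : Word n) → x ∈C C → x ≢ zeroW → d ≤ wt x)

_∈Dual_ : ∀ {n} → Word n → Code n → Set
_∈Dual_ {n} x C = ∀ (y : Word n) → y ∈C C → dot x y ≡ 𝟎

IsSelfDual : ∀ {n} → Code n → Set
IsSelfDual {n} C = ∀ (x : Word n) → (x ∈C C → x ∈Dual C) × (x ∈Dual C → x ∈C C)

SelfDualCode : (n k d : ℕ) → Code n → Set
SelfDualCode n k d C = IsLinear C × HasDim C k × HasMinWt C d × IsSelfDual C

Matrix : ℕ → Set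
Matrix n = Vec (Vec F3 n) n

entry : ∀ {n} → Matrix n → Fin n → Fin n → F3
entry P i j = lookup (lookup P i) j

_×M_ : ∀ {n} → Word n → Matrix n → Word n
_×M_ {n} x P = tabulate λ j → sumF (tabulate λ i → lookup x i *₃ entry P i j)

-- monomial: exactly one nonzero entry in each row and in each column
-- (nonzero entries of F₃ are exactly ±1)
IsMonomial : ∀ {n} → Matrix n → Set
IsMonomial {n} P =
  (∀ (i : Fin n) → Σ (Fin n) λ j → entry P i j ≢ 𝟎 × (∀ j' → entry P i j' ≢ 𝟎 → j' ≡ j)) ×
  (∀ (j : Fin n) → Σ (Fin n) λ i → entry P i j ≢ 𝟎 × (∀ i' → entry P i' j ≢ 𝟎 → i' ≡ i))

Equivalent : ∀ {n} → Code n → Code n → Set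
Equivalent {n} C C' = Σ (Matrix n) λ P → IsMonomial P ×
  (∀ (y : Word n) → (y ∈C C' → Σ (Word n) λ x → x ∈C C × y ≡ x ×M P)
                  × (Σ (Word n) (λ x → x ∈C C × y ≡ x ×M P) → y ∈C C'))

ExactlyUpToEquiv : ∀ {n} → (Code n → Set) → ℕ → Set
ExactlyUpToEquiv {n} Q m = Σ (Vec (Code n) m) λ reps →
  (∀ (i : Fin m) → Q (lookup reps i)) ×
  (∀ (i j : Fin m) → i ≢ j → ¬ Equivalent (lookup reps i) (lookup reps j)) ×
  (∀ (C : Code n) → Q C → Σ (Fin m) λ i → Equivalent (lookup reps i) C)

{-# OPTIONS --safe #-}

-- A lower bound for the size of each equivalence class is compared with the
-- number of self-dual codes.  Fix a word w of weight t ∈ {3 , 6}.  In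
-- hyperbolic coordinates with first vector w, the self-dual codes containing
-- w correspond to the maximal isotropic subspaces of an 11-fold hyperbolic
-- space, of which there are at most ∏_{i<11} (3^i + 1).  If C has A_t words of
-- weight t, then A_t · t! (24 - t)! 2^(24-t) monomial transformations move C
-- to a code containing w, and each code is reached at most |Aut C| times.
-- For the 166 + 170 representatives below these orbit sizes add up to the
-- bound, both for t = 3 and for t = 6, so that no self-dual code with a word
-- of weight 3 or 6 is missed (only extremal codes, with minimum weight 9, are).
--
-- |Aut C| is bounded along a chain of stabilizers of signed coordinates, and
-- the representatives are told apart, by colour refinement on the incidence
-- structure of signed coordinates and words of small weight.
module Submission where

open import Defs
open import Algebra.Properties.CommutativeMonoid.Sum using () renaming (sum to sumᶠ; sum-permute to sumᶠ-permute)
open import Data.Bool using (Bool; true; false; if_then_else_; _∧_; _∨_; not; _xor_; T)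
open import Data.Bool.ListAction using (all; any)
open import Data.Bool.Properties using (∨-zeroʳ; xor-same)
open import Data.Empty using (⊥; ⊥-elim)
open import Data.Fin as Fin using (Fin; zero; suc; combine)
open import Data.Fin.Permutation using (permutation)
open import Data.Fin.Properties as Finₚ using (combine-injective)
open import Data.List as List using (List; []; _∷_; _++_; length; cartesianProductWith)
open import Data.List.Membership.Propositional using (_∈_; find)
open import Data.List.Membership.Propositional.Properties using (∈-map⁺; ∈-map⁻; ∈-filter⁻; ∈-++⁺ˡ; ∈-++⁺ʳ; ∈-++⁻; ∈-concatMap⁻; ∈-cartesianProductWith⁺; ∈-deduplicate⁺; ∈-deduplicate⁻; ∈-allFin)
open import Data.List.Membership.Propositional.Properties.WithK using (unique∧set⇒bag)
import Data.List.Properties as Listₚ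
open import Data.List.Relation.Binary.BagAndSetEquality using (∼bag⇒↭)
open import Data.List.Relation.Binary.Permutation.Propositional as Perm using (_↭_; ↭-sym)
open import Data.List.Relation.Binary.Permutation.Propositional.Properties using (map⁺; ↭-length)
open import Data.List.Relation.Unary.All as All using (All; []; _∷_)
import Data.List.Relation.Unary.All.Properties as Allₚ
open import Data.List.Relation.Unary.AllPairs using (AllPairs; []; _∷_)
import Data.List.Relation.Unary.AllPairs.Properties as AllPairsₚ
open import Data.List.Relation.Unary.Any using (here; there; any?)
open import Data.List.Relation.Unary.Linked using (Linked; []; [-]; _∷_)
open import Data.List.Relation.Unary.Linked.Properties using (Linked⇒AllPairs)
open import Data.List.Relation.Unary.Unique.Propositional using (Unique)
open import Data.List.Relation.Unary.Unique.Propositional.Properties using (++⁺; filter⁺)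
open import Data.Maybe using (Maybe; just; nothing; maybe′)
open import Data.Nat as ℕ using (ℕ; zero; suc; _+_; _*_; _^_; _!; _∸_; _≤_; _<_; z≤n; s≤s; _≡ᵇ_; _≤ᵇ_; _<ᵇ_; _/_; _%_)
open import Data.Nat.Properties as ℕₚ using (+-comm; +-assoc; +-suc; ≡ᵇ⇒≡)
open import Data.Product using (Σ; ∃; _×_; _,_; proj₁; proj₂)
open import Data.Sum as Sum using (_⊎_; inj₁; inj₂)
open import Data.Unit using (⊤; tt)
open import Data.Vec as Vec using (Vec; []; _∷_; lookup; zipWith; map; replicate; tabulate; insertAt; removeAt; sum; toList)
import Data.Vec.Properties as Vecₚ
open import Function using (_∘_; id; case_of_; mk⇔)
open import Relation.Binary.Definitions using (DecidableEquality)
open import Relation.Binary.PropositionalEquality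
open import Relation.Nullary using (¬_; ¬?; Dec; yes; no)
open import Relation.Nullary.Decidable using (toWitness; _→-dec_)

-- Every numerical check may err in one direction only. The isotropic subspaces are merely injected
-- into `Fin (count 11)`, stabilizers are bounded from above and orbits from below; the equality of
-- the totals then forces all estimates to be sharp. A collision of hashes can only make a check
-- fail: it may hide a difference, but it never separates objects that a monomial transformation
-- identifies. Codes are Boolean functions, whose pointwise equality is not propositional equality.
-- A code is therefore counted through a number that determines it pointwise, and a transformation
-- through a normal form with honest equality. Stabilizers appear only as cosets: duplicate-free
-- lists of transformations that carry `C` to one code and a colouring to one colouring. Passing to
-- a smaller stabilizer is passing to a fibre of such a list. Weight 3 meets only codes of the
-- second list, so that this list alone fills the total there; through a word of weight 6 the codes
-- of both lists pass, and their shares have to be added.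

private variable
  A B X Y Z : Set
  n m k : ℕ

-- Arithmetic of the field with three elements

neg : F3 → F3
neg 𝟎 = 𝟎
neg 𝟏 = 𝟐
neg 𝟐 = 𝟏

_≟F_ : DecidableEquality F3
𝟎 ≟F 𝟎 = yes refl
𝟎 ≟F 𝟏 = no λ ()
𝟎 ≟F 𝟐 = no λ ()
𝟏 ≟F 𝟎 = no λ ()
𝟏 ≟F 𝟏 = yes refl
𝟏 ≟F 𝟐 = no λ ()
𝟐 ≟F 𝟎 = no λ ()
𝟐 ≟F 𝟏 = no λ ()
𝟐 ≟F 𝟐 = yes refl

all₃? : {P : F3 → Set} → (∀ x → Dec (P x)) → Dec (∀ x → P x)
all₃? P? with P? 𝟎 | P? 𝟏 | P? 𝟐
... | yes p | yes q | yes r = yes λ { 𝟎 → p ; 𝟏 → q ; 𝟐 → r }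
... | no ¬p | _ | _ = no λ f → ¬p (f 𝟎)
... | yes _ | no ¬q | _ = no λ f → ¬q (f 𝟏)
... | yes _ | yes _ | no ¬r = no λ f → ¬r (f 𝟐)

neg-involutive : ∀ x → neg (neg x) ≡ x
neg-involutive = toWitness {a? = all₃? λ x → (neg (neg x)) ≟F (x)} _

+₃-comm : ∀ x y → x +₃ y ≡ y +₃ x
+₃-comm = toWitness {a? = all₃? λ x → all₃? λ y → (x +₃ y) ≟F (y +₃ x)} _

+₃-assoc : ∀ x y z → (x +₃ y) +₃ z ≡ x +₃ (y +₃ z)
+₃-assoc = toWitness {a? = all₃? λ x → all₃? λ y → all₃? λ z → ((x +₃ y) +₃ z) ≟F (x +₃ (y +₃ z))} _

+₃-identityʳ : ∀ x → x +₃ 𝟎 ≡ x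
+₃-identityʳ = toWitness {a? = all₃? λ x → (x +₃ 𝟎) ≟F (x)} _

+₃-inverseʳ : ∀ x → x +₃ neg x ≡ 𝟎
+₃-inverseʳ = toWitness {a? = all₃? λ x → (x +₃ neg x) ≟F (𝟎)} _

*₃-comm : ∀ x y → x *₃ y ≡ y *₃ x
*₃-comm = toWitness {a? = all₃? λ x → all₃? λ y → (x *₃ y) ≟F (y *₃ x)} _

*₃-zeroʳ : ∀ x → x *₃ 𝟎 ≡ 𝟎
*₃-zeroʳ = toWitness {a? = all₃? λ x → (x *₃ 𝟎) ≟F (𝟎)} _

*₃-identityʳ : ∀ x → x *₃ 𝟏 ≡ x
*₃-identityʳ = toWitness {a? = all₃? λ x → (x *₃ 𝟏) ≟F (x)} _

*₃-distribˡ : ∀ x y z → x *₃ (y +₃ z) ≡ x *₃ y +₃ x *₃ z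
*₃-distribˡ = toWitness {a? = all₃? λ x → all₃? λ y → all₃? λ z → (x *₃ (y +₃ z)) ≟F (x *₃ y +₃ x *₃ z)} _

*₃-distribʳ : ∀ x y z → (y +₃ z) *₃ x ≡ y *₃ x +₃ z *₃ x
*₃-distribʳ = toWitness {a? = all₃? λ x → all₃? λ y → all₃? λ z → ((y +₃ z) *₃ x) ≟F (y *₃ x +₃ z *₃ x)} _

*₃-assoc : ∀ x y z → (x *₃ y) *₃ z ≡ x *₃ (y *₃ z)
*₃-assoc = toWitness {a? = all₃? λ x → all₃? λ y → all₃? λ z → ((x *₃ y) *₃ z) ≟F (x *₃ (y *₃ z))} _

neg-* : ∀ x y → neg x *₃ neg y ≡ x *₃ y
neg-* = toWitness {a? = all₃? λ x → all₃? λ y → (neg x *₃ neg y) ≟F (x *₃ y)} _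

neg-as-* : ∀ x → neg x ≡ 𝟐 *₃ x
neg-as-* = toWitness {a? = all₃? λ x → (neg x) ≟F (𝟐 *₃ x)} _

neg-+ : ∀ x y → neg (x +₃ y) ≡ neg x +₃ neg y
neg-+ = toWitness {a? = all₃? λ x → all₃? λ y → (neg (x +₃ y)) ≟F (neg x +₃ neg y)} _

+₃-middle : ∀ w x y z → (w +₃ x) +₃ (y +₃ z) ≡ (w +₃ y) +₃ (x +₃ z)
+₃-middle = toWitness {a? = all₃? λ w → all₃? λ x → all₃? λ y → all₃? λ z → ((w +₃ x) +₃ (y +₃ z)) ≟F ((w +₃ y) +₃ (x +₃ z))} _

-- Monomial transformations and their actions

-- A monomial transformation acts simultaneously on the vectors over every
-- set with a sign change i: on words with i = neg, on colourings of the
-- signed coordinates (vectors of pairs) with i = swap, on ℕ-vectors with i = id.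
record Sym (n : ℕ) : Set₁ where
  field
    app : (X → X) → Vec X n → Vec X n
    app-zipWith : ∀ {i : X → X} {j : Y → Y} {k : Z → Z} (f : X → Y → Z) →
      (∀ x y → f (i x) (j y) ≡ k (f x y)) →
      ∀ xs ys → app k (zipWith f xs ys) ≡ zipWith f (app i xs) (app j ys)
    app-map : ∀ {i : X → X} {j : Y → Y} (f : X → Y) →
      (∀ x → f (i x) ≡ j (f x)) → ∀ xs → app j (map f xs) ≡ map f (app i xs)
    app-replicate : ∀ {i : X → X} x → i x ≡ x → app i (replicate n x) ≡ replicate n x
    app-sum : ∀ (xs : Vec ℕ n) → sum (app id xs) ≡ sum xs

-- A signed permutation is coded by the successive positions at which coordinates are inserted, with
-- a sign for each. The code is unique (`push-faithful`), so that transformations can be counted by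
-- plain equality.
Mono : ℕ → Set
Mono zero = ⊤
Mono (suc n) = Fin (suc n) × Bool × Mono n

flip : (X → X) → Bool → X → X
flip i b x = if b then i x else x

pull : (X → X) → Mono n → Vec X n → Vec X n
pull {n = zero} i g xs = []
pull {n = suc n} i (j , s , g) xs = flip i s (lookup xs j) ∷ pull i g (removeAt xs j)

push : (X → X) → Mono n → Vec X n → Vec X n
push {n = zero} i g xs = []
push {n = suc n} i (j , s , g) (x ∷ xs) = insertAt (push i g xs) j (flip i s x)

flip-involutive : ∀ (i : X → X) → (∀ x → i (i x) ≡ x) → ∀ s x → flip i s (flip i s x) ≡ x
flip-involutive i h false x = refl
flip-involutive i h true x = h x

pull-push : ∀ {i : X → X} → (∀ x → i (i x) ≡ x) → ∀ (g : Mono n) xs → pull i g (push i g xs) ≡ xs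
pull-push {n = zero} h g [] = refl
pull-push {n = suc n} {i = i} h (j , s , g) (x ∷ xs) = cong₂ _∷_
  (trans (cong (flip i s) (Vecₚ.insertAt-lookup (push i g xs) j _)) (flip-involutive i h s x))
  (trans (cong (pull i g) (Vecₚ.removeAt-insertAt (push i g xs) j _)) (pull-push h g xs))

push-pull : ∀ {i : X → X} → (∀ x → i (i x) ≡ x) → ∀ (g : Mono n) xs → push i g (pull i g xs) ≡ xs
push-pull {n = zero} h g [] = refl
push-pull {n = suc n} {i = i} h (j , s , g) xs = trans
  (cong₂ (λ ys y → insertAt ys j y) (push-pull h g (removeAt xs j)) (flip-involutive i h s (lookup xs j)))
  (Vecₚ.insertAt-removeAt xs j)

flip-zip : ∀ (i : X → X) (j : Y → Y) (k : Z → Z) (f : X → Y → Z) → (∀ x y → f (i x) (j y) ≡ k (f x y)) →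
  ∀ s x y → flip k s (f x y) ≡ f (flip i s x) (flip j s y)
flip-zip i j k f h false x y = refl
flip-zip i j k f h true x y = sym (h x y)

removeAt-zipWith : ∀ (f : X → Y → Z) (xs : Vec X (suc n)) ys j →
  removeAt (zipWith f xs ys) j ≡ zipWith f (removeAt xs j) (removeAt ys j)
removeAt-zipWith f (x ∷ xs) (y ∷ ys) zero = refl
removeAt-zipWith f (x ∷ xs@(_ ∷ _)) (y ∷ ys@(_ ∷ _)) (suc j) = cong (f x y ∷_) (removeAt-zipWith f xs ys j)

insertAt-zipWith : ∀ (f : X → Y → Z) (xs : Vec X n) ys j x y →
  insertAt (zipWith f xs ys) j (f x y) ≡ zipWith f (insertAt xs j x) (insertAt ys j y)
insertAt-zipWith f xs ys zero x y = refl
insertAt-zipWith f (a ∷ xs) (b ∷ ys) (suc j) x y = cong (f a b ∷_) (insertAt-zipWith f xs ys j x y)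

removeAt-map : ∀ (f : X → Y) (xs : Vec X (suc n)) j → removeAt (map f xs) j ≡ map f (removeAt xs j)
removeAt-map f (x ∷ xs) zero = refl
removeAt-map f (x ∷ xs@(_ ∷ _)) (suc j) = cong (f x ∷_) (removeAt-map f xs j)

removeAt-replicate : ∀ (x : X) (j : Fin (suc n)) → removeAt (replicate (suc n) x) j ≡ replicate n x
removeAt-replicate x zero = refl
removeAt-replicate {n = suc n} x (suc j) = cong (x ∷_) (removeAt-replicate x j)

insertAt-replicate : ∀ (x : X) (j : Fin (suc n)) → insertAt (replicate n x) j x ≡ replicate (suc n) x
insertAt-replicate x zero = refl
insertAt-replicate {n = suc n} x (suc j) = cong (x ∷_) (insertAt-replicate x j)

sum-removeAt : ∀ (xs : Vec ℕ (suc n)) j → lookup xs j + sum (removeAt xs j) ≡ sum xs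
sum-removeAt (x ∷ xs) zero = refl
sum-removeAt (x ∷ xs@(_ ∷ _)) (suc j) = begin
  lookup xs j + (x + sum (removeAt xs j)) ≡⟨ sym (+-assoc (lookup xs j) x _) ⟩
  lookup xs j + x + sum (removeAt xs j)   ≡⟨ cong (_+ sum (removeAt xs j)) (+-comm (lookup xs j) x) ⟩
  x + lookup xs j + sum (removeAt xs j)   ≡⟨ +-assoc x (lookup xs j) _ ⟩
  x + (lookup xs j + sum (removeAt xs j)) ≡⟨ cong (x +_) (sum-removeAt xs j) ⟩
  x + sum xs ∎ where open ≡-Reasoning

sum-insertAt : ∀ (xs : Vec ℕ n) j x → sum (insertAt xs j x) ≡ x + sum xs
sum-insertAt xs j x = trans (sym (sum-removeAt (insertAt xs j x) j))
  (cong₂ _+_ (Vecₚ.insertAt-lookup xs j x) (cong sum (Vecₚ.removeAt-insertAt xs j x)))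

flip-id : ∀ s (x : X) → flip id s x ≡ x
flip-id false x = refl
flip-id true x = refl

flip-fixed : ∀ (i : X → X) s x → i x ≡ x → flip i s x ≡ x
flip-fixed i false x h = refl
flip-fixed i true x h = h

flip-map : ∀ (i : X → X) (j : Y → Y) (f : X → Y) → (∀ x → f (i x) ≡ j (f x)) →
  ∀ s x → flip j s (f x) ≡ f (flip i s x)
flip-map i j f h false x = refl
flip-map i j f h true x = sym (h x)

pullSym : Mono n → Sym n
pullSym g = record
  { app = λ i → pull i g
  ; app-zipWith = λ f h → zp f h g
  ; app-map = λ f h → mp f h g
  ; app-replicate = rp g
  ; app-sum = sm g }
  where
  zp : ∀ {n} {i : X → X} {j : Y → Y} {k : Z → Z} (f : X → Y → Z) → (∀ x y → f (i x) (j y) ≡ k (f x y)) →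
    ∀ (g : Mono n) xs ys → pull k g (zipWith f xs ys) ≡ zipWith f (pull i g xs) (pull j g ys)
  zp {n = zero} f h g [] [] = refl
  zp {n = suc n} {i = i} {j} {k} f h (l , s , g) xs ys = cong₂ _∷_
    (trans (cong (flip k s) (Vecₚ.lookup-zipWith f l xs ys)) (flip-zip i j k f h s _ _))
    (trans (cong (pull k g) (removeAt-zipWith f xs ys l)) (zp f h g _ _))
  mp : ∀ {n} {i : X → X} {j : Y → Y} (f : X → Y) → (∀ x → f (i x) ≡ j (f x)) →
    ∀ (g : Mono n) xs → pull j g (map f xs) ≡ map f (pull i g xs)
  mp {n = zero} f h g [] = refl
  mp {n = suc n} {i = i} {j} f h (l , s , g) xs = cong₂ _∷_
    (trans (cong (flip j s) (Vecₚ.lookup-map l f xs)) (flip-map i j f h s _))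
    (trans (cong (pull j g) (removeAt-map f xs l)) (mp f h g _))
  rp : ∀ {n} (g : Mono n) {i : X → X} x → i x ≡ x → pull i g (replicate n x) ≡ replicate n x
  rp {n = zero} g x h = refl
  rp {n = suc n} (l , s , g) {i} x h = cong₂ _∷_
    (trans (cong (flip i s) (Vecₚ.lookup-replicate l x)) (flip-fixed i s x h))
    (trans (cong (pull i g) (removeAt-replicate x l)) (rp g x h))
  sm : ∀ {n} (g : Mono n) (xs : Vec ℕ n) → sum (pull id g xs) ≡ sum xs
  sm {n = zero} g [] = refl
  sm {n = suc n} (l , s , g) xs = trans
    (cong₂ _+_ (flip-id s (lookup xs l)) (sm g (removeAt xs l))) (sum-removeAt xs l)

pushSym : Mono n → Sym n
pushSym g = record
  { app = λ i → push i g
  ; app-zipWith = λ f h → zp f h g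
  ; app-map = λ f h → mp f h g
  ; app-replicate = rp g
  ; app-sum = sm g }
  where
  zp : ∀ {n} {i : X → X} {j : Y → Y} {k : Z → Z} (f : X → Y → Z) → (∀ x y → f (i x) (j y) ≡ k (f x y)) →
    ∀ (g : Mono n) xs ys → push k g (zipWith f xs ys) ≡ zipWith f (push i g xs) (push j g ys)
  zp {n = zero} f h g [] [] = refl
  zp {n = suc n} {i = i} {j} {k} f h (l , s , g) (x ∷ xs) (y ∷ ys) = trans
    (cong₂ (λ zs z → insertAt zs l z) (zp f h g xs ys) (flip-zip i j k f h s x y))
    (insertAt-zipWith f (push _ g xs) (push _ g ys) l _ _)
  mp : ∀ {n} {i : X → X} {j : Y → Y} (f : X → Y) → (∀ x → f (i x) ≡ j (f x)) →
    ∀ (g : Mono n) xs → push j g (map f xs) ≡ map f (push i g xs)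
  mp {n = zero} f h g [] = refl
  mp {n = suc n} {i = i} {j} f h (l , s , g) (x ∷ xs) = trans
    (cong₂ (λ zs z → insertAt zs l z) (mp f h g xs) (flip-map i j f h s x))
    (sym (Vecₚ.map-insertAt f _ (push _ g xs) l))
  rp : ∀ {n} (g : Mono n) {i : X → X} x → i x ≡ x → push i g (replicate n x) ≡ replicate n x
  rp {n = zero} g x h = refl
  rp {n = suc n} (l , s , g) {i} x h = trans
    (cong₂ (λ zs z → insertAt zs l z) (rp g x h) (flip-fixed i s x h)) (insertAt-replicate x l)
  sm : ∀ {n} (g : Mono n) (xs : Vec ℕ n) → sum (push id g xs) ≡ sum xs
  sm {n = zero} g [] = refl
  sm {n = suc n} (l , s , g) (x ∷ xs) = trans (sum-insertAt (push id g xs) l _)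
    (cong₂ _+_ (flip-id s x) (sm g xs))

-- Composites are formed in `Sym`, where composition is immediate, whereas a product of two codes in
-- `Mono` would have to be computed. The composites that occur have the shape `pull` after `push`.
_∘ˢ_ : Sym n → Sym n → Sym n
g ∘ˢ h = record
  { app = λ i → G.app i ∘ H.app i
  ; app-zipWith = λ f e xs ys → trans (cong (G.app _) (H.app-zipWith f e xs ys)) (G.app-zipWith f e _ _)
  ; app-map = λ f e xs → trans (cong (G.app _) (H.app-map f e xs)) (G.app-map f e _)
  ; app-replicate = λ x e → trans (cong (G.app _) (H.app-replicate x e)) (G.app-replicate x e)
  ; app-sum = λ xs → trans (G.app-sum (H.app id xs)) (H.app-sum xs) }
  where module G = Sym g; module H = Sym h

-- Colour refinement on signed coordinates

-- The entries are the colours of a coordinate vector and of its negative; a sign change exchanges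
-- them.
Color : Set
Color = ℕ × ℕ

State : ℕ → Set
State = Vec Color

-- Soundness does not depend on the choice of these three functions.
opaque
  scramble : ℕ → ℕ
  scramble x = x * (x * x + 12345) % 2147483647

  label : ℕ → ℕ
  label k = 1000003 * suc k

  square : ℕ → ℕ
  square p = (p * p + 777) % 2147483647

-- A word and its negative act together: `a` goes to the signed coordinates in the word, `b` to
-- those in its negative. Exchanging the two words along with `a` and `b` changes nothing.
place : ℕ → ℕ → F3 → Color → Color
place a b 𝟎 c = c
place a b 𝟏 (p , m) = p + a , m + b
place a b 𝟐 (p , m) = p + b , m + a

colorSum : ∀ {n} → Word n → State n → ℕ
colorSum [] [] = 0
colorSum (𝟎 ∷ w) (_ ∷ st) = colorSum w st
colorSum (𝟏 ∷ w) ((p , m) ∷ st) = p + colorSum w st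
colorSum (𝟐 ∷ w) ((p , m) ∷ st) = m + colorSum w st

negW : ∀ {n} → Word n → Word n
negW = map neg

agree disagree : F3 → F3 → ℕ
agree 𝟏 𝟏 = 1
agree 𝟐 𝟐 = 1
agree _ _ = 0
disagree 𝟏 𝟐 = 1
disagree 𝟐 𝟏 = 1
disagree _ _ = 0

-- Negating either word exchanges the numbers of agreeing and of opposite entries, and the final sum
-- is symmetric in them. So the value depends on the words only up to sign.
overlapHash : ∀ {n} → Word n → Word n → ℕ → ℕ → ℕ
overlapHash [] [] a b = scramble (a + 3) + scramble (b + 3)
overlapHash (𝟎 ∷ x) (_ ∷ y) a b = overlapHash x y a b
overlapHash (𝟏 ∷ x) (𝟎 ∷ y) a b = overlapHash x y a b
overlapHash (𝟏 ∷ x) (𝟏 ∷ y) a b = overlapHash x y (suc a) b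
overlapHash (𝟏 ∷ x) (𝟐 ∷ y) a b = overlapHash x y a (suc b)
overlapHash (𝟐 ∷ x) (𝟎 ∷ y) a b = overlapHash x y a b
overlapHash (𝟐 ∷ x) (𝟏 ∷ y) a b = overlapHash x y a (suc b)
overlapHash (𝟐 ∷ x) (𝟐 ∷ y) a b = overlapHash x y (suc a) b

overlapSum : ∀ {n} → List (Word n) → Word n → ℕ
overlapSum [] w = 0
overlapSum (v ∷ vs) w = overlapHash w v 0 0 + overlapSum vs w

-- Comparing all pairs of words is quadratic, so long lists get weight 0. The cutoff depends on the
-- length alone and is therefore invariant.
weigh : ∀ {n} → List (Word n) → Word n → ℕ
weigh H w = if List.length H ≤ᵇ 120 then overlapSum H w else 0

rehash : ∀ {n} → ℕ → Word n → State n → ℕ → ℕ → Color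
rehash c [] [] a b = scramble (c + a) , scramble (c + b)
rehash c (𝟎 ∷ w) (_ ∷ st) a b = rehash c w st a b
rehash c (𝟏 ∷ w) ((p , m) ∷ st) a b = rehash c w st (p + a) (m + b)
rehash c (𝟐 ∷ w) ((p , m) ∷ st) a b = rehash c w st (m + a) (p + b)

-- The incidence matrix is transposed once per code, so that a refinement round runs down each
-- coordinate. `accumulate-gather` recovers the form that adds one word after the other, on which
-- invariance is proved.
columns : ∀ {n} → List (Word n) → Vec (List F3) n
columns [] = replicate _ []
columns (w ∷ ws) = zipWith _∷_ w (columns ws)

collect : List F3 → List Color → Color
collect [] hs = 0 , 0
collect (_ ∷ _) [] = 0 , 0
collect (𝟎 ∷ xs) (h ∷ hs) = collect xs hs
collect (𝟏 ∷ xs) ((a , b) ∷ hs) = place a b 𝟏 (collect xs hs)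
collect (𝟐 ∷ xs) ((a , b) ∷ hs) = place a b 𝟐 (collect xs hs)

collectAll : ∀ {n} → Vec (List F3) n → List Color → State n
collectAll cols hs = map (λ col → collect col hs) cols

accumulate : ∀ {n} → State n → Vec (List F3) n → List (ℕ × Word n) → State n
accumulate st cols ws = collectAll cols (List.map (λ (c , w) → rehash c w st 0 0) ws)

mix : Color → Color → Color
mix (p , m) (a , b) = scramble (7 * p + 3 * m + a) , scramble (7 * m + 3 * p + b)

Graph : ℕ → Set
Graph n = Vec (List F3) n × List (ℕ × Word n)

step : ∀ {n} → Graph n → State n → State n
step (cols , ws) st = zipWith mix st (accumulate st cols ws)

steps : ∀ {n} → ℕ → Graph n → State n → State n
steps zero ws st = st
steps (suc r) ws st = steps r ws (step ws st)

weighted : ∀ {n} → List (Word n) → Graph n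
weighted H = columns H , List.map (λ w → weigh H w , w) H

hash : ∀ {n} → State n → ℕ
hash [] = 0
hash ((p , m) ∷ st) = square p + square m + hash st

-- Individualization: the signed coordinate `p` receives the label of level `k`, its negative does
-- not.
mark : ∀ {n} → ℕ → Word n → State n → State n
mark k p st = zipWith (place (label k) 0) p st

start : ∀ {n} → State n
start = replicate _ (1 , 1)

-- Enumeration of the words of small weight

points : ∀ n → List (Word n)
points zero = []
points (suc n) = (𝟏 ∷ zeroW) ∷ (𝟐 ∷ zeroW) ∷ List.map (𝟎 ∷_) (points n)

trit : ℕ → F3
trit 0 = 𝟎
trit 1 = 𝟏
trit _ = 𝟐

trits : ∀ n → ℕ → Word n
trits zero N = []
trits (suc n) N = trit (N % 3) ∷ trits n (N / 3)

opaque
  matrix : ∀ k → ℕ → Vec (Word 12) k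
  matrix zero N = []
  -- A row consists of twelve ternary digits, and 531441 is the twelfth power of 3.
  matrix (suc k) N = trits 12 N ∷ matrix k (N / 531441)

light : ∀ {n} → ℕ → Word n → Bool
light r [] = true
light r (𝟎 ∷ x) = light r x
light zero (𝟏 ∷ x) = false
light zero (𝟐 ∷ x) = false
light (suc r) (𝟏 ∷ x) = light r x
light (suc r) (𝟐 ∷ x) = light r x

-- Runs over the words `u ++ v` with `v = acc ⊕ linComb u vs`, where `u` has weight at most `t` and
-- the whole word weight at most `r`. Each nonzero entry of `u` uses up one unit of both budgets,
-- which keeps the search small.
enum : ∀ {k m} → Vec (Word m) k → ℕ → ℕ → Word m → List (Word (k + m))
enum vs zero r acc = if light r acc then (zeroW Vec.++ acc) ∷ [] else []
enum [] (suc t) r acc = if light r acc then acc ∷ [] else []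
enum (v ∷ vs) (suc t) (suc r) acc =
  List.map (𝟎 ∷_) (enum vs (suc t) (suc r) acc) ++
  List.map (𝟏 ∷_) (enum vs t r (acc ⊕ v)) ++
  List.map (𝟐 ∷_) (enum vs t r (acc ⊕ negW v))
enum (v ∷ vs) (suc t) zero acc = List.map (𝟎 ∷_) (enum vs (suc t) zero acc)

-- Of two opposite words the one with first nonzero entry `𝟏` is taken; after that entry `enum`
-- continues with free signs.
enumN : ∀ {k m} → Vec (Word m) k → ℕ → ℕ → List (Word (k + m))
enumN [] t r = []
enumN (v ∷ vs) (suc t) (suc r) =
  List.map (𝟎 ∷_) (enumN vs (suc t) (suc r)) ++ List.map (𝟏 ∷_) (enum vs t r v)
enumN (v ∷ vs) t r = []

normalize : ∀ {n} → Word n → Word n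
normalize [] = []
normalize (𝟎 ∷ x) = 𝟎 ∷ normalize x
normalize (𝟏 ∷ x) = 𝟏 ∷ x
normalize (𝟐 ∷ x) = 𝟏 ∷ negW x

swapHalves : Word 24 → Word 24
swapHalves x with Vec.splitAt 12 x
... | u , v , _ = v Vec.++ u

heavyTail : ℕ → Word 24 → Bool
heavyTail t x with Vec.splitAt 12 x
... | u , v , _ = not (light t v)

opaque
  negTranspose : ∀ {k m} → Vec (Word m) k → Vec (Word k) m
  negTranspose A = tabulate λ j → tabulate λ i → neg (lookup (lookup A i) j)

  -- If the weight is at most `suc (s + t)`, then the left half has weight at most `s` or the right
  -- half weight at most `t`. The first kind is found from [I | A], the second from [-Aᵀ | I], which
  -- generates the same code; the filter drops the words already found.
  smallWords : ℕ → ℕ → Vec (Word 12) 12 → List (Word 24)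
  smallWords s t A = enumN A s (suc (s + t)) ++
    List.map (λ x → normalize (swapHalves x)) (List.filterᵇ (heavyTail s) (enumN (negTranspose A) t (suc (s + t))))

eqF : F3 → F3 → Bool
eqF 𝟎 𝟎 = true
eqF 𝟏 𝟏 = true
eqF 𝟐 𝟐 = true
eqF _ _ = false

eqW : ∀ {n} → Word n → Word n → Bool
eqW [] [] = true
eqW (x ∷ xs) (y ∷ ys) = eqF x y ∧ eqW xs ys

member : ∀ {k m} → Vec (Word m) k → Word m → Word (k + m) → Bool
member [] acc x = eqW acc x
member (v ∷ vs) acc (a ∷ x) = member vs (acc ⊕ (a · v)) x

code : Vec (Word 12) 12 → Code 24
code A = member A zeroW

-- Checking a stabilizer chain

-- One step of a stabilizer chain.  Among the points with the colour of the
-- base point, those flagged in mask are rejected: after marking the points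
-- extra as well, all ways to match the colours fail, either because the
-- hashes differ or because a word that depends only on the colours, equal to
-- test at the base point, lies in the code on one side only.  The number of
-- remaining candidates is size.
record Level : Set where
  constructor level
  field
    base : ℕ
    extra : List ℕ
    test : ℕ
    mask : ℕ
    size : ℕ

nth : ∀ {n} → List (Word n) → ℕ → Word n
nth [] _ = zeroW
nth (x ∷ xs) zero = x
nth (x ∷ xs) (suc i) = nth xs i

module Chain {n} (rounds : ℕ) (C : Code n) (W : Graph n) where

  refine : State n → State n
  refine = steps rounds W

  Table : Set
  Table = List (ℕ × F3)

  colorValue : Table → ℕ → F3
  colorValue [] c = 𝟎
  colorValue ((d , x) ∷ t) c = if c ≡ᵇ d then x else colorValue t c

  -- Exchanging the two colours negates the value. Hence painting commutes with monomial
  -- transformations, and an automorphism carries the word painted on one colouring to the word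
  -- painted on its image.
  paint : Table → Color → F3
  paint t (p , m) = colorValue t p +₃ neg (colorValue t m)

  table : ∀ {l} → Word l → State l → Table
  table [] [] = []
  table (𝟎 ∷ y) (_ ∷ st) = table y st
  table (x ∷ y) ((p , _) ∷ st) = (p , x) ∷ table y st

  colored : Table → State n → Bool
  -- An empty table arises from the test word 0 and leaves the comparison to the hash alone.
  colored [] ρ = true
  colored t@(_ ∷ _) ρ = C (map (paint t) ρ)

  leaf : ℕ → Table → Bool → State n → Bool
  leaf h t c σ = decide (refine σ)
    where
    decide : State n → Bool
    decide ρ = not (hash ρ ≡ᵇ h) ∨ (colored t ρ xor c)

  node : ℕ → ℕ → ℕ → (State n → Bool) → State n → Bool
  node k h c rest σ = decide (refine σ)
    where
    decide : State n → Bool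
    decide ρ = not (hash ρ ≡ᵇ h) ∨
      all (λ q → not (colorSum q ρ ≡ᵇ c) ∨ rest (mark k q ρ)) (points n)

  -- The value `true` certifies that no automorphism carries `σ` to the other state; `false` claims
  -- nothing. Hash, colours and table of the base state are computed before a candidate is supplied,
  -- so that all candidates share them.
  differs : ℕ → List (Word n) → Word n → State n → State n → Bool
  differs k [] y σ = on (refine σ)
    where
    with-table : State n → Table → State n → Bool
    with-table ρ t = leaf (hash ρ) t (colored t ρ)
    on : State n → State n → Bool
    on ρ = with-table ρ (table y ρ)
  differs k (b ∷ bs) y σ = on (refine σ)
    where
    on : State n → State n → Bool
    on ρ = node k (hash ρ) (colorSum b ρ) (differs (suc k) bs y (mark k b ρ))

  -- The mask only tells where the rejection test is worth running: a clear bit keeps the candidate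
  -- untested, and a set bit removes it only if the test succeeds.
  survivors : (Word n → Bool) → ℕ → List (Word n) → ℕ
  survivors d mask [] = 0
  survivors d mask (q ∷ qs) =
    (if (mask % 2 ≡ᵇ 1) ∧ d q then 0 else 1) + survivors d (mask / 2) qs

  sameColor : Word n → State n → List (Word n)
  sameColor b ρ = go (colorSum b ρ)
    where
    go : ℕ → List (Word n)
    go c = List.filterᵇ (λ q → colorSum q ρ ≡ᵇ c) (points n)

  distinct : List ℕ → Bool
  distinct [] = true
  distinct (x ∷ xs) = all (λ y → not (x ≡ᵇ y)) xs ∧ distinct xs

  allColors : State n → List ℕ
  allColors ρ = List.map (λ q → colorSum q ρ) (points n)

  passes : ℕ → State n → Word n → ℕ → ℕ → (State n → Bool) → Bool
  passes k ρ b mask size d = survivors (λ q → d (mark k q ρ)) mask (sameColor b ρ) ≡ᵇ size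

  -- The first argument is the number of rounds before the next base point; all later levels use
  -- `rounds`. When the chain ends, the signed coordinates must have pairwise distinct colours, so
  -- that only the identity preserves the colouring.
  chain : ℕ → ℕ → State n → List Level → Bool
  chain r k σ [] = distinct (allColors (steps r W σ))
  chain r k σ (level base extra test mask size ∷ ls) =
    descend (nth (points n) base) (List.map (nth (points n)) extra) (steps r W σ)
    where
    descend : Word n → List (Word n) → State n → Bool
    descend b bs ρ =
      all (λ x → wt x ≡ᵇ 1) (b ∷ bs) ∧
      (passes k ρ b mask size (differs (suc k) bs (trits n test) (mark k b ρ)) ∧
      chain rounds (suc k) (mark k b ρ) ls)

-- Invariance of colour refinement

true≢false : true ≢ false
true≢false ()

∧-split : ∀ {a b} → a ∧ b ≡ true → a ≡ true × b ≡ true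
∧-split {true} {true} e = refl , refl

≡ᵇ-true : ∀ {a b} → (a ≡ᵇ b) ≡ true → a ≡ b
≡ᵇ-true {a} {b} e = ≡ᵇ⇒≡ a b (subst T (sym e) tt)

≡ᵇ-refl : ∀ a → (a ≡ᵇ a) ≡ true
≡ᵇ-refl zero = refl
≡ᵇ-refl (suc a) = ≡ᵇ-refl a

all-∈ : ∀ (f : A → Bool) {xs x} → all f xs ≡ true → x ∈ xs → f x ≡ true
all-∈ f e (here refl) = proj₁ (∧-split e)
all-∈ f {x ∷ xs} e (there i) = all-∈ f (proj₂ (∧-split {f x} e)) i

all-false : ∀ (f : A → Bool) {xs x} → x ∈ xs → f x ≡ false → all f xs ≡ false
all-false f {x ∷ xs} i e with all f (x ∷ xs) in e′
... | false = refl
... | true = ⊥-elim (true≢false (trans (sym (all-∈ f e′ i)) e))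

swapColor : Color → Color
swapColor (p , m) = m , p

negW-involutive : ∀ (x : Word n) → negW (negW x) ≡ x
negW-involutive [] = refl
negW-involutive (x ∷ xs) = cong₂ _∷_ (neg-involutive x) (negW-involutive xs)

pick : F3 → Color → ℕ
pick 𝟎 c = 0
pick 𝟏 (p , m) = p
pick 𝟐 (p , m) = m

pick-swap : ∀ x c → pick (neg x) (swapColor c) ≡ pick x c
pick-swap 𝟎 c = refl
pick-swap 𝟏 c = refl
pick-swap 𝟐 c = refl

place-swap : ∀ a b x c → place a b (neg x) (swapColor c) ≡ swapColor (place a b x c)
place-swap a b 𝟎 c = refl
place-swap a b 𝟏 c = refl
place-swap a b 𝟐 c = refl

place-neg : ∀ a b x c → place b a (neg x) c ≡ place a b x c
place-neg a b 𝟎 c = refl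
place-neg a b 𝟏 c = refl
place-neg a b 𝟐 c = refl

-- Contributions of different words commute, which makes a refinement round independent of the order
-- in which the words are listed.
place-comm : ∀ a b a′ b′ x y c → place a b x (place a′ b′ y c) ≡ place a′ b′ y (place a b x c)
place-comm a b a′ b′ x y c = go x y
  where
  sw : ∀ p u v → p + u + v ≡ p + v + u
  sw p u v = trans (+-assoc p u v) (trans (cong (p +_) (+-comm u v)) (sym (+-assoc p v u)))
  go : ∀ x y → place a b x (place a′ b′ y c) ≡ place a′ b′ y (place a b x c)
  go 𝟎 y = refl
  go 𝟏 𝟎 = refl
  go 𝟐 𝟎 = refl
  go 𝟏 𝟏 = cong₂ _,_ (sw (proj₁ c) a′ a) (sw (proj₂ c) b′ b)
  go 𝟏 𝟐 = cong₂ _,_ (sw (proj₁ c) b′ a) (sw (proj₂ c) a′ b)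
  go 𝟐 𝟏 = cong₂ _,_ (sw (proj₁ c) a′ b) (sw (proj₂ c) b′ a)
  go 𝟐 𝟐 = cong₂ _,_ (sw (proj₁ c) b′ b) (sw (proj₂ c) a′ a)

mix-swap : ∀ c d → mix (swapColor c) (swapColor d) ≡ swapColor (mix c d)
mix-swap c d = refl

colorSum-sum : ∀ (w : Word n) st → colorSum w st ≡ sum (zipWith pick w st)
colorSum-sum [] [] = refl
colorSum-sum (𝟎 ∷ w) (c ∷ st) = colorSum-sum w st
colorSum-sum (𝟏 ∷ w) ((p , m) ∷ st) = cong (p +_) (colorSum-sum w st)
colorSum-sum (𝟐 ∷ w) ((p , m) ∷ st) = cong (m +_) (colorSum-sum w st)

overlapHash-sum : ∀ (x y : Word n) a b → overlapHash x y a b ≡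
  scramble (sum (zipWith agree x y) + a + 3) + scramble (sum (zipWith disagree x y) + b + 3)
overlapHash-sum [] [] a b = refl
overlapHash-sum (𝟎 ∷ x) (𝟎 ∷ y) a b = overlapHash-sum x y a b
overlapHash-sum (𝟎 ∷ x) (𝟏 ∷ y) a b = overlapHash-sum x y a b
overlapHash-sum (𝟎 ∷ x) (𝟐 ∷ y) a b = overlapHash-sum x y a b
overlapHash-sum (𝟏 ∷ x) (𝟎 ∷ y) a b = overlapHash-sum x y a b
overlapHash-sum (𝟐 ∷ x) (𝟎 ∷ y) a b = overlapHash-sum x y a b
overlapHash-sum (𝟏 ∷ x) (𝟏 ∷ y) a b = trans (overlapHash-sum x y (suc a) b)
  (cong (λ z → scramble (z + 3) + scramble (sum (zipWith disagree x y) + b + 3)) (+-suc (sum (zipWith agree x y)) a))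
overlapHash-sum (𝟐 ∷ x) (𝟐 ∷ y) a b = trans (overlapHash-sum x y (suc a) b)
  (cong (λ z → scramble (z + 3) + scramble (sum (zipWith disagree x y) + b + 3)) (+-suc (sum (zipWith agree x y)) a))
overlapHash-sum (𝟏 ∷ x) (𝟐 ∷ y) a b = trans (overlapHash-sum x y a (suc b))
  (cong (λ z → scramble (sum (zipWith agree x y) + a + 3) + scramble (z + 3)) (+-suc (sum (zipWith disagree x y)) b))
overlapHash-sum (𝟐 ∷ x) (𝟏 ∷ y) a b = trans (overlapHash-sum x y a (suc b))
  (cong (λ z → scramble (sum (zipWith agree x y) + a + 3) + scramble (z + 3)) (+-suc (sum (zipWith disagree x y)) b))

agree-neg : ∀ x y → agree (neg x) (neg y) ≡ agree x y
agree-neg = toWitness {a? = all₃? λ x → all₃? λ y → (agree (neg x) (neg y)) ℕₚ.≟ (agree x y)} _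

disagree-neg : ∀ x y → disagree (neg x) (neg y) ≡ disagree x y
disagree-neg = toWitness {a? = all₃? λ x → all₃? λ y → (disagree (neg x) (neg y)) ℕₚ.≟ (disagree x y)} _

agree-swap : ∀ x y → agree x (neg y) ≡ disagree x y
agree-swap = toWitness {a? = all₃? λ x → all₃? λ y → (agree x (neg y)) ℕₚ.≟ (disagree x y)} _

disagree-swap : ∀ x y → disagree x (neg y) ≡ agree x y
disagree-swap = toWitness {a? = all₃? λ x → all₃? λ y → (disagree x (neg y)) ℕₚ.≟ (agree x y)} _

zipWith-negʳ : ∀ {f g : F3 → F3 → ℕ} → (∀ x y → f x (neg y) ≡ g x y) →
  ∀ (x y : Word n) → zipWith f x (negW y) ≡ zipWith g x y
zipWith-negʳ h [] [] = refl
zipWith-negʳ h (x ∷ xs) (y ∷ ys) = cong₂ _∷_ (h x y) (zipWith-negʳ h xs ys)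

zipWith-neg² : ∀ {f : F3 → F3 → ℕ} → (∀ x y → f (neg x) (neg y) ≡ f x y) →
  ∀ (x y : Word n) → zipWith f (negW x) (negW y) ≡ zipWith f x y
zipWith-neg² h [] [] = refl
zipWith-neg² h (x ∷ xs) (y ∷ ys) = cong₂ _∷_ (h x y) (zipWith-neg² h xs ys)

overlapHash-negʳ : ∀ (x y : Word n) → overlapHash x (negW y) 0 0 ≡ overlapHash x y 0 0
overlapHash-negʳ x y = begin
  overlapHash x (negW y) 0 0 ≡⟨ overlapHash-sum x (negW y) 0 0 ⟩
  _ ≡⟨ cong₂ (λ u v → scramble (sum u + 0 + 3) + scramble (sum v + 0 + 3))
         (zipWith-negʳ agree-swap x y) (zipWith-negʳ disagree-swap x y) ⟩
  scramble (sum (zipWith disagree x y) + 0 + 3) + scramble (sum (zipWith agree x y) + 0 + 3)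
    ≡⟨ +-comm (scramble (sum (zipWith disagree x y) + 0 + 3)) _ ⟩
  _ ≡⟨ sym (overlapHash-sum x y 0 0) ⟩
  overlapHash x y 0 0 ∎ where open ≡-Reasoning

overlapHash-neg² : ∀ (x y : Word n) → overlapHash (negW x) (negW y) 0 0 ≡ overlapHash x y 0 0
overlapHash-neg² x y = begin
  overlapHash (negW x) (negW y) 0 0 ≡⟨ overlapHash-sum (negW x) (negW y) 0 0 ⟩
  _ ≡⟨ cong₂ (λ u v → scramble (sum u + 0 + 3) + scramble (sum v + 0 + 3))
         (zipWith-neg² agree-neg x y) (zipWith-neg² disagree-neg x y) ⟩
  _ ≡⟨ sym (overlapHash-sum x y 0 0) ⟩
  overlapHash x y 0 0 ∎ where open ≡-Reasoning

overlapHash-negˡ : ∀ (x y : Word n) → overlapHash (negW x) y 0 0 ≡ overlapHash x y 0 0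
overlapHash-negˡ x y = trans (sym (overlapHash-negʳ (negW x) y)) (overlapHash-neg² x y)

normalize-cases : ∀ (x : Word n) → normalize x ≡ x ⊎ normalize x ≡ negW x
normalize-cases [] = inj₁ refl
normalize-cases (𝟎 ∷ x) with normalize-cases x
... | inj₁ e = inj₁ (cong (𝟎 ∷_) e)
... | inj₂ e = inj₂ (cong (𝟎 ∷_) e)
normalize-cases (𝟏 ∷ x) = inj₁ refl
normalize-cases (𝟐 ∷ x) = inj₂ refl

normalize-idem : ∀ (x : Word n) → normalize (normalize x) ≡ normalize x
normalize-idem [] = refl
normalize-idem (𝟎 ∷ x) = cong (𝟎 ∷_) (normalize-idem x)
normalize-idem (𝟏 ∷ x) = refl
normalize-idem (𝟐 ∷ x) = refl

normalize-neg : ∀ (x : Word n) → normalize (negW x) ≡ normalize x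
normalize-neg [] = refl
normalize-neg (𝟎 ∷ x) = cong (𝟎 ∷_) (normalize-neg x)
normalize-neg (𝟏 ∷ x) = cong (𝟏 ∷_) (negW-involutive x)
normalize-neg (𝟐 ∷ x) = refl

-- Transformations do not respect the chosen representatives of pairs of opposite words. Everything
-- derived from a listed word is even, and for even functions the representative is immaterial.
normalize-even : ∀ (f : Word n → A) → (∀ x → f (negW x) ≡ f x) → ∀ x → f (normalize x) ≡ f x
normalize-even f h x with normalize-cases x
... | inj₁ e = cong f e
... | inj₂ e = trans (cong f e) (h x)

nonzero : F3 → ℕ
nonzero 𝟎 = 0
nonzero 𝟏 = 1
nonzero 𝟐 = 1

wt-sum : ∀ (x : Word n) → wt x ≡ sum (map nonzero x)
wt-sum [] = refl
wt-sum (𝟎 ∷ x) = wt-sum x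
wt-sum (𝟏 ∷ x) = cong suc (wt-sum x)
wt-sum (𝟐 ∷ x) = cong suc (wt-sum x)

wt-neg : ∀ (x : Word n) → wt (negW x) ≡ wt x
wt-neg [] = refl
wt-neg (𝟎 ∷ x) = wt-neg x
wt-neg (𝟏 ∷ x) = cong suc (wt-neg x)
wt-neg (𝟐 ∷ x) = cong suc (wt-neg x)

wt-zeroW : ∀ n → wt (zeroW {n}) ≡ 0
wt-zeroW zero = refl
wt-zeroW (suc n) = wt-zeroW n

wt≡0 : ∀ (x : Word n) → wt x ≡ 0 → x ≡ zeroW
wt≡0 [] e = refl
wt≡0 (𝟎 ∷ x) e = cong (𝟎 ∷_) (wt≡0 x e)

points-complete : ∀ (x : Word n) → wt x ≡ 1 → x ∈ points n
points-complete (𝟎 ∷ x) e = there (there (∈-map⁺ (𝟎 ∷_) (points-complete x e)))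
points-complete (𝟏 ∷ x) e = here (cong (𝟏 ∷_) (wt≡0 x (ℕₚ.suc-injective e)))
points-complete (𝟐 ∷ x) e = there (here (cong (𝟐 ∷_) (wt≡0 x (ℕₚ.suc-injective e))))

points-sound : ∀ {x : Word n} → x ∈ points n → wt x ≡ 1
points-sound {suc n} (here refl) = cong suc (wt-zeroW n)
points-sound {suc n} (there (here refl)) = cong suc (wt-zeroW n)
points-sound {suc n} (there (there i)) with ∈-map⁻ (𝟎 ∷_) i
... | y , j , refl = points-sound j

hash-sum : ∀ (st : State n) → hash st ≡ sum (map (λ c → hash (c ∷ [])) st)
hash-sum [] = refl
hash-sum ((p , m) ∷ st) = cong₂ _+_ (sym (ℕₚ.+-identityʳ _)) (hash-sum st)

contribute : State n → ℕ → Word n → State n → State n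
contribute st c w = zipWith (place (scramble (c + colorSum w st)) (scramble (c + colorSum (negW w) st))) w

contribute-neg : ∀ (st : State n) c w acc → contribute st c (negW w) acc ≡ contribute st c w acc
contribute-neg st c w acc = trans
  (cong (λ v → zipWith (place (scramble (c + colorSum (negW w) st)) (scramble (c + colorSum v st))) (negW w) acc)
    (negW-involutive w))
  (go w acc)
  where
  go : ∀ {n a b} (w : Word n) acc → zipWith (place b a) (negW w) acc ≡ zipWith (place a b) w acc
  go [] [] = refl
  go (x ∷ w) (c ∷ acc) = cong₂ _∷_ (place-neg _ _ x c) (go w acc)

contribute-comm : ∀ (st : State n) c w c′ w′ acc →
  contribute st c w (contribute st c′ w′ acc) ≡ contribute st c′ w′ (contribute st c w acc)
contribute-comm st c w c′ w′ acc = go w w′ acc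
  where
  go : ∀ {n a b a′ b′} (w w′ : Word n) acc → zipWith (place a b) w (zipWith (place a′ b′) w′ acc) ≡
    zipWith (place a′ b′) w′ (zipWith (place a b) w acc)
  go [] [] [] = refl
  go (x ∷ w) (y ∷ w′) (c ∷ acc) = cong₂ _∷_ (place-comm _ _ _ _ x y c) (go w w′ acc)

gather : State n → List (ℕ × Word n) → State n
gather st [] = replicate _ (0 , 0)
gather st ((c , w) ∷ ws) = contribute st c w (gather st ws)

+-slide : ∀ a b c → a + (b + c) ≡ (b + a) + c
+-slide a b c = trans (sym (+-assoc a b c)) (cong (_+ c) (+-comm a b))

rehash-sum : ∀ c (w : Word n) st a b → rehash c w st a b ≡
  (scramble (c + (colorSum w st + a)) , scramble (c + (colorSum (negW w) st + b)))
rehash-sum c [] [] a b = refl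
rehash-sum c (𝟎 ∷ w) (_ ∷ st) a b = rehash-sum c w st a b
rehash-sum c (𝟏 ∷ w) ((p , m) ∷ st) a b = trans (rehash-sum c w st (p + a) (m + b))
  (cong₂ (λ x y → scramble (c + x) , scramble (c + y)) (+-slide (colorSum w st) p a) (+-slide (colorSum (negW w) st) m b))
rehash-sum c (𝟐 ∷ w) ((p , m) ∷ st) a b = trans (rehash-sum c w st (m + a) (p + b))
  (cong₂ (λ x y → scramble (c + x) , scramble (c + y)) (+-slide (colorSum w st) m a) (+-slide (colorSum (negW w) st) p b))

accumulate-gather : ∀ (st : State n) (f : Word n → ℕ) H →
  accumulate st (columns H) (List.map (λ w → f w , w) H) ≡ gather st (List.map (λ w → f w , w) H)
accumulate-gather {n} st f [] = Vecₚ.map-replicate (λ col → collect col []) [] n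
accumulate-gather st f (w ∷ H) = trans (go (rehash (f w) w st 0 0) w (columns H))
  (cong₂ (λ (a , b) acc → zipWith (place a b) w acc)
    (trans (rehash-sum (f w) w st 0 0)
      (cong₂ (λ x y → scramble (f w + x) , scramble (f w + y)) (ℕₚ.+-identityʳ _) (ℕₚ.+-identityʳ _)))
    (accumulate-gather st f H))
  where
  go : ∀ {k hs} h (w : Word k) cols →
    collectAll (zipWith _∷_ w cols) (h ∷ hs) ≡ zipWith (place (proj₁ h) (proj₂ h)) w (collectAll cols hs)
  go h [] [] = refl
  go h (𝟎 ∷ w) (c ∷ cols) = cong (_ ∷_) (go h w cols)
  go h (𝟏 ∷ w) (c ∷ cols) = cong (_ ∷_) (go h w cols)
  go h (𝟐 ∷ w) (c ∷ cols) = cong (_ ∷_) (go h w cols)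

gather-↭ : ∀ (st : State n) {ws ws′} → ws ↭ ws′ → gather st ws ≡ gather st ws′
gather-↭ st Perm.refl = refl
gather-↭ st (Perm.prep (c , w) p) = cong (contribute st c w) (gather-↭ st p)
gather-↭ st (Perm.swap (c , w) (c′ , w′) p) = trans
  (cong (λ a → contribute st c w (contribute st c′ w′ a)) (gather-↭ st p)) (contribute-comm st c w c′ w′ _)
gather-↭ st (Perm.trans p q) = trans (gather-↭ st p) (gather-↭ st q)

overlapSum-↭ : ∀ (w : Word n) {H H′} → H ↭ H′ → overlapSum H w ≡ overlapSum H′ w
overlapSum-↭ w Perm.refl = refl
overlapSum-↭ w (Perm.prep x p) = cong (overlapHash w x 0 0 +_) (overlapSum-↭ w p)
overlapSum-↭ w (Perm.swap x y p) = trans (sym (+-assoc (overlapHash w x 0 0) _ _))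
  (trans (cong₂ _+_ (+-comm (overlapHash w x 0 0) _) (overlapSum-↭ w p)) (+-assoc (overlapHash w y 0 0) _ _))
overlapSum-↭ w (Perm.trans p q) = trans (overlapSum-↭ w p) (overlapSum-↭ w q)

weigh-↭ : ∀ (w : Word n) {H H′} → H ↭ H′ → weigh H w ≡ weigh H′ w
weigh-↭ w p = cong₂ (λ l s → if l ≤ᵇ 120 then s else 0) (↭-length p) (overlapSum-↭ w p)

module Invariance (h : Sym n) where
  open Sym h

  hW : Word n → Word n
  hW = app neg

  hS : State n → State n
  hS = app swapColor

  hW-neg : ∀ x → hW (negW x) ≡ negW (hW x)
  hW-neg = app-map neg (λ x → refl)

  wt-hW : ∀ x → wt (hW x) ≡ wt x
  wt-hW x = begin
    wt (hW x) ≡⟨ wt-sum (hW x) ⟩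
    sum (map nonzero (hW x)) ≡⟨ cong sum (sym (app-map nonzero nz-neg x)) ⟩
    sum (app id (map nonzero x)) ≡⟨ app-sum _ ⟩
    sum (map nonzero x) ≡⟨ sym (wt-sum x) ⟩
    wt x ∎
    where
    open ≡-Reasoning
    nz-neg : ∀ x → nonzero (neg x) ≡ nonzero x
    nz-neg 𝟎 = refl
    nz-neg 𝟏 = refl
    nz-neg 𝟐 = refl

  sum-zip : ∀ {i : X → X} {j : Y → Y} (f : X → Y → ℕ) → (∀ x y → f (i x) (j y) ≡ f x y) →
    ∀ xs ys → sum (zipWith f (app i xs) (app j ys)) ≡ sum (zipWith f xs ys)
  sum-zip f e xs ys = trans (cong sum (sym (app-zipWith f e xs ys))) (app-sum _)

  colorSum-h : ∀ w st → colorSum (hW w) (hS st) ≡ colorSum w st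
  colorSum-h w st = trans (colorSum-sum (hW w) (hS st))
    (trans (sum-zip pick pick-swap w st) (sym (colorSum-sum w st)))

  overlapHash-h : ∀ x y → overlapHash (hW x) (hW y) 0 0 ≡ overlapHash x y 0 0
  overlapHash-h x y = trans (overlapHash-sum (hW x) (hW y) 0 0)
    (trans (cong₂ (λ u v → scramble (u + 0 + 3) + scramble (v + 0 + 3))
      (sum-zip agree agree-neg x y) (sum-zip disagree disagree-neg x y)) (sym (overlapHash-sum x y 0 0)))

  hash-h : ∀ st → hash (hS st) ≡ hash st
  hash-h st = begin
    hash (hS st) ≡⟨ hash-sum (hS st) ⟩
    sum (map (λ c → hash (c ∷ [])) (hS st)) ≡⟨ cong sum (sym (app-map (λ c → hash (c ∷ [])) one st)) ⟩
    sum (app id (map (λ c → hash (c ∷ [])) st)) ≡⟨ app-sum _ ⟩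
    sum (map (λ c → hash (c ∷ [])) st) ≡⟨ sym (hash-sum st) ⟩
    hash st ∎
    where
    open ≡-Reasoning
    one : ∀ c → hash (swapColor c ∷ []) ≡ hash (c ∷ [])
    one (p , m) = cong (_+ 0) (+-comm _ (square p))

  mark-h : ∀ k p st → hS (mark k p st) ≡ mark k (hW p) (hS st)
  mark-h k p st = app-zipWith (place _ 0) (place-swap _ 0) p st

  start-h : hS start ≡ start
  start-h = app-replicate (1 , 1) refl

  -- The image of `w` is listed only up to sign. Evenness removes the normalization, and both colour
  -- sums are preserved, so the rest is the equivariance of `place`.
  contribute-h : ∀ st c w acc → contribute (hS st) c (normalize (hW w)) (hS acc) ≡ hS (contribute st c w acc)
  contribute-h st c w acc = begin
    contribute (hS st) c (normalize (hW w)) (hS acc)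
      ≡⟨ normalize-even (λ x → contribute (hS st) c x (hS acc)) (λ x → contribute-neg (hS st) c x _) (hW w) ⟩
    contribute (hS st) c (hW w) (hS acc)
      ≡⟨ cong₂ (λ a b → zipWith (place (scramble (c + a)) (scramble (c + b))) (hW w) (hS acc))
           (colorSum-h w st)
           (trans (cong (λ x → colorSum x (hS st)) (sym (hW-neg w))) (colorSum-h (negW w) st)) ⟩
    zipWith (place (scramble (c + colorSum w st)) (scramble (c + colorSum (negW w) st))) (hW w) (hS acc)
      ≡⟨ sym (app-zipWith (place _ _) (place-swap _ _) w acc) ⟩
    hS (contribute st c w acc) ∎ where open ≡-Reasoning

  overlapSum-h : ∀ H w → overlapSum (List.map (normalize ∘ hW) H) (normalize (hW w)) ≡ overlapSum H w
  overlapSum-h [] w = refl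
  overlapSum-h (v ∷ H) w = cong₂ _+_ (begin
    overlapHash (normalize (hW w)) (normalize (hW v)) 0 0
      ≡⟨ normalize-even (λ x → overlapHash x (normalize (hW v)) 0 0) (λ x → overlapHash-negˡ x _) (hW w) ⟩
    overlapHash (hW w) (normalize (hW v)) 0 0
      ≡⟨ normalize-even (λ x → overlapHash (hW w) x 0 0) (overlapHash-negʳ (hW w)) (hW v) ⟩
    overlapHash (hW w) (hW v) 0 0 ≡⟨ overlapHash-h w v ⟩
    overlapHash w v 0 0 ∎) (overlapSum-h H w)
    where open ≡-Reasoning

  module _ (H H′ : List (Word n)) (H↭ : List.map (normalize ∘ hW) H ↭ H′) where

    weigh-h : ∀ w → weigh H′ (normalize (hW w)) ≡ weigh H w
    weigh-h w = trans (weigh-↭ (normalize (hW w)) (↭-sym H↭))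
      (cong₂ (λ l s → if l ≤ᵇ 120 then s else 0) (Listₚ.length-map (normalize ∘ hW) H) (overlapSum-h H w))

    heavy heavy′ : List (ℕ × Word n)
    heavy = List.map (λ w → weigh H w , w) H
    heavy′ = List.map (λ w → weigh H′ w , w) H′

    gather-h : ∀ st → gather (hS st) heavy′ ≡ hS (gather st heavy)
    gather-h st = trans (sym (gather-↭ (hS st) (map⁺ (λ w → weigh H′ w , w) H↭))) (go H)
      where
      go : ∀ L → gather (hS st) (List.map (λ w → weigh H′ w , w) (List.map (normalize ∘ hW) L)) ≡
        hS (gather st (List.map (λ w → weigh H w , w) L))
      go [] = sym (app-replicate (0 , 0) refl)
      go (w ∷ L) = trans (cong₂ (λ c a → contribute (hS st) c (normalize (hW w)) a) (weigh-h w) (go L))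
        (contribute-h st (weigh H w) w _)

    -- One round is a `zipWith mix` with a sum over the listed words. `mix` is equivariant, and the
    -- sum sees the list only up to sign and order, which is all that `H↭` provides.
    steps-h : ∀ r st → steps r (weighted H′) (hS st) ≡ hS (steps r (weighted H) st)
    steps-h zero st = refl
    steps-h (suc r) st = trans (cong (steps r (weighted H′)) (begin
      step (weighted H′) (hS st)                          ≡⟨ cong (zipWith mix (hS st)) (accumulate-gather (hS st) (weigh H′) H′) ⟩
      zipWith mix (hS st) (gather (hS st) heavy′)         ≡⟨ cong (zipWith mix (hS st)) (gather-h st) ⟩
      zipWith mix (hS st) (hS (gather st heavy))          ≡⟨ sym (app-zipWith mix mix-swap st _) ⟩
      hS (zipWith mix st (gather st heavy))               ≡⟨ cong (hS ∘ zipWith mix st) (sym (accumulate-gather st (weigh H) H)) ⟩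
      hS (step (weighted H) st) ∎)) (steps-h r (step (weighted H) st))
      where open ≡-Reasoning

-- Words of small weight under isomorphisms

_≟W_ : DecidableEquality (Word n)
_≟W_ = Vecₚ.≡-dec _≟F_

Unique-map : ∀ {f : A → B} {xs} → (∀ {x y} → x ∈ xs → y ∈ xs → f x ≡ f y → x ≡ y) → Unique xs → Unique (List.map f xs)
Unique-map inj [] = []
Unique-map {f = f} {x ∷ xs} inj (x∉ ∷ u) = go ∷ Unique-map (λ i j → inj (there i) (there j)) u
  where
  go : All (f x ≢_) (List.map f xs)
  go = All.tabulate λ i e → case ∈-map⁻ f i of λ where
    (y , j , refl) → All.lookup x∉ j (inj (here refl) (there j) e)

Unique-same-↭ : ∀ {xs ys : List A} → Unique xs → Unique ys → (∀ {x} → x ∈ xs → x ∈ ys) → (∀ {x} → x ∈ ys → x ∈ xs) → xs ↭ ys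
Unique-same-↭ u v f g = ∼bag⇒↭ (unique∧set⇒bag u v (mk⇔ f g))

-- The nonzero words of weight at most r of a code, up to sign.
record Minors (r : ℕ) (C : Code n) (H : List (Word n)) : Set where
  field
    even : ∀ x → C (negW x) ≡ C x
    unique : Unique H
    sound : ∀ {x} → x ∈ H → C x ≡ true × wt x ≤ r × normalize x ≡ x × x ≢ zeroW
    complete : ∀ {x} → C x ≡ true → wt x ≤ r → normalize x ≡ x → x ≢ zeroW → x ∈ H

wt-normalize : ∀ (x : Word n) → wt (normalize x) ≡ wt x
wt-normalize = normalize-even wt wt-neg

negW-zeroW : negW (zeroW {n}) ≡ zeroW
negW-zeroW {n} = Vecₚ.map-replicate neg 𝟎 n

normalize-zero : ∀ {x : Word n} → normalize x ≡ zeroW → x ≡ zeroW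
normalize-zero {x = x} e with normalize-cases x
... | inj₁ p = trans (sym p) e
... | inj₂ p = trans (sym (negW-involutive x)) (trans (cong negW (trans (sym p) e)) negW-zeroW)

module _ (h h⁻ : Sym n) where
  private
    module I = Invariance h
    module J = Invariance h⁻

  -- Both lists are free of duplicates, so a permutation follows from equal membership. This holds
  -- because each list is complete and the weight is invariant under `h` and `h⁻`.
  minors-↭ : ∀ {r} {C C′ : Code n} {H H′} → Minors r C H → Minors r C′ H′ →
    (∀ x → J.hW (I.hW x) ≡ x) → (∀ x → I.hW (J.hW x) ≡ x) → (∀ x → C′ (I.hW x) ≡ C x) →
    List.map (normalize ∘ I.hW) H ↭ H′
  minors-↭ {r} {C} {C′} {H} {H′} M M′ inv inv′ e =
    Unique-same-↭ (Unique-map inj (Minors.unique M)) (Minors.unique M′) fwd bwd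
    where
    module M = Minors M
    module M′ = Minors M′
    norm-J : ∀ x → normalize (J.hW (normalize x)) ≡ normalize (J.hW x)
    norm-J = normalize-even (normalize ∘ J.hW) λ x → trans (cong normalize (J.hW-neg x)) (normalize-neg (J.hW x))
    norm-I : ∀ x → normalize (I.hW (normalize x)) ≡ normalize (I.hW x)
    norm-I = normalize-even (normalize ∘ I.hW) λ x → trans (cong normalize (I.hW-neg x)) (normalize-neg (I.hW x))
    back : ∀ {x} → x ∈ H → normalize (J.hW (normalize (I.hW x))) ≡ x
    back {x} i = trans (norm-J (I.hW x)) (trans (cong normalize (inv x)) (proj₁ (proj₂ (proj₂ (M.sound i)))))
    inj : ∀ {x y} → x ∈ H → y ∈ H → normalize (I.hW x) ≡ normalize (I.hW y) → x ≡ y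
    inj i j e = trans (sym (back i)) (trans (cong (normalize ∘ J.hW) e) (back j))
    zero-I : ∀ {x} → I.hW x ≡ zeroW → x ≡ zeroW
    zero-I {x} p = trans (sym (inv x)) (trans (cong J.hW p) (Sym.app-replicate h⁻ 𝟎 refl))
    zero-J : ∀ {x} → J.hW x ≡ zeroW → x ≡ zeroW
    zero-J {x} p = trans (sym (inv′ x)) (trans (cong I.hW p) (Sym.app-replicate h 𝟎 refl))
    fwd : ∀ {x} → x ∈ List.map (normalize ∘ I.hW) H → x ∈ H′
    fwd i with ∈-map⁻ (normalize ∘ I.hW) i
    ... | w , j , refl = let (c , l , _ , z) = M.sound j in M′.complete
      (trans (normalize-even C′ M′.even (I.hW w)) (trans (e w) c))
      (subst (_≤ r) (sym (trans (wt-normalize (I.hW w)) (I.wt-hW w))) l)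
      (normalize-idem (I.hW w)) (z ∘ zero-I ∘ normalize-zero)
    bwd : ∀ {x} → x ∈ H′ → x ∈ List.map (normalize ∘ I.hW) H
    bwd {x} i = subst (_∈ List.map (normalize ∘ I.hW) H) eq (∈-map⁺ (normalize ∘ I.hW) mem)
      where
      s = M′.sound i
      mem : normalize (J.hW x) ∈ H
      mem = M.complete
        (trans (normalize-even C M.even (J.hW x)) (trans (sym (e (J.hW x))) (trans (cong C′ (inv′ x)) (proj₁ s))))
        (subst (_≤ r) (sym (trans (wt-normalize (J.hW x)) (J.wt-hW x))) (proj₁ (proj₂ s)))
        (normalize-idem (J.hW x)) (proj₂ (proj₂ (proj₂ s)) ∘ zero-J ∘ normalize-zero)
      eq : normalize (I.hW (normalize (J.hW x))) ≡ x
      eq = trans (norm-I (J.hW x)) (trans (cong normalize (inv′ x)) (proj₁ (proj₂ (proj₂ s))))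

pushW pullW : Mono n → Word n → Word n
pushW = push neg
pullW = pull neg

insertAt-unit : ∀ {x y : F3} i j → x ≢ 𝟎 → y ≢ 𝟎 → insertAt (zeroW {n}) i x ≡ insertAt zeroW j y → i ≡ j × x ≡ y
insertAt-unit zero zero p q e = refl , proj₁ (Vecₚ.∷-injective e)
insertAt-unit {suc n} zero (suc j) p q e = ⊥-elim (p (proj₁ (Vecₚ.∷-injective e)))
insertAt-unit {suc n} (suc i) zero p q e = ⊥-elim (q (sym (proj₁ (Vecₚ.∷-injective e))))
insertAt-unit {suc n} (suc i) (suc j) p q e with insertAt-unit i j p q (proj₂ (Vecₚ.∷-injective e))
... | refl , e′ = refl , e′

flip-nonzero : ∀ s → flip neg s 𝟏 ≢ 𝟎
flip-nonzero false ()
flip-nonzero true ()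

flip-𝟏-injective : ∀ s t → flip neg s 𝟏 ≡ flip neg t 𝟏 → s ≡ t
flip-𝟏-injective false false e = refl
flip-𝟏-injective true true e = refl

-- The image of the first unit vector reveals the first position and sign; deleting that position
-- leaves the remaining code, and induction applies.
push-faithful : ∀ (g g′ : Mono n) → (∀ p → wt p ≡ 1 → pushW g p ≡ pushW g′ p) → g ≡ g′
push-faithful {zero} g g′ e = refl
push-faithful {suc n} (j , s , g) (j′ , s′ , g′) e = cong₂ (λ a b → a , b) (proj₁ eq₁)
  (cong₂ _,_ (flip-𝟏-injective s s′ (proj₂ eq₁)) (push-faithful g g′ λ p w → rest p w))
  where
  head = e (𝟏 ∷ zeroW) (cong suc (wt-zeroW n))
  z : ∀ (g : Mono n) → pushW g zeroW ≡ zeroW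
  z g = Sym.app-replicate (pushSym g) 𝟎 refl
  eq₁ : j ≡ j′ × flip neg s 𝟏 ≡ flip neg s′ 𝟏
  eq₁ = insertAt-unit j j′ (flip-nonzero s) (flip-nonzero s′)
    (trans (cong (λ v → insertAt v j (flip neg s 𝟏)) (sym (z g)))
      (trans head (cong (λ v → insertAt v j′ (flip neg s′ 𝟏)) (z g′))))
  rest : ∀ p → wt p ≡ 1 → pushW g p ≡ pushW g′ p
  rest p w = trans (sym (Vecₚ.removeAt-insertAt (pushW g p) j _))
    (trans (cong (λ v → removeAt v j) (e (𝟎 ∷ p) w))
    (trans (cong (removeAt (insertAt (pushW g′ p) j′ _)) (proj₁ eq₁)) (Vecₚ.removeAt-insertAt (pushW g′ p) j′ _)))

length-filter-split : ∀ {P : A → Set} (P? : ∀ x → Dec (P x)) xs →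
  length xs ≡ length (List.filter P? xs) + length (List.filter (λ x → ¬? (P? x)) xs)
length-filter-split P? [] = refl
length-filter-split P? (x ∷ xs) with P? x
... | yes _ = cong suc (length-filter-split P? xs)
... | no _ = trans (cong suc (length-filter-split P? xs)) (sym (+-suc _ _))

-- The orbit-stabilizer estimate for lists. It is applied to the images of a base point, to the
-- codes in an orbit, and with the identity map as the pigeonhole principle.
fibres-bound : ∀ {f : A → B} (_≟_ : DecidableEquality B) {b} (S : List B) (xs : List A) →
  Unique xs → (∀ {x} → x ∈ xs → f x ∈ S) →
  (∀ s ys → Unique ys → (∀ {x} → x ∈ ys → x ∈ xs × f x ≡ s) → length ys ≤ b) →
  length xs ≤ length S * b
fibres-bound {f = f} _≟_ [] [] u i h = z≤n
fibres-bound {f = f} _≟_ [] (x ∷ xs) u i h = case i (here refl) of λ ()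
fibres-bound {A = A} {f = f} _≟_ {b} (s ∷ S) xs u i h = begin
  length xs ≡⟨ length-filter-split P? xs ⟩
  length as + length bs ≤⟨ ℕₚ.+-mono-≤
    (h s as (filter⁺ P? u) λ j → ∈-filter⁻ P? j)
    (fibres-bound _≟_ S bs (filter⁺ Q? u) inS
      λ t ys v k → h t ys v λ j → proj₁ (∈-filter⁻ Q? (proj₁ (k j))) , proj₂ (k j)) ⟩
  b + length S * b ∎
  where
  open ℕₚ.≤-Reasoning
  P? : ∀ x → Dec (f x ≡ s)
  P? x = f x ≟ s
  Q? : ∀ x → Dec (¬ (f x ≡ s))
  Q? x = ¬? (P? x)
  as = List.filter P? xs
  bs = List.filter Q? xs
  inS : ∀ {x} → x ∈ bs → f x ∈ S
  inS j with ∈-filter⁻ Q? j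
  ... | k , ne with i k
  ... | here e = ⊥-elim (ne e)
  ... | there l = l

-- Soundness of stabilizer chains

bound : List Level → ℕ
bound [] = 1
bound (l ∷ ls) = Level.size l * bound ls

module ChainSound (rounds : ℕ) {r} {C : Code n} {H : List (Word n)} (M : Minors r C H) where
  open Chain rounds C (weighted H)
  open Minors M

  module Aut (h h⁻ : Sym n)
    (inv : ∀ x → Invariance.hW h⁻ (Invariance.hW h x) ≡ x)
    (inv′ : ∀ x → Invariance.hW h (Invariance.hW h⁻ x) ≡ x)
    (stable : ∀ x → C (Invariance.hW h x) ≡ C x) where
    open Invariance h

    rounds-h : ∀ r σ → steps r (weighted H) (hS σ) ≡ hS (steps r (weighted H) σ)
    rounds-h = steps-h H H (minors-↭ h h⁻ M M inv inv′ stable)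

    refine-h : ∀ σ → refine (hS σ) ≡ hS (refine σ)
    refine-h = rounds-h rounds

    paint-swap : ∀ t c → paint t (swapColor c) ≡ neg (paint t c)
    paint-swap t (p , m) = go (colorValue t p) (colorValue t m)
      where
      go : ∀ a b → b +₃ neg a ≡ neg (a +₃ neg b)
      go 𝟎 b = trans (+₃-identityʳ b) (sym (neg-involutive b))
      go 𝟏 𝟎 = refl
      go 𝟏 𝟏 = refl
      go 𝟏 𝟐 = refl
      go 𝟐 𝟎 = refl
      go 𝟐 𝟏 = refl
      go 𝟐 𝟐 = refl

    colored-h : ∀ t ρ → colored t (hS ρ) ≡ colored t ρ
    colored-h [] ρ = refl
    colored-h t@(_ ∷ _) ρ = trans (cong C (sym (Sym.app-map h (paint t) (paint-swap t) ρ))) (stable _)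

    -- At every node the image `hW b` of the extra point has the colour of `b`, so its branch is
    -- among those examined. There the marked states again correspond under `h`; at the leaf the
    -- hashes and the membership of the painted words agree.
    differs-h : ∀ k bs y σ → All (λ b → wt b ≡ 1) bs → differs k bs y σ (hS σ) ≡ false
    differs-h k [] y σ [] rewrite refine-h σ | hash-h (refine σ) | ≡ᵇ-refl (hash (refine σ))
      | colored-h (table y (refine σ)) (refine σ) = xor-same (colored (table y (refine σ)) (refine σ))
    differs-h k (b ∷ bs) y σ (w ∷ ws) rewrite refine-h σ | hash-h (refine σ) | ≡ᵇ-refl (hash (refine σ)) =
      all-false _ (points-complete (hW b) (trans (wt-hW b) w))
        (cong₂ (λ u v → not u ∨ v)
          (trans (cong (_≡ᵇ colorSum b (refine σ)) (colorSum-h b (refine σ))) (≡ᵇ-refl (colorSum b (refine σ))))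
          (trans (cong (differs (suc k) bs y (mark k b (refine σ))) (sym (mark-h k b (refine σ)))) (differs-h (suc k) bs y (mark k b (refine σ)) ws)))

  survivors-list : ∀ d mask qs → ∃ λ S → length S ≡ survivors d mask qs × (∀ {q} → q ∈ qs → d q ≡ false → q ∈ S)
  survivors-list d mask [] = [] , refl , λ ()
  survivors-list d mask (q ∷ qs) with survivors-list d (mask ℕ./ 2) qs | mask ℕ.% 2 ≡ᵇ 1 | d q in e
  ... | S , l , f | true | true = S , l , λ where
    (here refl) p → ⊥-elim (true≢false (trans (sym e) p))
    (there i) p → f i p
  ... | S , l , f | true | false = q ∷ S , cong suc l , λ where
    (here refl) p → here refl
    (there i) p → there (f i p)
  ... | S , l , f | false | _ = q ∷ S , cong suc l , λ where
    (here refl) p → here refl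
    (there i) p → there (f i p)

  distinct-injective : ∀ (f : A → ℕ) xs → distinct (List.map f xs) ≡ true → ∀ {x y} → x ∈ xs → y ∈ xs → f x ≡ f y → x ≡ y
  distinct-injective f (z ∷ xs) e = λ where
      (here refl) (here refl) p → refl
      (here refl) (there j) p → ⊥-elim (clash j p)
      (there i) (here refl) p → ⊥-elim (clash i (sym p))
      (there i) (there j) p → distinct-injective f xs (proj₂ (∧-split {all (λ y → not (f z ≡ᵇ y)) (List.map f xs)} e)) i j p
    where
    clash : ∀ {y} → y ∈ xs → f z ≡ f y → ⊥
    clash {y} j p with all-∈ (λ y → not (f z ≡ᵇ y)) (proj₁ (∧-split e)) (∈-map⁺ f j)
    ... | q rewrite p | ≡ᵇ-refl (f y) = true≢false (sym q)

  pushS pullS : Mono n → State n → State n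
  pushS = push swapColor
  pullS = pull swapColor

  ∈-sameColor : ∀ {b ρ q} → q ∈ points n → colorSum q ρ ≡ colorSum b ρ → q ∈ sameColor b ρ
  ∈-sameColor {b} {ρ} {q} i e = go (points n) i
    where
    go : ∀ ps → q ∈ ps → q ∈ List.filterᵇ (λ q → colorSum q ρ ≡ᵇ colorSum b ρ) ps
    go (p ∷ ps) (here refl) rewrite e | ≡ᵇ-refl (colorSum b ρ) = here refl
    go (p ∷ ps) (there i) with colorSum p ρ ≡ᵇ colorSum b ρ
    ... | true = there (go ps i)
    ... | false = go ps i

  wt1 : ∀ {bs : List (Word n)} → all (λ x → wt x ≡ᵇ 1) bs ≡ true → All (λ b → wt b ≡ 1) bs
  wt1 {[]} e = []
  wt1 {b ∷ bs} e = ≡ᵇ-true (proj₁ (∧-split e)) ∷ wt1 (proj₂ (∧-split {wt b ≡ᵇ 1} e))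

  -- For g, g₀ with the same image code, pull g₀ ∘ push g is an automorphism of C.
  chain-bound : ∀ r k σ ls (D : Code n) G → chain r k σ ls ≡ true → Unique G →
    (∀ {g} → g ∈ G → ∀ z → C (pullW g z) ≡ D z) →
    (∀ {g g₀} → g ∈ G → g₀ ∈ G → pushS g σ ≡ pushS g₀ σ) →
    length G ≤ bound ls
  chain-bound r k σ ls D [] ok u img agr = z≤n
  -- `G` is part of a coset of the stabilizer of `σ`, and any of its members can serve as the
  -- reference.
  chain-bound r k σ ls D G@(g₀ ∷ G′) ok u img agr = go ls ok
    where
    ρ = steps r (weighted H) σ
    module On {g} (i : g ∈ G) where
      h h⁻ : Sym n
      h = pullSym g₀ ∘ˢ pushSym g
      h⁻ = pullSym g ∘ˢ pushSym g₀
      inv : ∀ x → Invariance.hW h⁻ (Invariance.hW h x) ≡ x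
      inv x = trans (cong (pullW g) (push-pull neg-involutive g₀ (pushW g x))) (pull-push neg-involutive g x)
      inv′ : ∀ x → Invariance.hW h (Invariance.hW h⁻ x) ≡ x
      inv′ x = trans (cong (pullW g₀) (push-pull neg-involutive g (pushW g₀ x))) (pull-push neg-involutive g₀ x)
      stable : ∀ x → C (Invariance.hW h x) ≡ C x
      stable x = trans (img (here refl) (pushW g x)) (trans (sym (img i (pushW g x))) (cong C (pull-push neg-involutive g x)))
      open Invariance h public
      open Aut h h⁻ inv inv′ stable public
      -- `g` and `g₀` push `σ` to the same state, so pulling back along `g₀` returns `σ`.
      fix : hS σ ≡ σ
      fix = trans (cong (pullS g₀) (agr i (here refl))) (pull-push (λ _ → refl) g₀ σ)
      fixρ : hS ρ ≡ ρ
      fixρ = trans (sym (rounds-h r σ)) (cong (steps r (weighted H)) fix)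
      color-h : ∀ p → colorSum (hW p) ρ ≡ colorSum p ρ
      color-h p = trans (cong (colorSum (hW p)) (sym fixρ)) (colorSum-h p ρ)
    agrρ : ∀ {g g′} → g ∈ G → g′ ∈ G → pushS g ρ ≡ pushS g′ ρ
    agrρ i j = trans (at i) (sym (at j))
      where
      at : ∀ {g} → g ∈ G → pushS g ρ ≡ pushS g₀ ρ
      at {g} i = trans (sym (push-pull (λ _ → refl) g₀ (pushS g ρ))) (cong (pushS g₀) (On.fixρ i))
    go : ∀ ls → chain r k σ ls ≡ true → length G ≤ bound ls
    -- The automorphism preserves every colour, and the colours are distinct; so it fixes all signed
    -- coordinates, and `push-faithful` gives `g ≡ g₀`.
    go [] ok = single u
      where
      same : ∀ {g} → g ∈ G → g ≡ g₀
      same {g} i = push-faithful g g₀ λ p w → trans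
        (sym (push-pull neg-involutive g₀ (pushW g p)))
        (cong (pushW g₀) (distinct-injective (λ q → colorSum q ρ) (points n) ok
          (points-complete (O.hW p) (trans (O.wt-hW p) w)) (points-complete p w) (O.color-h p)))
        where module O = On i
      single : Unique G → length G ≤ 1
      single (ne ∷ _) = s≤s (none G′ λ i → All.lookup ne i (sym (same (there i))))
        where
        none : ∀ xs → (∀ {x} → x ∈ xs → ⊥) → length xs ≤ 0
        none [] f = z≤n
        none (x ∷ xs) f = ⊥-elim (f (here refl))
    go (level base extra test mask size ∷ ls) ok = ℕₚ.≤-trans
      (fibres-bound {f = target} _≟W_ S G u inS fibre)
      (ℕₚ.≤-reflexive (cong (_* bound ls) (trans (proj₁ (proj₂ surv)) (≡ᵇ-true (proj₁ ok₂)))))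
      where
      b = nth (points n) base
      bs = List.map (nth (points n)) extra
      ok₁ = ∧-split {all (λ x → wt x ≡ᵇ 1) (b ∷ bs)} ok
      ws = wt1 {b ∷ bs} (proj₁ ok₁)
      wb = All.lookup ws (here refl)
      d : Word n → Bool
      d q = differs (suc k) bs (trits n test) (mark k b ρ) (mark k q ρ)
      ok₂ = ∧-split {passes k ρ b mask size (differs (suc k) bs (trits n test) (mark k b ρ))} (proj₂ ok₁)
      surv = survivors-list d mask (sameColor b ρ)
      S = proj₁ surv
      -- The image of the base point under the automorphism that compares `g` with `g₀`.
      target : Mono n → Word n
      target g = pullW g₀ (pushW g b)
      inS : ∀ {g} → g ∈ G → target g ∈ S
      inS i = proj₂ (proj₂ surv)
        (∈-sameColor {b} {ρ} (points-complete (O.hW b) (trans (O.wt-hW b) wb)) (O.color-h b))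
        (trans (cong (differs (suc k) bs (trits n test) (mark k b ρ))
            (trans (cong (mark k (O.hW b)) (sym O.fixρ)) (sym (O.mark-h k b ρ))))
          (O.differs-h (suc k) bs (trits n test) (mark k b ρ) (All.tail ws)))
        where module O = On i
      -- Members of one fibre push the base point to the same place. So they also agree on the state
      -- marked at the base point, and one check of the remaining chain serves for all fibres.
      fibre : ∀ s ys → Unique ys → (∀ {g} → g ∈ ys → g ∈ G × target g ≡ s) → length ys ≤ bound ls
      fibre s ys v f = chain-bound rounds (suc k) (mark k b ρ) ls D ys (proj₂ ok₂) v (λ i → img (proj₁ (f i)))
        λ {g} {g′} i j → trans (Invariance.mark-h (pushSym g) k b ρ)
          (trans (cong₂ (mark k) (trans (atB i) (sym (atB j))) (agrρ (proj₁ (f i)) (proj₁ (f j))))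
            (sym (Invariance.mark-h (pushSym g′) k b ρ)))
        where
        atB : ∀ {g} → g ∈ ys → pushW g b ≡ pushW g₀ s
        atB {g} i = trans (sym (push-pull neg-involutive g₀ (pushW g b))) (cong (pushW g₀) (proj₂ (f i)))

-- Maximal isotropic subspaces of a hyperbolic space

Hyp : ℕ → Set
Hyp = Vec (F3 × F3)

form : Hyp m → Hyp m → F3
form [] [] = 𝟎
form ((a , b) ∷ u) ((c , d) ∷ v) = (a *₃ d +₃ b *₃ c) +₃ form u v

_⊞_ : Hyp m → Hyp m → Hyp m
_⊞_ = zipWith λ (a , b) (c , d) → a +₃ c , b +₃ d

_⊡_ : F3 → Hyp m → Hyp m
s ⊡ u = map (λ (a , b) → s *₃ a , s *₃ b) u

form-sym : ∀ (u v : Hyp m) → form u v ≡ form v u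
form-sym [] [] = refl
form-sym ((a , b) ∷ u) ((c , d) ∷ v) = cong₂ _+₃_ (eq a b c d) (form-sym u v)
  where
  eq : ∀ a b c d → a *₃ d +₃ b *₃ c ≡ c *₃ b +₃ d *₃ a
  eq = toWitness {a? = all₃? λ a → all₃? λ b → all₃? λ c → all₃? λ d →
    (a *₃ d +₃ b *₃ c) ≟F (c *₃ b +₃ d *₃ a)} _

form-⊞ : ∀ (u v w : Hyp m) → form u (v ⊞ w) ≡ form u v +₃ form u w
form-⊞ [] [] [] = refl
form-⊞ ((a , b) ∷ u) ((c , d) ∷ v) ((e , f) ∷ w) = trans
  (cong₂ _+₃_ (trans (cong₂ _+₃_ (*₃-distribˡ a d f) (*₃-distribˡ b c e))
    (+₃-middle (a *₃ d) (a *₃ f) (b *₃ c) (b *₃ e))) (form-⊞ u v w))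
  (+₃-middle (a *₃ d +₃ b *₃ c) (a *₃ f +₃ b *₃ e) _ _)

form-⊡ : ∀ s (u v : Hyp m) → form u (s ⊡ v) ≡ s *₃ form u v
form-⊡ s [] [] = sym (*₃-zeroʳ s)
form-⊡ s ((a , b) ∷ u) ((c , d) ∷ v) = trans (cong₂ _+₃_ (eq s a b c d) (form-⊡ s u v))
  (sym (*₃-distribˡ s (a *₃ d +₃ b *₃ c) (form u v)))
  where
  eq : ∀ s a b c d → a *₃ (s *₃ d) +₃ b *₃ (s *₃ c) ≡ s *₃ (a *₃ d +₃ b *₃ c)
  eq 𝟎 a b c d = cong₂ _+₃_ (*₃-zeroʳ a) (*₃-zeroʳ b)
  eq 𝟏 a b c d = refl
  eq 𝟐 = toWitness {a? = all₃? λ a → all₃? λ b → all₃? λ c → all₃? λ d →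
    (a *₃ (𝟐 *₃ d) +₃ b *₃ (𝟐 *₃ c)) ≟F (𝟐 *₃ (a *₃ d +₃ b *₃ c))} _

form-⊞ˡ : ∀ (u v w : Hyp m) → form (u ⊞ v) w ≡ form u w +₃ form v w
form-⊞ˡ u v w = trans (form-sym (u ⊞ v) w) (trans (form-⊞ w u v) (cong₂ _+₃_ (form-sym w u) (form-sym w v)))

form-⊡ˡ : ∀ s (u v : Hyp m) → form (s ⊡ u) v ≡ s *₃ form u v
form-⊡ˡ s u v = trans (form-sym (s ⊡ u) v) (trans (form-⊡ s v u) (cong (s *₃_) (form-sym v u)))

_⊢_ : (Hyp m → Bool) → Hyp m → Set
S ⊢ v = S v ≡ true

SelfDual : (Hyp m → Bool) → Set
SelfDual S = ∀ v → (S ⊢ v → ∀ u → S ⊢ u → form v u ≡ 𝟎) × ((∀ u → S ⊢ u → form v u ≡ 𝟎) → S ⊢ v)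

module SD {S : Hyp m → Bool} (sd : SelfDual S) where
  orth : ∀ {u v} → S ⊢ u → S ⊢ v → form u v ≡ 𝟎
  orth {u} {v} p q = proj₁ (sd u) p v q

  -- Linearity comes from the second half of `SelfDual`: whatever is orthogonal to `S` belongs to
  -- `S`.
  ⊞-closed : ∀ {u v} → S ⊢ u → S ⊢ v → S ⊢ (u ⊞ v)
  ⊞-closed {u} {v} p q = proj₂ (sd _) λ w r → trans (form-⊞ˡ u v w) (cong₂ _+₃_ (orth p r) (orth q r))

  ⊡-closed : ∀ s {u} → S ⊢ u → S ⊢ (s ⊡ u)
  ⊡-closed s {u} p = proj₂ (sd _) λ w r → trans (form-⊡ˡ s u w) (trans (cong (s *₃_) (orth p r)) (*₃-zeroʳ s))

-- Reduction modulo the first hyperbolic pair (e , f): S ↦ ((S ∩ e^⊥) + e) / e.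
red : (Hyp (suc m) → Bool) → Hyp m → Bool
red S v = S ((𝟎 , 𝟎) ∷ v) ∨ (S ((𝟏 , 𝟎) ∷ v) ∨ S ((𝟐 , 𝟎) ∷ v))

red⁺ : ∀ {S : Hyp (suc m) → Bool} {v} t → S ⊢ ((t , 𝟎) ∷ v) → red S ⊢ v
red⁺ 𝟎 p rewrite p = refl
red⁺ {S = S} {v} 𝟏 p rewrite p = ∨-zeroʳ (S ((𝟎 , 𝟎) ∷ v))
red⁺ {S = S} {v} 𝟐 p rewrite p | ∨-zeroʳ (S ((𝟏 , 𝟎) ∷ v)) = ∨-zeroʳ (S ((𝟎 , 𝟎) ∷ v))

red⁻ : ∀ {S : Hyp (suc m) → Bool} {v} → red S ⊢ v → ∃ λ t → S ⊢ ((t , 𝟎) ∷ v)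
red⁻ {S = S} {v} p with S ((𝟎 , 𝟎) ∷ v) in e₀ | S ((𝟏 , 𝟎) ∷ v) in e₁ | S ((𝟐 , 𝟎) ∷ v) in e₂
... | true | _ | _ = 𝟎 , e₀
... | false | true | _ = 𝟏 , e₁
... | false | false | true = 𝟐 , e₂

red-cong : ∀ {S T : Hyp (suc m) → Bool} → (∀ v → S v ≡ T v) → ∀ v → red S v ≡ red T v
red-cong e v = cong₂ _∨_ (e _) (cong₂ _∨_ (e _) (e _))

first : (A → Bool) → List A → Maybe A
first f [] = nothing
first f (x ∷ xs) = if f x then just x else first f xs

first-just : ∀ (f : A → Bool) xs {x} → first f xs ≡ just x → f x ≡ true
first-just f (y ∷ xs) e with f y in e′
... | true with e
... | refl = e′
first-just f (y ∷ xs) e | false = first-just f xs e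

first-nothing : ∀ (f : A → Bool) xs {x} → first f xs ≡ nothing → x ∈ xs → f x ≡ false
first-nothing f (y ∷ xs) e i with f y in e′
first-nothing f (y ∷ xs) e (here refl) | false = e′
first-nothing f (y ∷ xs) e (there i) | false = first-nothing f xs e i

first-cong : ∀ {f g : A → Bool} → (∀ x → f x ≡ g x) → ∀ xs → first f xs ≡ first g xs
first-cong e [] = refl
first-cong {f = f} {g} e (x ∷ xs) = cong₂ (λ b r → if b then just x else r) (e x) (first-cong e xs)

scalars : List F3
scalars = 𝟎 ∷ 𝟏 ∷ 𝟐 ∷ []

∈-scalars : ∀ x → x ∈ scalars
∈-scalars 𝟎 = here refl
∈-scalars 𝟏 = there (here refl)
∈-scalars 𝟐 = there (there (here refl))

allHyp : ∀ m → List (Hyp m)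
allHyp zero = [] ∷ []
allHyp (suc m) = cartesianProductWith _∷_ (cartesianProductWith _,_ scalars scalars) (allHyp m)

∈-allHyp : ∀ (v : Hyp m) → v ∈ allHyp m
∈-allHyp [] = here refl
∈-allHyp ((a , b) ∷ v) = ∈-cartesianProductWith⁺ _∷_
  (∈-cartesianProductWith⁺ _,_ (∈-scalars a) (∈-scalars b)) (∈-allHyp v)

isPivot : (Hyp (suc m) → Bool) → F3 × Hyp m → Bool
isPivot S (c , p) = S ((c , 𝟏) ∷ p)

tops : ∀ m → List (F3 × Hyp m)
tops m = cartesianProductWith _,_ scalars (allHyp m)

-- An element of `S` outside e^⊥, scaled to have product `𝟏` with e. For a self-dual `S` there is
-- none exactly if e lies in `S`. Taking the first one in a fixed enumeration makes the choice
-- depend only on the values of `S`; the enumeration is never evaluated.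
pivot : (Hyp (suc m) → Bool) → Maybe (F3 × Hyp m)
pivot {m} S = first (isPivot S) (tops m)

pivot-just : ∀ (S : Hyp (suc m) → Bool) {c p} → pivot S ≡ just (c , p) → S ⊢ ((c , 𝟏) ∷ p)
pivot-just {m} S = first-just (isPivot S) (tops m)

pivot-cong : ∀ {S T : Hyp (suc m) → Bool} → (∀ v → S v ≡ T v) → pivot S ≡ pivot T
pivot-cong {m} e = first-cong (λ (c , p) → e ((c , 𝟏) ∷ p)) (tops m)

pivot-nothing : ∀ {S : Hyp (suc m) → Bool} → SelfDual S → pivot S ≡ nothing →
  ∀ {a b v} → S ⊢ ((a , b) ∷ v) → b ≡ 𝟎
pivot-nothing {S = S} sd e {a} {b} {v} p = go b p
  where
  no-pivot : ∀ c u → S ⊢ ((c , 𝟏) ∷ u) → ⊥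
  no-pivot c u q = true≢false (trans (sym q) (first-nothing (isPivot S) (tops _) {c , u} e
    (∈-cartesianProductWith⁺ _,_ (∈-scalars c) (∈-allHyp u))))
  go : ∀ b → S ⊢ ((a , b) ∷ v) → b ≡ 𝟎
  go 𝟎 p = refl
  go 𝟏 p = ⊥-elim (no-pivot a v p)
  -- Doubling turns the coefficient `𝟐` into `𝟏`.
  go 𝟐 p = ⊥-elim (no-pivot _ _ (SD.⊡-closed sd 𝟐 p))

clear : ∀ {S : Hyp (suc m) → Bool} → SelfDual S → ∀ {a b u c p} → S ⊢ ((a , b) ∷ u) → S ⊢ ((c , 𝟏) ∷ p) →
  S ⊢ ((a +₃ neg b *₃ c , 𝟎) ∷ (u ⊞ (neg b ⊡ p)))
clear {S = S} sd {a} {b} {u} {c} {p} q r = subst (λ z → S ⊢ ((a +₃ neg b *₃ c , z) ∷ (u ⊞ (neg b ⊡ p)))) (eq b)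
  (SD.⊞-closed sd q (SD.⊡-closed sd (neg b) r))
  where
  eq : ∀ b → b +₃ neg b *₃ 𝟏 ≡ 𝟎
  eq = toWitness {a? = all₃? λ b → (b +₃ neg b *₃ 𝟏) ≟F 𝟎} _

-- For the second half a vector orthogonal to the reduction has to be lifted into `S`. Without a
-- pivot `S` lies in e^⊥, and the lift with top coordinate `𝟎` is orthogonal to it. With a pivot,
-- `S` is spanned by the pivot and its part in e^⊥.
red-SD : ∀ {S : Hyp (suc m) → Bool} → SelfDual S → SelfDual (red S)
red-SD {m} {S} sd v = to , from
  where
  open SD sd
  to : red S ⊢ v → ∀ u → red S ⊢ u → form v u ≡ 𝟎
  to p u q with red⁻ {S = S} p | red⁻ {S = S} q
  ... | t , p′ | t′ , q′ = trans (sym (cong (_+₃ form v u) (eq t))) (orth p′ q′)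
    where
    eq : ∀ t → t *₃ 𝟎 +₃ 𝟎 ≡ 𝟎
    eq t = trans (+₃-identityʳ (t *₃ 𝟎)) (*₃-zeroʳ t)
  from : (∀ u → red S ⊢ u → form v u ≡ 𝟎) → red S ⊢ v
  from h with pivot S in e
  ... | nothing = red⁺ {S = S} {v} 𝟎 (proj₂ (sd ((𝟎 , 𝟎) ∷ v)) λ where
      ((c , d) ∷ u) q → case pivot-nothing sd e q of λ where
        refl → h u (red⁺ {S = S} {u} c q))
  -- The top coordinate of the lift is the one that makes it orthogonal to the pivot.
  ... | just (c₀ , p₀) = red⁺ {S = S} {v} (neg (form v p₀)) (proj₂ (sd ((neg (form v p₀) , 𝟎) ∷ v)) λ where
      ((c , d) ∷ u) q → eq d (form v p₀) (form v u) (trans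
        (sym (trans (form-⊞ v u (neg d ⊡ p₀)) (cong (form v u +₃_) (form-⊡ (neg d) v p₀))))
        (h _ (red⁺ {S = S} _ (clear sd q (pivot-just S e))))))
    where
    eq : ∀ d b x → x +₃ neg d *₃ b ≡ 𝟎 → (neg b *₃ d +₃ 𝟎) +₃ x ≡ 𝟎
    eq = toWitness {a? = all₃? λ d → all₃? λ b → all₃? λ x →
      ((x +₃ neg d *₃ b) ≟F 𝟎) →-dec (((neg b *₃ d +₃ 𝟎) +₃ x) ≟F 𝟎)} _

digit : F3 → Fin 3
digit 𝟎 = zero
digit 𝟏 = suc zero
digit 𝟐 = suc (suc zero)

digit-injective : ∀ x y → digit x ≡ digit y → x ≡ y
digit-injective = toWitness {a? = all₃? λ x → all₃? λ y → (digit x Finₚ.≟ digit y) →-dec (x ≟F y)} _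

-- A numbering of the cosets of a self-dual `S`. The leading digit is a functional that vanishes on
-- `S`: the product with the pivot, or with e if there is no pivot. The remaining digits number the
-- coset of the reduction, after the pivot has been used to move the vector into e^⊥.
coset : ∀ m → (Hyp m → Bool) → Hyp m → Fin (3 ^ m)
coset zero S [] = zero
coset (suc m) S ((a , b) ∷ u) = combine
  (digit (maybe′ (λ (c , p) → form ((a , b) ∷ u) ((c , 𝟏) ∷ p)) b (pivot S)))
  (coset m (red S) (maybe′ (λ (c , p) → u ⊞ (neg b ⊡ p)) u (pivot S)))

coset-cong : ∀ m {S T : Hyp m → Bool} → (∀ v → S v ≡ T v) → ∀ u → coset m S u ≡ coset m T u
coset-cong zero e [] = refl
coset-cong (suc m) {S} {T} e ((a , b) ∷ u) rewrite pivot-cong e = cong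
  (combine (digit (maybe′ (λ (c , p) → form ((a , b) ∷ u) ((c , 𝟏) ∷ p)) b (pivot T))))
  (coset-cong m {red S} {red T} (red-cong e) (maybe′ (λ (c , p) → u ⊞ (neg b ⊡ p)) u (pivot T)))

_⊟_ : Hyp m → Hyp m → Hyp m
u ⊟ v = u ⊞ (𝟐 ⊡ v)

hyp-cong : ∀ {a a′ b b′} {u u′ : Hyp m} → a ≡ a′ → b ≡ b′ → u ≡ u′ →
  _≡_ {A = Hyp (suc m)} ((a , b) ∷ u) ((a′ , b′) ∷ u′)
hyp-cong refl refl refl = refl

coset-injective : ∀ m {S : Hyp m → Bool} → SelfDual S → ∀ u v → coset m S u ≡ coset m S v → S ⊢ (u ⊟ v)
coset-injective zero {S} sd [] [] e = proj₂ (sd []) λ { [] _ → refl }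
coset-injective (suc m) {S} sd ((a , b) ∷ u) ((a′ , b′) ∷ v) e with pivot S in eq
... | nothing with combine-injective (digit b) _ (digit b′) _ e
... | eb , ec with digit-injective b b′ eb
... | refl with red⁻ {S = S} (coset-injective m (red-SD sd) u v ec)
-- Here `S` lies in e^⊥, so the top coordinate does not affect products with `S`, and the lifted
-- difference may be given the top coordinate required.
... | t , q = subst (λ x → S ⊢ ((a +₃ 𝟐 *₃ a′ , x) ∷ (u ⊟ v))) (sym (zero-b b)) (proj₂ (sd _) λ where
    ((c , d) ∷ w) r → case pivot-nothing sd eq r of λ where
      refl → trans (drop (a +₃ 𝟐 *₃ a′) (form (u ⊟ v) w)) (trans (sym (drop t (form (u ⊟ v) w))) (SD.orth sd q r)))
  where
  zero-b : ∀ b → b +₃ 𝟐 *₃ b ≡ 𝟎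
  zero-b = toWitness {a? = all₃? λ b → (b +₃ 𝟐 *₃ b) ≟F 𝟎} _
  drop : ∀ s y → (s *₃ 𝟎 +₃ 𝟎) +₃ y ≡ y
  drop s y = cong (_+₃ y) (trans (+₃-identityʳ _) (*₃-zeroʳ s))
coset-injective (suc m) {S} sd ((a , b) ∷ u) ((a′ , b′) ∷ v) e | just (c , p)
  with combine-injective (digit (form ((a , b) ∷ u) ((c , 𝟏) ∷ p))) _ (digit (form ((a′ , b′) ∷ v) ((c , 𝟏) ∷ p))) _ e
... | eb , ec with digit-injective (form ((a , b) ∷ u) ((c , 𝟏) ∷ p)) (form ((a′ , b′) ∷ v) ((c , 𝟏) ∷ p)) eb
... | eB with red⁻ {S = S} (coset-injective m (red-SD sd) (u ⊞ (neg b ⊡ p)) (v ⊞ (neg b′ ⊡ p)) ec)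
-- The difference is a lift of the reduced difference plus a multiple of the pivot. Only the top
-- coordinates remain to be compared; orthogonality to the pivot settles them.
... | t , q = proj₂ (sd _) λ w r → trans (cong (λ z → form z w) decomp)
    (trans (form-⊞ˡ ((t , 𝟎) ∷ w₀) (δ ⊡ ((c , 𝟏) ∷ p)) w) (cong₂ _+₃_ (SD.orth sd q r)
      (SD.orth sd (SD.⊡-closed sd δ pv) r)))
  where
  pv : S ⊢ ((c , 𝟏) ∷ p)
  pv = pivot-just S eq
  δ = b +₃ 𝟐 *₃ b′
  w₀ = (u ⊞ (neg b ⊡ p)) ⊟ (v ⊞ (neg b′ ⊡ p))
  tails : ∀ {l} (u v p : Hyp l) b b′ → (u ⊟ v) ≡ ((u ⊞ (neg b ⊡ p)) ⊟ (v ⊞ (neg b′ ⊡ p))) ⊞ ((b +₃ 𝟐 *₃ b′) ⊡ p)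
  tails [] [] [] b b′ = refl
  tails ((x , y) ∷ u) ((x′ , y′) ∷ v) ((x″ , y″) ∷ p) b b′ = hyp-cong (one x x′ x″ b b′) (one y y′ y″ b b′) (tails u v p b b′)
    where
    one : ∀ x y z b b′ → x +₃ 𝟐 *₃ y ≡ ((x +₃ neg b *₃ z) +₃ 𝟐 *₃ (y +₃ neg b′ *₃ z)) +₃ (b +₃ 𝟐 *₃ b′) *₃ z
    one = toWitness {a? = all₃? λ x → all₃? λ y → all₃? λ z → all₃? λ b → all₃? λ b′ →
      (x +₃ 𝟐 *₃ y) ≟F (((x +₃ neg b *₃ z) +₃ 𝟐 *₃ (y +₃ neg b′ *₃ z)) +₃ (b +₃ 𝟐 *₃ b′) *₃ z)} _
  D : Hyp (suc m)
  D = ((a , b) ∷ u) ⊟ ((a′ , b′) ∷ v)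
  BD : form D ((c , 𝟏) ∷ p) ≡ 𝟎
  BD = trans (form-⊞ˡ ((a , b) ∷ u) (𝟐 ⊡ ((a′ , b′) ∷ v)) _)
    (trans (cong (form ((a , b) ∷ u) ((c , 𝟏) ∷ p) +₃_) (form-⊡ˡ 𝟐 ((a′ , b′) ∷ v) _))
    (trans (cong (λ z → z +₃ 𝟐 *₃ form ((a′ , b′) ∷ v) ((c , 𝟏) ∷ p)) eB) (x+2x (form ((a′ , b′) ∷ v) ((c , 𝟏) ∷ p)))))
    where
    x+2x : ∀ x → x +₃ 𝟐 *₃ x ≡ 𝟎
    x+2x = toWitness {a? = all₃? λ b → (b +₃ 𝟐 *₃ b) ≟F 𝟎} _
  -- the first coordinate is forced by orthogonality to the isotropic pivot
  Bp : 𝟎 ≡ (c *₃ 𝟏 +₃ 𝟏 *₃ c) +₃ form p p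
  Bp = sym (SD.orth sd pv pv)
  Bq : (t *₃ 𝟏 +₃ 𝟎) +₃ form w₀ p ≡ 𝟎
  Bq = SD.orth sd q pv
  BD′ : ((a +₃ 𝟐 *₃ a′) *₃ 𝟏 +₃ δ *₃ c) +₃ (form w₀ p +₃ δ *₃ form p p) ≡ 𝟎
  BD′ = trans (cong (((a +₃ 𝟐 *₃ a′) *₃ 𝟏 +₃ δ *₃ c) +₃_)
    (sym (trans (cong (λ z → form z p) (tails u v p b b′)) (trans (form-⊞ˡ w₀ (δ ⊡ p) p) (cong (form w₀ p +₃_) (form-⊡ˡ δ p p))))))
    BD
  top : a +₃ 𝟐 *₃ a′ ≡ t +₃ δ *₃ c
  top = solve (a +₃ 𝟐 *₃ a′) t δ c (form w₀ p) (form p p) Bp Bq BD′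
    where
    isolate : ∀ c β → 𝟎 ≡ (c *₃ 𝟏 +₃ 𝟏 *₃ c) +₃ β → β ≡ c
    isolate = toWitness {a? = all₃? λ c → all₃? λ β → (𝟎 ≟F ((c *₃ 𝟏 +₃ 𝟏 *₃ c) +₃ β)) →-dec (β ≟F c)} _
    isolate′ : ∀ t w → (t *₃ 𝟏 +₃ 𝟎) +₃ w ≡ 𝟎 → w ≡ neg t
    isolate′ = toWitness {a? = all₃? λ t → all₃? λ w → (((t *₃ 𝟏 +₃ 𝟎) +₃ w) ≟F 𝟎) →-dec (w ≟F neg t)} _
    finish : ∀ x t e → (x *₃ 𝟏 +₃ e) +₃ (neg t +₃ e) ≡ 𝟎 → x ≡ t +₃ e
    finish = toWitness {a? = all₃? λ x → all₃? λ t → all₃? λ e → (((x *₃ 𝟏 +₃ e) +₃ (neg t +₃ e)) ≟F 𝟎) →-dec (x ≟F (t +₃ e))} _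
    solve : ∀ x t δ c w β → 𝟎 ≡ (c *₃ 𝟏 +₃ 𝟏 *₃ c) +₃ β → (t *₃ 𝟏 +₃ 𝟎) +₃ w ≡ 𝟎 →
      (x *₃ 𝟏 +₃ δ *₃ c) +₃ (w +₃ δ *₃ β) ≡ 𝟎 → x ≡ t +₃ δ *₃ c
    solve x t δ c w β p q r with isolate c β p | isolate′ t w q
    ... | refl | refl = finish x t (δ *₃ c) r
  decomp : D ≡ ((t , 𝟎) ∷ w₀) ⊞ (δ ⊡ ((c , 𝟏) ∷ p))
  decomp = hyp-cong top (sym (*₃-identityʳ δ)) (tails u v p b b′)

count : ℕ → ℕ
count zero = 1
count (suc m) = count m * suc (3 ^ m)

-- The fibre of S ↦ red S is indexed by: zero if e ∈ S, otherwise the coset of the pivot.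
index : ∀ m → (Hyp m → Bool) → Fin (count m)
index zero S = zero
index (suc m) S = combine (index m (red S)) (maybe′ (λ (c , p) → suc (coset m (red S) p)) zero (pivot S))

bool-ext : ∀ {a b} → (a ≡ true → b ≡ true) → (b ≡ true → a ≡ true) → a ≡ b
bool-ext {false} {false} f g = refl
bool-ext {false} {true} f g = g refl
bool-ext {true} f g = sym (f refl)

module Fibre {S T : Hyp (suc m) → Bool} (sdS : SelfDual S) (sdT : SelfDual T) where

  -- A self-dual subspace that contains e is the full preimage of its reduction.
  contains-e : pivot S ≡ nothing → pivot T ≡ nothing → (∀ v → red S v ≡ red T v) → ∀ v → S ⊢ v → T ⊢ v
  contains-e eS eT e ((a , b) ∷ v) p with pivot-nothing sdS eS p
  ... | refl = proj₂ (sdT _) λ where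
    ((c , d) ∷ w) q → case pivot-nothing sdT eT q of λ where
      refl → cong₂ _+₃_ (trans (+₃-identityʳ _) (*₃-zeroʳ a))
        (SD.orth (red-SD sdT) (trans (sym (e v)) (red⁺ {S = S} a p)) (red⁺ {S = T} c q))

  -- Such a subspace is spanned by a pivot and the lifts of its reduction. If the pivots are
  -- congruent modulo the reduction, then `T` contains a vector that can differ from the pivot of
  -- `S` only in the top coordinate, and isotropy determines that coordinate. The lifts are then
  -- determined by orthogonality to the common pivot.
  misses-e : ∀ {c p c′ p′} → S ⊢ ((c , 𝟏) ∷ p) → T ⊢ ((c′ , 𝟏) ∷ p′) → (∀ v → red S v ≡ red T v) →
    red T ⊢ (p ⊟ p′) → ∀ v → S ⊢ v → T ⊢ v
  misses-e {c} {p} {c′} {p′} pS pT e d ((a , b) ∷ v) q with red⁻ {S = T} d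
  ... | t , lift-d with red⁻ {S = T} (trans (sym (e _)) (red⁺ {S = S} _ (clear sdS q pS)))
  ... | s , lift-q = subst (T ⊢_) decomp (SD.⊞-closed sdT lift-q (SD.⊡-closed sdT b pS∈T))
    where
    w = v ⊞ (neg b ⊡ p)
    a′ = a +₃ neg b *₃ c
    unsplit : ∀ {l} (p p′ : Hyp l) → p ≡ p′ ⊞ (p ⊟ p′)
    unsplit [] [] = refl
    unsplit ((x , y) ∷ p) ((x′ , y′) ∷ p′) = hyp-cong (one x x′) (one y y′) (unsplit p p′)
      where
      one : ∀ x y → x ≡ y +₃ (x +₃ 𝟐 *₃ y)
      one = toWitness {a? = all₃? λ x → all₃? λ y → x ≟F (y +₃ (x +₃ 𝟐 *₃ y))} _
    same-p : T ⊢ ((c′ +₃ t , 𝟏) ∷ p)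
    same-p = subst (λ z → T ⊢ ((c′ +₃ t , 𝟏) ∷ z)) (sym (unsplit p p′)) (SD.⊞-closed sdT pT lift-d)
    isotropic-top : ∀ c c″ β → (c *₃ 𝟏 +₃ 𝟏 *₃ c) +₃ β ≡ 𝟎 → (c″ *₃ 𝟏 +₃ 𝟏 *₃ c″) +₃ β ≡ 𝟎 → c″ ≡ c
    isotropic-top = toWitness {a? = all₃? λ c → all₃? λ d → all₃? λ β →
      (((c *₃ 𝟏 +₃ 𝟏 *₃ c) +₃ β) ≟F 𝟎) →-dec ((((d *₃ 𝟏 +₃ 𝟏 *₃ d) +₃ β) ≟F 𝟎) →-dec (d ≟F c))} _
    pS∈T : T ⊢ ((c , 𝟏) ∷ p)
    pS∈T = subst (λ z → T ⊢ ((z , 𝟏) ∷ p)) (isotropic-top c _ (form p p) (SD.orth sdS pS pS) (SD.orth sdT same-p same-p)) same-p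
    lift-top : ∀ x y β → (x *₃ 𝟏 +₃ 𝟎) +₃ β ≡ 𝟎 → (y *₃ 𝟏 +₃ 𝟎) +₃ β ≡ 𝟎 → x ≡ y
    lift-top = toWitness {a? = all₃? λ c → all₃? λ d → all₃? λ β →
      (((c *₃ 𝟏 +₃ 𝟎) +₃ β) ≟F 𝟎) →-dec ((((d *₃ 𝟏 +₃ 𝟎) +₃ β) ≟F 𝟎) →-dec (c ≟F d))} _
    s≡a′ : s ≡ a′
    s≡a′ = lift-top s a′ (form w p) (SD.orth sdT lift-q pS∈T) (SD.orth sdS (clear sdS q pS) pS)
    rebuild : ∀ {l} (v p : Hyp l) b → (v ⊞ (neg b ⊡ p)) ⊞ (b ⊡ p) ≡ v
    one′ : ∀ x y b → (x +₃ neg b *₃ y) +₃ b *₃ y ≡ x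
    one′ = toWitness {a? = all₃? λ x → all₃? λ y → all₃? λ b → ((x +₃ neg b *₃ y) +₃ b *₃ y) ≟F x} _
    rebuild [] [] b = refl
    rebuild ((x , y) ∷ v) ((x′ , y′) ∷ p) b = hyp-cong (one′ x x′ b) (one′ y y′ b) (rebuild v p b)
    decomp : ((s , 𝟎) ∷ w) ⊞ (b ⊡ ((c , 𝟏) ∷ p)) ≡ (a , b) ∷ v
    decomp = hyp-cong (trans (cong (_+₃ b *₃ c) s≡a′) (one′ a c b)) (*₃-identityʳ b) (rebuild v p b)

⊟-swap : ∀ (u v : Hyp m) → 𝟐 ⊡ (u ⊟ v) ≡ v ⊟ u
⊟-swap [] [] = refl
⊟-swap ((x , y) ∷ u) ((x′ , y′) ∷ v) = hyp-cong (one x x′) (one y y′) (⊟-swap u v)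
  where
  one : ∀ x y → 𝟐 *₃ (x +₃ 𝟐 *₃ y) ≡ y +₃ 𝟐 *₃ x
  one = toWitness {a? = all₃? λ x → all₃? λ y → (𝟐 *₃ (x +₃ 𝟐 *₃ y)) ≟F (y +₃ 𝟐 *₃ x)} _

index-injective : ∀ m {S T : Hyp m → Bool} → SelfDual S → SelfDual T → index m S ≡ index m T → ∀ v → S v ≡ T v
index-injective zero {S} {T} sS sT e [] = trans (one sS) (sym (one sT))
  where
  one : ∀ {S : Hyp 0 → Bool} → SelfDual S → S [] ≡ true
  one s = proj₂ (s []) λ { [] _ → refl }
index-injective (suc m) {S} {T} sS sT e v with combine-injective (index m (red S)) _ (index m (red T)) _ e
... | e₁ , e₂ with index-injective m (red-SD sS) (red-SD sT) e₁
... | er with pivot S in eS | pivot T in eT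
... | nothing | nothing = bool-ext (Fibre.contains-e sS sT eS eT er v) (Fibre.contains-e sT sS eT eS (sym ∘ er) v)
... | just (c , p) | just (c′ , p′) = bool-ext
    (Fibre.misses-e sS sT (pivot-just S eS) (pivot-just T eT) er d v)
    (Fibre.misses-e sT sS (pivot-just T eT) (pivot-just S eS) (sym ∘ er)
      (trans (er _) (subst (red T ⊢_) (⊟-swap p p′) (SD.⊡-closed (red-SD sT) 𝟐 d))) v)
  where
  d : red T ⊢ (p ⊟ p′)
  d = coset-injective m (red-SD sT) p p′ (trans (sym (coset-cong m er p)) (Finₚ.suc-injective e₂))

-- Systematic codes

⊕-identityˡ : ∀ (x : Word n) → zeroW ⊕ x ≡ x
⊕-identityˡ [] = refl
⊕-identityˡ (x ∷ xs) = cong (x ∷_) (⊕-identityˡ xs)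

⊕-comm : ∀ (x y : Word n) → x ⊕ y ≡ y ⊕ x
⊕-comm = Vecₚ.zipWith-comm +₃-comm

⊕-identityʳ : ∀ (x : Word n) → x ⊕ zeroW ≡ x
⊕-identityʳ x = trans (⊕-comm x zeroW) (⊕-identityˡ x)

⊕-assoc : ∀ (x y z : Word n) → (x ⊕ y) ⊕ z ≡ x ⊕ (y ⊕ z)
⊕-assoc = Vecₚ.zipWith-assoc +₃-assoc

⊕-middle : ∀ (a b c d : Word n) → (a ⊕ b) ⊕ (c ⊕ d) ≡ (a ⊕ c) ⊕ (b ⊕ d)
⊕-middle [] [] [] [] = refl
⊕-middle (a ∷ as) (b ∷ bs) (c ∷ cs) (d ∷ ds) = cong₂ _∷_ (+₃-middle a b c d) (⊕-middle as bs cs ds)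

·-zeroW : ∀ a → a · zeroW {n} ≡ zeroW
·-zeroW {zero} a = refl
·-zeroW {suc n} a = cong₂ _∷_ (*₃-zeroʳ a) (·-zeroW a)

·-⊕ : ∀ a (x y : Word n) → a · (x ⊕ y) ≡ (a · x) ⊕ (a · y)
·-⊕ a [] [] = refl
·-⊕ a (x ∷ xs) (y ∷ ys) = cong₂ _∷_ (*₃-distribˡ a x y) (·-⊕ a xs ys)

+-· : ∀ a b (x : Word n) → (a +₃ b) · x ≡ (a · x) ⊕ (b · x)
+-· a b [] = refl
+-· a b (x ∷ xs) = cong₂ _∷_ (*₃-distribʳ x a b) (+-· a b xs)

*-· : ∀ a b (x : Word n) → (a *₃ b) · x ≡ a · (b · x)
*-· a b [] = refl
*-· a b (x ∷ xs) = cong₂ _∷_ (*₃-assoc a b x) (*-· a b xs)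

𝟎-· : ∀ (x : Word n) → 𝟎 · x ≡ zeroW
𝟎-· [] = refl
𝟎-· (x ∷ xs) = cong (𝟎 ∷_) (𝟎-· xs)

𝟏-· : ∀ (x : Word n) → 𝟏 · x ≡ x
𝟏-· [] = refl
𝟏-· (x ∷ xs) = cong (x ∷_) (𝟏-· xs)

negW-· : ∀ (x : Word n) → negW x ≡ 𝟐 · x
negW-· [] = refl
negW-· (x ∷ xs) = cong₂ _∷_ (neg-as-* x) (negW-· xs)

dot-sym : ∀ (x y : Word n) → dot x y ≡ dot y x
dot-sym [] [] = refl
dot-sym (x ∷ xs) (y ∷ ys) = cong₂ _+₃_ (*₃-comm x y) (dot-sym xs ys)

dot-⊕ : ∀ (x y z : Word n) → dot x (y ⊕ z) ≡ dot x y +₃ dot x z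
dot-⊕ [] [] [] = refl
dot-⊕ (x ∷ xs) (y ∷ ys) (z ∷ zs) = trans (cong₂ _+₃_ (*₃-distribˡ x y z) (dot-⊕ xs ys zs))
  (+₃-middle (x *₃ y) (x *₃ z) (dot xs ys) (dot xs zs))

dot-· : ∀ a (x y : Word n) → dot x (a · y) ≡ a *₃ dot x y
dot-· a [] [] = sym (*₃-zeroʳ a)
dot-· a (x ∷ xs) (y ∷ ys) = trans (cong₂ _+₃_ (eq x a y) (dot-· a xs ys)) (sym (*₃-distribˡ a (x *₃ y) (dot xs ys)))
  where
  eq : ∀ x a y → x *₃ (a *₃ y) ≡ a *₃ (x *₃ y)
  eq = toWitness {a? = all₃? λ x → all₃? λ a → all₃? λ y → (x *₃ (a *₃ y)) ≟F (a *₃ (x *₃ y))} _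

dot-zeroʳ : ∀ (x : Word n) → dot x zeroW ≡ 𝟎
dot-zeroʳ [] = refl
dot-zeroʳ (x ∷ xs) = cong₂ _+₃_ (*₃-zeroʳ x) (dot-zeroʳ xs)

dot-neg : ∀ (x y : Word n) → dot x (negW y) ≡ neg (dot x y)
dot-neg x y = trans (cong (dot x) (negW-· y)) (trans (dot-· 𝟐 x y) (sym (neg-as-* (dot x y))))

dot-++ : ∀ (u u′ : Word k) (v v′ : Word m) → dot (u Vec.++ v) (u′ Vec.++ v′) ≡ dot u u′ +₃ dot v v′
dot-++ [] [] v v′ = refl
dot-++ (x ∷ u) (y ∷ u′) v v′ = trans (cong (x *₃ y +₃_) (dot-++ u u′ v v′))
  (sym (+₃-assoc (x *₃ y) (dot u u′) (dot v v′)))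

linComb-⊕ : ∀ (a b : Word k) (vs : Vec (Word n) k) → linComb (a ⊕ b) vs ≡ linComb a vs ⊕ linComb b vs
linComb-⊕ [] [] [] = sym (⊕-identityˡ zeroW)
linComb-⊕ (a ∷ as) (b ∷ bs) (v ∷ vs) = trans (cong₂ _⊕_ (+-· a b v) (linComb-⊕ as bs vs))
  (⊕-middle (a · v) (b · v) _ _)

linComb-· : ∀ a (b : Word k) (vs : Vec (Word n) k) → linComb (a · b) vs ≡ a · linComb b vs
linComb-· a [] [] = sym (·-zeroW a)
linComb-· a (b ∷ bs) (v ∷ vs) = trans (cong₂ _⊕_ (*-· a b v) (linComb-· a bs vs)) (sym (·-⊕ a (b · v) _))

linComb-zero : ∀ (vs : Vec (Word n) k) → linComb zeroW vs ≡ zeroW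
linComb-zero [] = refl
linComb-zero (v ∷ vs) = trans (cong₂ _⊕_ (𝟎-· v) (linComb-zero vs)) (⊕-identityˡ zeroW)

linComb-map : ∀ {f : Word n → Word m} → f zeroW ≡ zeroW → (∀ x y → f (x ⊕ y) ≡ f x ⊕ f y) → (∀ a x → f (a · x) ≡ a · f x) →
  ∀ (a : Word k) vs → f (linComb a vs) ≡ linComb a (map f vs)
linComb-map f0 f+ f· [] [] = f0
linComb-map f0 f+ f· (a ∷ as) (v ∷ vs) = trans (f+ _ _) (cong₂ _⊕_ (f· a v) (linComb-map f0 f+ f· as vs))

linComb-𝟎∷ : ∀ (a : Word k) (vs : Vec (Word n) k) → linComb a (map (𝟎 ∷_) vs) ≡ 𝟎 ∷ linComb a vs
linComb-𝟎∷ [] [] = refl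
linComb-𝟎∷ (a ∷ as) (v ∷ vs) = cong₂ _⊕_ (cong (_∷ a · v) (*₃-zeroʳ a)) (linComb-𝟎∷ as vs)

dot-linComb : ∀ (x : Word n) (a : Word k) vs → (∀ i → dot x (lookup vs i) ≡ 𝟎) → dot x (linComb a vs) ≡ 𝟎
dot-linComb x [] [] h = dot-zeroʳ x
dot-linComb x (a ∷ as) (v ∷ vs) h = trans (dot-⊕ x (a · v) _) (cong₂ _+₃_
  (trans (dot-· a x v) (trans (cong (a *₃_) (h zero)) (*₃-zeroʳ a))) (dot-linComb x as vs (h ∘ suc)))

units : ∀ k → Vec (Word k) k
units zero = []
units (suc k) = (𝟏 ∷ zeroW) ∷ map (𝟎 ∷_) (units k)

linComb-units : ∀ (u : Word k) → linComb u (units k) ≡ u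
linComb-units [] = refl
linComb-units (a ∷ u) = trans (cong₂ _⊕_ (cong₂ _∷_ (*₃-identityʳ a) (·-zeroW a))
  (trans (linComb-𝟎∷ u (units _)) (cong (𝟎 ∷_) (linComb-units u))))
  (cong₂ _∷_ (+₃-identityʳ a) (⊕-identityˡ u))

eqF-sound : ∀ x y → eqF x y ≡ true → x ≡ y
eqF-sound 𝟎 𝟎 e = refl
eqF-sound 𝟏 𝟏 e = refl
eqF-sound 𝟐 𝟐 e = refl

eqW-sound : ∀ (x y : Word n) → eqW x y ≡ true → x ≡ y
eqW-sound [] [] e = refl
eqW-sound (x ∷ xs) (y ∷ ys) e = cong₂ _∷_ (eqF-sound x y (proj₁ (∧-split e))) (eqW-sound xs ys (proj₂ (∧-split {eqF x y} e)))

eqW-refl : ∀ (x : Word n) → eqW x x ≡ true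
eqW-refl [] = refl
eqW-refl (𝟎 ∷ x) = eqW-refl x
eqW-refl (𝟏 ∷ x) = eqW-refl x
eqW-refl (𝟐 ∷ x) = eqW-refl x

member-spec : ∀ (A : Vec (Word m) k) acc u v → member A acc (u Vec.++ v) ≡ eqW (acc ⊕ linComb u A) v
member-spec [] acc [] v = cong (λ z → eqW z v) (sym (⊕-identityʳ acc))
member-spec (w ∷ A) acc (a ∷ u) v = trans (member-spec A (acc ⊕ (a · w)) u v)
  (cong (λ z → eqW z v) (⊕-assoc acc (a · w) _))

gens : Vec (Word m) k → Vec (Word (k + m)) k
gens [] = []
gens (v ∷ vs) = (𝟏 ∷ (zeroW Vec.++ v)) ∷ map (𝟎 ∷_) (gens vs)

linComb-gens : ∀ (a : Word k) (A : Vec (Word m) k) → linComb a (gens A) ≡ a Vec.++ linComb a A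
linComb-gens [] [] = refl
linComb-gens (a ∷ as) (v ∷ A) = trans
  (cong₂ _⊕_ (cong₂ _∷_ (*₃-identityʳ a) (trans (Vecₚ.map-++ (a *₃_) zeroW v) (cong (Vec._++ (a · v)) (·-zeroW a))))
    (trans (linComb-𝟎∷ as (gens A)) (cong (𝟎 ∷_) (linComb-gens as A))))
  (cong₂ _∷_ (+₃-identityʳ a) (trans (Vecₚ.zipWith-++ _+₃_ zeroW (a · v) as _) (cong (Vec._++ ((a · v) ⊕ linComb as A)) (⊕-identityˡ as))))

dot-gens : ∀ (u : Word k) (v : Word m) (A : Vec (Word m) k) i →
  dot (u Vec.++ v) (lookup (gens A) i) ≡ lookup u i +₃ dot v (lookup A i)
dot-gens (a ∷ u) v (w ∷ A) zero = cong₂ _+₃_ (*₃-identityʳ a)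
  (trans (dot-++ u zeroW v w) (cong (_+₃ dot v w) (dot-zeroʳ u)))
dot-gens (a ∷ u) v (w ∷ A) (suc i) = trans (cong (dot (a ∷ (u Vec.++ v))) (Vecₚ.lookup-map i (𝟎 ∷_) (gens A)))
  (trans (cong (_+₃ _) (*₃-zeroʳ a)) (dot-gens u v A i))

lookup-linComb : ∀ (z : Word k) (vs : Vec (Word n) k) i → lookup (linComb z vs) i ≡ dot z (map (λ v → lookup v i) vs)
lookup-linComb [] [] i = Vecₚ.lookup-replicate i 𝟎
lookup-linComb (z ∷ zs) (v ∷ vs) i = trans (Vecₚ.lookup-zipWith _+₃_ i (z · v) _)
  (cong₂ _+₃_ (Vecₚ.lookup-map i (z *₃_) v) (lookup-linComb zs vs i))

opaque
  unfolding negTranspose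
  column-negTranspose : ∀ (A : Vec (Word m) k) i → map (λ v → lookup v i) (negTranspose A) ≡ negW (lookup A i)
  column-negTranspose A i = trans (sym (Vecₚ.tabulate-∘ (λ v → lookup v i) (λ j → tabulate λ i → neg (lookup (lookup A i) j)))) (trans
    (Vecₚ.tabulate-cong λ j → Vecₚ.lookup∘tabulate (λ i → neg (lookup (lookup A i) j)) i)
    (trans (Vecₚ.tabulate-∘ neg (lookup (lookup A i))) (cong negW (Vecₚ.tabulate∘lookup (lookup A i)))))

dot-via-negTranspose : ∀ (A : Vec (Word m) k) v i → lookup (linComb v (negTranspose A)) i ≡ neg (dot v (lookup A i))
dot-via-negTranspose A v i = trans (lookup-linComb v (negTranspose A) i)
  (trans (cong (dot v) (column-negTranspose A i)) (dot-neg v (lookup A i)))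

eqM : Vec (Word n) k → Vec (Word n) k → Bool
eqM [] [] = true
eqM (x ∷ xs) (y ∷ ys) = eqW x y ∧ eqM xs ys

eqM-sound : ∀ (xs ys : Vec (Word n) k) → eqM xs ys ≡ true → xs ≡ ys
eqM-sound [] [] e = refl
eqM-sound (x ∷ xs) (y ∷ ys) e = cong₂ _∷_ (eqW-sound x y (proj₁ (∧-split e))) (eqM-sound xs ys (proj₂ (∧-split {eqW x y} e)))

compose : Vec (Word n) k → Vec (Word m) n → Vec (Word m) k
compose A B = map (λ r → linComb r B) A

linComb-compose : ∀ (u : Word k) (A : Vec (Word n) k) (B : Vec (Word m) n) → linComb (linComb u A) B ≡ linComb u (compose A B)
linComb-compose u A B = linComb-map (linComb-zero B) (λ x y → linComb-⊕ x y B) (λ a x → linComb-· a x B) u A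

-- Then A Aᵗ = -I and Aᵗ A = -I, so that [I | A] generates a self-dual code.
orthogonal : Vec (Word 12) 12 → Bool
orthogonal A = eqM (compose A (negTranspose A)) (units 12) ∧ eqM (compose (negTranspose A) A) (units 12)

light-sound : ∀ r (x : Word n) → light r x ≡ true → wt x ≤ r
light-sound r [] e = z≤n
light-sound r (𝟎 ∷ x) e = light-sound r x e
light-sound (suc r) (𝟏 ∷ x) e = s≤s (light-sound r x e)
light-sound (suc r) (𝟐 ∷ x) e = s≤s (light-sound r x e)

light-complete : ∀ r (x : Word n) → wt x ≤ r → light r x ≡ true
light-complete r [] l = refl
light-complete r (𝟎 ∷ x) l = light-complete r x l
light-complete (suc r) (𝟏 ∷ x) (s≤s l) = light-complete r x l
light-complete (suc r) (𝟐 ∷ x) (s≤s l) = light-complete r x l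

skip-zero : ∀ (w : Word m) (A : Vec (Word m) k) acc u {v} → v ≡ acc ⊕ linComb (𝟎 ∷ u) (w ∷ A) → v ≡ acc ⊕ linComb u A
skip-zero w A acc u e = trans e (cong (acc ⊕_) (trans (cong (_⊕ linComb u A) (𝟎-· w)) (⊕-identityˡ _)))

∈-enum : ∀ (A : Vec (Word m) k) t r acc u v → wt u ≤ t → wt u + wt v ≤ r → v ≡ acc ⊕ linComb u A →
  (u Vec.++ v) ∈ enum A t r acc
∈-enum A zero r acc u v l l′ e with wt≡0 u (ℕₚ.n≤0⇒n≡0 l)
... | refl with trans e (trans (cong (acc ⊕_) (linComb-zero A)) (⊕-identityʳ acc))
... | refl rewrite light-complete r acc (ℕₚ.m+n≤o⇒n≤o _ l′) = here refl
∈-enum [] (suc t) r acc [] v l l′ refl rewrite ⊕-identityʳ acc | light-complete r acc l′ = here refl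
∈-enum (w ∷ A) (suc t) zero acc (𝟎 ∷ u) v l l′ e = ∈-map⁺ (𝟎 ∷_) (∈-enum A (suc t) zero acc u v l l′ (skip-zero w A acc u e))
∈-enum (w ∷ A) (suc t) (suc r) acc (𝟎 ∷ u) v l l′ e =
  ∈-++⁺ˡ (∈-map⁺ (𝟎 ∷_) (∈-enum A (suc t) (suc r) acc u v l l′ (skip-zero w A acc u e)))
∈-enum (w ∷ A) (suc t) (suc r) acc (𝟏 ∷ u) v (s≤s l) (s≤s l′) e =
  ∈-++⁺ʳ (List.map (𝟎 ∷_) (enum A (suc t) (suc r) acc)) (∈-++⁺ˡ (∈-map⁺ (𝟏 ∷_) (∈-enum A t r _ u v l l′
    (trans e (trans (cong (λ z → acc ⊕ (z ⊕ linComb u A)) (𝟏-· w)) (sym (⊕-assoc acc w _)))))))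
∈-enum (w ∷ A) (suc t) (suc r) acc (𝟐 ∷ u) v (s≤s l) (s≤s l′) e =
  ∈-++⁺ʳ (List.map (𝟎 ∷_) (enum A (suc t) (suc r) acc)) (∈-++⁺ʳ (List.map (𝟏 ∷_) (enum A t r (acc ⊕ w)))
    (∈-map⁺ (𝟐 ∷_) (∈-enum A t r _ u v l l′
    (trans e (trans (cong (λ z → acc ⊕ (z ⊕ linComb u A)) (sym (negW-· w))) (sym (⊕-assoc acc (negW w) _)))))))

∈-enumN : ∀ (A : Vec (Word m) k) t r u v → wt u ≤ t → wt u + wt v ≤ r → v ≡ linComb u A → u ≢ zeroW →
  normalize (u Vec.++ v) ≡ u Vec.++ v → (u Vec.++ v) ∈ enumN A t r
∈-enumN [] t r [] v l l′ e z nz = ⊥-elim (z refl)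
∈-enumN (w ∷ A) t r (𝟎 ∷ u) v l l′ e z nz = go t r l l′
  where
  z′ : u ≢ zeroW
  z′ = z ∘ cong (𝟎 ∷_)
  go : ∀ t r → wt u ≤ t → wt u + wt v ≤ r → (𝟎 ∷ (u Vec.++ v)) ∈ enumN (w ∷ A) t r
  go zero r l l′ = ⊥-elim (z′ (wt≡0 u (ℕₚ.n≤0⇒n≡0 l)))
  go (suc t) zero l l′ = ⊥-elim (z′ (wt≡0 u (ℕₚ.m+n≡0⇒m≡0 (wt u) (ℕₚ.n≤0⇒n≡0 l′))))
  go (suc t) (suc r) l l′ = ∈-++⁺ˡ (∈-map⁺ (𝟎 ∷_) (∈-enumN A (suc t) (suc r) u v l l′
    (trans e (trans (cong (_⊕ linComb u A) (𝟎-· w)) (⊕-identityˡ _))) z′ (Vecₚ.∷-injectiveʳ nz)))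
∈-enumN (w ∷ A) (suc t) (suc r) (𝟏 ∷ u) v (s≤s l) (s≤s l′) e z nz =
  ∈-++⁺ʳ (List.map (𝟎 ∷_) (enumN A (suc t) (suc r))) (∈-map⁺ (𝟏 ∷_) (∈-enum A t r w u v l l′
    (trans e (cong (_⊕ linComb u A) (𝟏-· w)))))
∈-enumN (w ∷ A) t r (𝟐 ∷ u) v l l′ e z ()

swapHalves-++ : ∀ (u v : Word 12) → swapHalves (u Vec.++ v) ≡ v Vec.++ u
swapHalves-++ u v with Vec.splitAt 12 (u Vec.++ v)
... | u′ , v′ , e with Vecₚ.++-injective u u′ e
... | refl , refl = refl

heavyTail-++ : ∀ t (u v : Word 12) → heavyTail t (u Vec.++ v) ≡ not (light t v)
heavyTail-++ t u v with Vec.splitAt 12 (u Vec.++ v)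
... | u′ , v′ , e with Vecₚ.++-injective u u′ e
... | refl , refl = refl

wt-++ : ∀ (u : Word k) (v : Word m) → wt (u Vec.++ v) ≡ wt u + wt v
wt-++ [] v = refl
wt-++ (𝟎 ∷ u) v = wt-++ u v
wt-++ (𝟏 ∷ u) v = cong suc (wt-++ u v)
wt-++ (𝟐 ∷ u) v = cong suc (wt-++ u v)

negW-++ : ∀ (u : Word k) (v : Word m) → negW (u Vec.++ v) ≡ negW u Vec.++ negW v
negW-++ u v = Vecₚ.map-++ neg u v

∈-filterᵇ : ∀ {A : Set} (f : A → Bool) {y ys} → f y ≡ true → y ∈ ys → y ∈ List.filterᵇ f ys
∈-filterᵇ f e (here refl) rewrite e = here refl
∈-filterᵇ f {ys = y′ ∷ ys} e (there i) with f y′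
... | true = there (∈-filterᵇ f e i)
... | false = ∈-filterᵇ f e i

opaque
  unfolding smallWords
  ∈-smallWords-light : ∀ s t A {x} → x ∈ enumN A s (suc (s + t)) → x ∈ smallWords s t A
  ∈-smallWords-light s t A = ∈-++⁺ˡ

  ∈-smallWords-heavy : ∀ s t A {y} → heavyTail s y ≡ true → y ∈ enumN (negTranspose A) t (suc (s + t)) →
    normalize (swapHalves y) ∈ smallWords s t A
  ∈-smallWords-heavy s t A h i = ∈-++⁺ʳ (enumN A s (suc (s + t)))
    (∈-map⁺ (λ x → normalize (swapHalves x)) (∈-filterᵇ (heavyTail s) h i))

tails : F3 → List (Word (suc n)) → List (Word n)
tails a [] = []
tails a ((b ∷ w) ∷ xs) = if eqF a b then w ∷ tails a xs else tails a xs

-- The list is sorted into buckets by the first letter, recursively, which avoids comparing all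
-- pairs of words.
distinctW : List (Word n) → Bool
distinctW [] = true
distinctW (_ ∷ []) = true
distinctW {zero} (_ ∷ _ ∷ _) = false
distinctW {suc n} xs@(_ ∷ _ ∷ _) = distinctW (tails 𝟎 xs) ∧ (distinctW (tails 𝟏 xs) ∧ distinctW (tails 𝟐 xs))

eqF-refl : ∀ x → eqF x x ≡ true
eqF-refl 𝟎 = refl
eqF-refl 𝟏 = refl
eqF-refl 𝟐 = refl

∈-tails : ∀ {a} {w : Word n} {xs} → (a ∷ w) ∈ xs → w ∈ tails a xs
∈-tails {a = a} (here refl) rewrite eqF-refl a = here refl
∈-tails {a = a} {xs = (b ∷ _) ∷ _} (there i) with eqF a b
... | true = there (∈-tails i)
... | false = ∈-tails i

Unique-tails : ∀ (xs : List (Word (suc n))) → (∀ a → Unique (tails a xs)) → Unique xs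
Unique-tails [] u = []
Unique-tails ((b ∷ w) ∷ xs) u = All.tabulate (λ { i refl → clash (u b) (∈-tails i) }) ∷ Unique-tails xs (λ a → rest a (u a))
  where
  clash : Unique (tails b ((b ∷ w) ∷ xs)) → w ∈ tails b xs → ⊥
  clash u i rewrite eqF-refl b with u
  ... | ne ∷ _ = All.lookup ne i refl
  rest : ∀ a → Unique (tails a ((b ∷ w) ∷ xs)) → Unique (tails a xs)
  rest a u with eqF a b
  rest a (_ ∷ u) | true = u
  rest a u | false = u

distinctW-sound : ∀ (xs : List (Word n)) → distinctW xs ≡ true → Unique xs
distinctW-sound [] e = []
distinctW-sound (_ ∷ []) e = [] ∷ []
distinctW-sound {suc n} xs@(_ ∷ _ ∷ _) e = Unique-tails xs λ where
    𝟎 → distinctW-sound (tails 𝟎 xs) (proj₁ e₁)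
    𝟏 → distinctW-sound (tails 𝟏 xs) (proj₁ e₂)
    𝟐 → distinctW-sound (tails 𝟐 xs) (proj₂ e₂)
  where
  e₁ = ∧-split {distinctW (tails 𝟎 xs)} e
  e₂ = ∧-split {distinctW (tails 𝟏 xs)} (proj₂ e₁)

isMinor : ℕ → Code n → Word n → Bool
isMinor r C x = C x ∧ ((wt x ≤ᵇ r) ∧ (eqW (normalize x) x ∧ (1 ≤ᵇ wt x)))

-- Evaluation checks that the listed words qualify and are distinct. That no word is missing is
-- proved once for all matrices in `Systematic.minors`.
verified : ℕ → ℕ → Vec (Word 12) 12 → List (Word 24) → Bool
verified s t A H = all (isMinor (suc (s + t)) (code A)) H ∧ distinctW H

≤ᵇ-true : ∀ {a b} → (a ≤ᵇ b) ≡ true → a ≤ b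
≤ᵇ-true {a} {b} e = ℕₚ.≤ᵇ⇒≤ a b (subst T (sym e) _)

module Systematic (A : Vec (Word 12) 12) (wf : orthogonal A ≡ true) where
  private
    C = code A
    A⁻ = negTranspose A
    w₂ = ∧-split {eqM (compose A A⁻) (units 12)} wf

  there-back : ∀ u → linComb (linComb u A) A⁻ ≡ u
  there-back u = trans (linComb-compose u A A⁻) (trans (cong (linComb u) (eqM-sound _ _ (proj₁ w₂))) (linComb-units u))

  back-there : ∀ v → linComb (linComb v A⁻) A ≡ v
  back-there v = trans (linComb-compose v A⁻ A) (trans (cong (linComb v) (eqM-sound _ _ (proj₂ w₂))) (linComb-units v))

  code-++ : ∀ u v → C (u Vec.++ v) ≡ eqW (linComb u A) v
  code-++ u v = trans (member-spec A zeroW u v) (cong (λ z → eqW z v) (⊕-identityˡ (linComb u A)))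

  code⁺ : ∀ u v → v ≡ linComb u A → C (u Vec.++ v) ≡ true
  code⁺ u v refl = trans (code-++ u v) (eqW-refl v)

  code⁻ : ∀ u v → C (u Vec.++ v) ≡ true → v ≡ linComb u A
  code⁻ u v e = sym (eqW-sound _ _ (trans (sym (code-++ u v)) e))

  linear : IsLinear C
  linear = code⁺ zeroW zeroW (sym (linComb-zero A)) , plus , times
    where
    plus : ∀ x y → x ∈C C → y ∈C C → (x ⊕ y) ∈C C
    plus x y p q with Vec.splitAt 12 x | Vec.splitAt 12 y
    ... | u , v , refl | u′ , v′ , refl = trans (cong C (Vecₚ.zipWith-++ _+₃_ u v u′ v′)) (code⁺ (u ⊕ u′) (v ⊕ v′)
      (trans (cong₂ _⊕_ (code⁻ u v p) (code⁻ u′ v′ q)) (sym (linComb-⊕ u u′ A))))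
    times : ∀ a x → x ∈C C → (a · x) ∈C C
    times a x p with Vec.splitAt 12 x
    ... | u , v , refl = trans (cong C (Vecₚ.map-++ (a *₃_) u v)) (code⁺ (a · u) (a · v)
      (trans (cong (a ·_) (code⁻ u v p)) (sym (linComb-· a u A))))

  hasDim : HasDim C 12
  hasDim = gens A ,
    (λ a e → proj₁ (Vecₚ.++-injective a zeroW (trans (sym (linComb-gens a A)) e))) ,
    λ x → to x , from x
    where
    to : ∀ x → x ∈C C → Σ (Word 12) λ a → x ≡ linComb a (gens A)
    to x p with Vec.splitAt 12 x
    ... | u , v , refl = u , sym (trans (linComb-gens u A) (cong (u Vec.++_) (sym (code⁻ u v p))))
    from : ∀ x → Σ (Word 12) (λ a → x ≡ linComb a (gens A)) → x ∈C C
    from x (a , refl) = trans (cong C (linComb-gens a A)) (code⁺ a _ refl)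

  -- Orthogonality to the generators says that `u` equals `linComb v A⁻`, and multiplication by `A`
  -- inverts this.
  dual-row : ∀ u v → (∀ i → dot (u Vec.++ v) (lookup (gens A) i) ≡ 𝟎) → v ≡ linComb u A
  dual-row u v h = trans (sym (back-there v)) (cong (λ z → linComb z A) (lookup-ext {x = linComb v A⁻} {u} λ i →
    trans (dot-via-negTranspose A v i) (isolate _ _ (trans (sym (dot-gens u v A i)) (h i)))))
    where
    isolate : ∀ a b → a +₃ b ≡ 𝟎 → neg b ≡ a
    isolate 𝟎 𝟎 e = refl
    isolate 𝟏 𝟐 e = refl
    isolate 𝟐 𝟏 e = refl
    lookup-ext : ∀ {n} {x y : Word n} → (∀ i → lookup x i ≡ lookup y i) → x ≡ y
    lookup-ext {x = x} {y} e = trans (sym (Vecₚ.tabulate∘lookup x)) (trans (Vecₚ.tabulate-cong e) (Vecₚ.tabulate∘lookup y))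

  gens-orth : ∀ u v → v ≡ linComb u A → ∀ i → dot (u Vec.++ v) (lookup (gens A) i) ≡ 𝟎
  gens-orth u v e i = trans (dot-gens u v A i) (trans (cong (_+₃ dot v (lookup A i))
    (trans (cong (λ z → lookup z i) (trans (sym (there-back u)) (cong (λ z → linComb z A⁻) (sym e)))) (dot-via-negTranspose A v i)))
    (cancel (dot v (lookup A i))))
    where
    cancel : ∀ x → neg x +₃ x ≡ 𝟎
    cancel x = trans (+₃-comm (neg x) x) (+₃-inverseʳ x)

  selfDual : IsSelfDual C
  selfDual x = to , from
    where
    to : x ∈C C → x ∈Dual C
    to p y q with Vec.splitAt 12 x | proj₁ (proj₂ (proj₂ hasDim) y) q
    ... | u , v , refl | b , refl = dot-linComb (u Vec.++ v) b (gens A) (gens-orth u v (code⁻ u v p))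
    from : x ∈Dual C → x ∈C C
    from h with Vec.splitAt 12 x
    ... | u , v , refl = code⁺ u v (dual-row u v λ i → h _ (proj₂ (proj₂ (proj₂ hasDim) _) (lookup (units 12) i , pick-gen (gens A) i)))
      where
      pick-gen : ∀ {k n} (vs : Vec (Word n) k) i → lookup vs i ≡ linComb (lookup (units k) i) vs
      pick-gen (v ∷ vs) zero = sym (trans (cong₂ _⊕_ (𝟏-· v) (linComb-zero vs)) (⊕-identityʳ v))
      pick-gen {suc k} (v ∷ vs) (suc i) = trans (pick-gen vs i) (trans (sym (⊕-identityˡ _))
        (trans (cong (_⊕ _) (sym (𝟎-· v))) (cong (λ z → linComb z (v ∷ vs)) (sym (Vecₚ.lookup-map i (𝟎 ∷_) (units k))))))

  even-code : ∀ x → C (negW x) ≡ C x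
  even-code x = bool-ext
    (λ p → trans (cong C (trans (sym (negW-involutive x)) (negW-· (negW x)))) (proj₂ (proj₂ linear) 𝟐 (negW x) p))
    (λ p → trans (cong C (negW-· x)) (proj₂ (proj₂ linear) 𝟐 x p))

  minors : ∀ s t → verified s t A (smallWords s t A) ≡ true → Minors (suc (s + t)) C (smallWords s t A)
  minors s t ok = record
    { even = even-code
    ; unique = distinctW-sound _ (proj₂ w₃)
    ; sound = snd
    ; complete = λ {x} → cmp {x} }
    where
    r = suc (s + t)
    w₃ = ∧-split {all (isMinor r C) (smallWords s t A)} ok
    snd : ∀ {x} → x ∈ smallWords s t A → C x ≡ true × wt x ≤ r × normalize x ≡ x × x ≢ zeroW
    snd {x} i with ∧-split {C x} (all-∈ (isMinor r C) (proj₁ w₃) i)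
    ... | c , e with ∧-split {wt x ≤ᵇ r} e
    ... | l , e′ with ∧-split {eqW (normalize x) x} e′
    ... | q , z = c , ≤ᵇ-true l , eqW-sound _ _ q , λ { refl → case z of λ () }
    cmp : ∀ {x} → C x ≡ true → wt x ≤ r → normalize x ≡ x → x ≢ zeroW → x ∈ smallWords s t A
    cmp {x} c l nz z with Vec.splitAt 12 x
    ... | u , v , refl with wt u ℕ.≤? s
    ... | yes l₃ = ∈-smallWords-light s t A (∈-enumN A s r u v l₃ (subst (_≤ r) (wt-++ u v) l) (code⁻ u v c) u≢0 nz)
      where
      u≢0 : u ≢ zeroW
      u≢0 refl = z (cong (zeroW {12} Vec.++_) (trans (code⁻ u v c) (linComb-zero A)))
    -- The left half has weight at least `suc s`, so at most `t` is left for the right half, and the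
    -- word appears in the enumeration by right halves.
    ... | no l₃ = subst (_∈ smallWords s t A) eq (∈-smallWords-heavy s t A hv mem)
      where
      l₄ : suc s ≤ wt u
      l₄ = ℕₚ.≰⇒> l₃
      l₆ : wt u + wt v ≤ r
      l₆ = subst (_≤ r) (wt-++ u v) l
      lv : wt v ≤ t
      lv = ℕₚ.+-cancelˡ-≤ (suc s) _ _ (ℕₚ.≤-trans (ℕₚ.+-monoˡ-≤ (wt v) l₄) l₆)
      u≡ : u ≡ linComb v A⁻
      u≡ = trans (sym (there-back u)) (cong (λ z → linComb z A⁻) (sym (code⁻ u v c)))
      v≢0 : v ≢ zeroW
      v≢0 refl = ℕₚ.n≮0 (subst (s <_) (trans (cong wt (trans u≡ (linComb-zero A⁻))) (wt-zeroW 12)) l₄)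
      heavy : ∀ (w : Word 12) → wt w ≡ wt u → not (light s w) ≡ true
      heavy w e with light s w in e′
      ... | false = refl
      ... | true = ⊥-elim (l₃ (subst (_≤ s) e (light-sound s w e′)))
      wl₆ : ∀ {a b} → a ≡ wt v → b ≡ wt u → a + b ≤ r
      wl₆ p q = subst (_≤ r) (trans (+-comm (wt u) (wt v)) (sym (cong₂ _+_ p q))) l₆
      y = v Vec.++ u
      -- That enumeration lists only one of `y` and its negative. Either may be the normalized one;
      -- swapping the halves back and normalizing again gives the original word in both cases.
      data Side : Set where
        plus : normalize y ≡ y → Side
        minus : normalize y ≡ negW v Vec.++ negW u → Side
      side : Side
      side with normalize-cases y
      ... | inj₁ e = plus e
      ... | inj₂ e = minus (trans e (negW-++ v u))
      neg-u≡ : negW u ≡ linComb (negW v) A⁻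
      neg-u≡ = trans (negW-· u) (trans (cong (𝟐 ·_) u≡) (trans (sym (linComb-· 𝟐 v A⁻)) (cong (λ z → linComb z A⁻) (sym (negW-· v)))))
      neg-v≢0 : negW v ≢ zeroW
      neg-v≢0 e = v≢0 (trans (sym (negW-involutive v)) (trans (cong negW e) negW-zeroW))
      mem : normalize y ∈ enumN A⁻ t r
      mem with side
      ... | plus e = subst (_∈ enumN A⁻ t r) (sym e) (∈-enumN A⁻ t r v u lv (wl₆ refl refl) u≡ v≢0 e)
      ... | minus e = subst (_∈ enumN A⁻ t r) (sym e) (∈-enumN A⁻ t r (negW v) (negW u)
        (subst (_≤ t) (sym (wt-neg v)) lv) (wl₆ (wt-neg v) (wt-neg u)) neg-u≡ neg-v≢0
        (trans (cong normalize (sym e)) (trans (normalize-idem y) e)))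
      hv : heavyTail s (normalize y) ≡ true
      hv with side
      ... | plus e = trans (cong (heavyTail s) e) (trans (heavyTail-++ s v u) (heavy u refl))
      ... | minus e = trans (cong (heavyTail s) e) (trans (heavyTail-++ s (negW v) (negW u)) (heavy (negW u) (wt-neg u)))
      eq : normalize (swapHalves (normalize y)) ≡ u Vec.++ v
      eq with side
      ... | plus e = trans (cong (normalize ∘ swapHalves) e) (trans (cong normalize (swapHalves-++ v u)) nz)
      ... | minus e = trans (cong (normalize ∘ swapHalves) e) (trans (cong normalize (trans (swapHalves-++ (negW v) (negW u)) (sym (negW-++ u v))))
        (trans (normalize-neg (u Vec.++ v)) nz))

  private
    H = smallWords 3 2 A

  module MinWt (ok : verified 3 2 A H ≡ true) where
    open Minors (minors 3 2 ok)

    heaviest : ∀ d → d ≤ 7 → all (λ x → d ≤ᵇ wt x) H ≡ true → ∀ x → x ∈C C → x ≢ zeroW → d ≤ wt x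
    heaviest d d≤7 ok x c z with wt x ℕ.≤? 6
    -- Words outside the list weigh at least 7, whence the restriction on `d`.
    ... | no l = ℕₚ.≤-trans d≤7 (ℕₚ.≰⇒> l)
    ... | yes l = subst (d ≤_) (wt-normalize x) (≤ᵇ-true (all-∈ (λ x → d ≤ᵇ wt x) ok
      (complete (trans (normalize-even C even-code x) c) (subst (_≤ 6) (sym (wt-normalize x)) l) (normalize-idem x) (z ∘ normalize-zero))))

    hasMinWt : ∀ d → d ≤ 7 → all (λ x → d ≤ᵇ wt x) H ∧ any (λ x → wt x ≡ᵇ d) H ≡ true → HasMinWt C d
    hasMinWt d d≤7 ok with ∧-split {all (λ x → d ≤ᵇ wt x) H} ok
    ... | lo , at = (let (x , i , e) = attained H at ; s = sound i in x , proj₁ s , proj₂ (proj₂ (proj₂ s)) , ≡ᵇ-true e) ,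
        heaviest d d≤7 lo
      where
      attained : ∀ xs → any (λ x → wt x ≡ᵇ d) xs ≡ true → ∃ λ x → x ∈ xs × (wt x ≡ᵇ d) ≡ true
      attained (x ∷ xs) e with wt x ≡ᵇ d in p
      ... | true = x , here refl , p
      ... | false with attained xs e
      ... | y , i , q = y , there i , q

-- F₃-sums are determined by ℕ-sums of representatives.
residue : ℕ → F3
residue zero = 𝟎
residue (suc a) = 𝟏 +₃ residue a

residue-+ : ∀ a b → residue (a + b) ≡ residue a +₃ residue b
residue-+ zero b = refl
residue-+ (suc a) b = trans (cong (𝟏 +₃_) (residue-+ a b)) (sym (+₃-assoc 𝟏 (residue a) (residue b)))

lift : F3 → ℕ
lift 𝟎 = 0
lift 𝟏 = 1
lift 𝟐 = 2

residue-lift : ∀ x → residue (lift x) ≡ x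
residue-lift 𝟎 = refl
residue-lift 𝟏 = refl
residue-lift 𝟐 = refl

sumF-residue : ∀ (xs : Word n) → sumF xs ≡ residue (sum (map lift xs))
sumF-residue [] = refl
sumF-residue (x ∷ xs) = trans (cong₂ _+₃_ (sym (residue-lift x)) (sumF-residue xs)) (sym (residue-+ (lift x) _))

module SymWords (h : Sym n) where
  open Sym h
  open Invariance h using (hW)

  sumF-h : ∀ (xs : Word n) → sumF (app id xs) ≡ sumF xs
  sumF-h xs = trans (sumF-residue (app id xs)) (trans (cong residue
    (trans (cong sum (sym (app-map lift (λ _ → refl) xs))) (app-sum (map lift xs)))) (sym (sumF-residue xs)))

  dot-h : ∀ x y → dot (hW x) (hW y) ≡ dot x y
  dot-h x y = trans (cong sumF (sym (app-zipWith _*₃_ neg-* x y))) (sumF-h (zipWith _*₃_ x y))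

  hW-⊕ : ∀ x y → hW (x ⊕ y) ≡ hW x ⊕ hW y
  hW-⊕ = app-zipWith _+₃_ (λ x y → sym (neg-+ x y))

  hW-zero : hW zeroW ≡ zeroW
  hW-zero = app-replicate 𝟎 refl

  hW-· : ∀ a x → hW (a · x) ≡ a · hW x
  hW-· a = app-map (a *₃_) (*-neg a)
    where
    *-neg : ∀ a x → a *₃ neg x ≡ neg (a *₃ x)
    *-neg = toWitness {a? = all₃? λ a → all₃? λ x → (a *₃ neg x) ≟F neg (a *₃ x)} _

-- Hyperbolic coordinates for words

Pairs : ℕ → ℕ → Set
Pairs n = Vec (Word n × Word n)

ψ : Pairs n m → Hyp m → Word n
ψ [] [] = zeroW
ψ ((e , f) ∷ bs) ((a , b) ∷ u) = ((a · e) ⊕ (b · f)) ⊕ ψ bs u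

χ : Pairs n m → Word n → Hyp m
χ bs v = map (λ (e , f) → dot v f , dot v e) bs

zero? : F3 → Bool
zero? x = eqF x 𝟎

perpendicular : Word n → Pairs n m → Bool
perpendicular x [] = true
perpendicular x ((e , f) ∷ bs) = (zero? (dot x e) ∧ zero? (dot x f)) ∧ perpendicular x bs

hyperbolic : Pairs n m → Bool
hyperbolic [] = true
hyperbolic ((e , f) ∷ bs) = ((zero? (dot e e) ∧ zero? (dot f f)) ∧ eqF (dot e f) 𝟏) ∧
  ((perpendicular e bs ∧ perpendicular f bs) ∧ hyperbolic bs)

dot-⊕ˡ : ∀ (x y z : Word n) → dot (x ⊕ y) z ≡ dot x z +₃ dot y z
dot-⊕ˡ x y z = trans (dot-sym (x ⊕ y) z) (trans (dot-⊕ z x y) (cong₂ _+₃_ (dot-sym z x) (dot-sym z y)))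

dot-·ˡ : ∀ a (x y : Word n) → dot (a · x) y ≡ a *₃ dot x y
dot-·ˡ a x y = trans (dot-sym (a · x) y) (trans (dot-· a y x) (cong (a *₃_) (dot-sym y x)))

perp-ψ : ∀ (x : Word n) (bs : Pairs n m) → perpendicular x bs ≡ true → ∀ u → dot x (ψ bs u) ≡ 𝟎
perp-ψ x [] p [] = dot-zeroʳ x
perp-ψ x ((e , f) ∷ bs) p ((a , b) ∷ u) with ∧-split {zero? (dot x e) ∧ zero? (dot x f)} p
... | q , r with ∧-split {zero? (dot x e)} q
... | xe , xf = trans (dot-⊕ x _ (ψ bs u)) (cong₂ _+₃_
  (trans (dot-⊕ x (a · e) (b · f)) (cong₂ _+₃_
    (trans (dot-· a x e) (trans (cong (a *₃_) (eqF-sound _ _ xe)) (*₃-zeroʳ a)))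
    (trans (dot-· b x f) (trans (cong (b *₃_) (eqF-sound _ _ xf)) (*₃-zeroʳ b)))))
  (perp-ψ x bs r u))

dot-ψ : ∀ (bs : Pairs n m) → hyperbolic bs ≡ true → ∀ u v → dot (ψ bs u) (ψ bs v) ≡ form u v
dot-ψ {n} [] h [] [] = dot-zeroʳ {n} zeroW
dot-ψ ((e , f) ∷ bs) h ((a , b) ∷ u) ((c , d) ∷ v)
  with ∧-split {(zero? (dot e e) ∧ zero? (dot f f)) ∧ eqF (dot e f) 𝟏} h
... | h₁ , h₂ with ∧-split {zero? (dot e e) ∧ zero? (dot f f)} h₁ | ∧-split {perpendicular e bs ∧ perpendicular f bs} h₂
... | h₃ , ef | h₄ , hb with ∧-split {zero? (dot e e)} h₃ | ∧-split {perpendicular e bs} h₄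
... | ee , ff | pe , pf = trans (dot-⊕ (x ⊕ ψ bs u) y (ψ bs v)) (trans
    (cong₂ _+₃_ (dot-⊕ˡ x (ψ bs u) y) (dot-⊕ˡ x (ψ bs u) (ψ bs v)))
    (trans (cong₂ _+₃_ (cong₂ _+₃_ xy (trans (dot-sym (ψ bs u) y) (comb-ψ c d u)))
      (cong₂ _+₃_ (comb-ψ a b v) (dot-ψ bs hb u v)))
      (cong (_+₃ form u v) (+₃-identityʳ _))))
  where
  x = (a · e) ⊕ (b · f)
  y = (c · e) ⊕ (d · f)
  comb-ψ : ∀ a b v → dot ((a · e) ⊕ (b · f)) (ψ bs v) ≡ 𝟎
  comb-ψ a b v = trans (dot-⊕ˡ (a · e) (b · f) (ψ bs v)) (cong₂ _+₃_
    (trans (dot-·ˡ a e (ψ bs v)) (trans (cong (a *₃_) (perp-ψ e bs pe v)) (*₃-zeroʳ a)))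
    (trans (dot-·ˡ b f (ψ bs v)) (trans (cong (b *₃_) (perp-ψ f bs pf v)) (*₃-zeroʳ b))))
  term : ∀ a c x y {z} → dot x y ≡ z → dot (a · x) (c · y) ≡ a *₃ (c *₃ z)
  term a c x y p = trans (dot-·ˡ a x (c · y)) (cong (a *₃_) (trans (dot-· c x y) (cong (c *₃_) p)))
  arith : ∀ a b c d → (a *₃ (c *₃ 𝟎) +₃ a *₃ (d *₃ 𝟏)) +₃ (b *₃ (c *₃ 𝟏) +₃ b *₃ (d *₃ 𝟎)) ≡ a *₃ d +₃ b *₃ c
  arith = toWitness {a? = all₃? λ a → all₃? λ b → all₃? λ c → all₃? λ d →
    ((a *₃ (c *₃ 𝟎) +₃ a *₃ (d *₃ 𝟏)) +₃ (b *₃ (c *₃ 𝟏) +₃ b *₃ (d *₃ 𝟎))) ≟F (a *₃ d +₃ b *₃ c)} _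
  xy : dot x y ≡ a *₃ d +₃ b *₃ c
  xy = trans (dot-⊕ˡ (a · e) (b · f) y) (trans (cong₂ _+₃_
    (trans (dot-⊕ (a · e) (c · e) (d · f)) (cong₂ _+₃_
      (term a c e e (eqF-sound _ _ ee)) (term a d e f (eqF-sound _ _ ef))))
    (trans (dot-⊕ (b · f) (c · e) (d · f)) (cong₂ _+₃_
      (term b c f e (trans (dot-sym f e) (eqF-sound _ _ ef))) (term b d f f (eqF-sound _ _ ff)))))
    (arith a b c d))

ψ-⊞ : ∀ (bs : Pairs n m) u v → ψ bs (u ⊞ v) ≡ ψ bs u ⊕ ψ bs v
ψ-⊞ [] [] [] = sym (⊕-identityˡ zeroW)
ψ-⊞ ((e , f) ∷ bs) ((a , b) ∷ u) ((c , d) ∷ v) = trans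
  (cong₂ _⊕_ (trans (cong₂ _⊕_ (+-· a c e) (+-· b d f)) (⊕-middle (a · e) (c · e) (b · f) (d · f))) (ψ-⊞ bs u v))
  (⊕-middle ((a · e) ⊕ (b · f)) ((c · e) ⊕ (d · f)) (ψ bs u) (ψ bs v))

ψ-⊡ : ∀ (bs : Pairs n m) s u → ψ bs (s ⊡ u) ≡ s · ψ bs u
ψ-⊡ [] s [] = sym (·-zeroW s)
ψ-⊡ ((e , f) ∷ bs) s ((a , b) ∷ u) = trans
  (cong₂ _⊕_ (trans (cong₂ _⊕_ (*-· s a e) (*-· s b f)) (sym (·-⊕ s (a · e) (b · f)))) (ψ-⊡ bs s u))
  (sym (·-⊕ s _ (ψ bs u)))

ψ-zero : ∀ (bs : Pairs n m) → ψ bs (replicate m (𝟎 , 𝟎)) ≡ zeroW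
ψ-zero [] = refl
ψ-zero ((e , f) ∷ bs) = trans (cong₂ _⊕_ (trans (cong₂ _⊕_ (𝟎-· e) (𝟎-· f)) (⊕-identityˡ zeroW)) (ψ-zero bs)) (⊕-identityˡ zeroW)

-- By linearity it is enough to reproduce the unit vectors. The coefficient of e is the product with
-- f and conversely, which is `χ`.
spanning : Pairs n m → Bool
spanning {n} bs = eqM (map (λ v → ψ bs (χ bs v)) (units n)) (units n)

ψ-surjective : ∀ (bs : Pairs n m) → spanning bs ≡ true → ∀ x → ∃ λ u → ψ bs u ≡ x
ψ-surjective {n} {m} bs s x = subst (λ z → ∃ λ u → ψ bs u ≡ z) (linComb-units x) (go x (units n) on-units)
  where
  on-units : ∀ i → ∃ λ u → ψ bs u ≡ lookup (units n) i
  on-units i = χ bs (lookup (units n) i) , trans (sym (Vecₚ.lookup-map i (λ v → ψ bs (χ bs v)) (units n)))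
    (cong (λ M → lookup M i) (eqM-sound (map (λ v → ψ bs (χ bs v)) (units n)) (units n) s))
  go : ∀ {k} (a : Word k) vs → (∀ i → ∃ λ u → ψ bs u ≡ lookup vs i) → ∃ λ u → ψ bs u ≡ linComb a vs
  go [] [] h = replicate m (𝟎 , 𝟎) , ψ-zero bs
  go (a ∷ as) (v ∷ vs) h with h zero | go as vs (h ∘ suc)
  ... | u , p | w , q = (a ⊡ u) ⊞ w , trans (ψ-⊞ bs (a ⊡ u) w) (cong₂ _⊕_ (trans (ψ-⊡ bs a u) (cong (a ·_) p)) q)

form-zeroˡ : ∀ (v : Hyp m) → form (replicate m (𝟎 , 𝟎)) v ≡ 𝟎
form-zeroˡ [] = refl
form-zeroˡ (_ ∷ v) = form-zeroˡ v

module CodeIndex (bs : Pairs n (suc m)) (hyp : hyperbolic bs ≡ true) (span : spanning bs ≡ true) where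

  corner : Word n
  corner = ψ bs ((𝟏 , 𝟎) ∷ replicate m (𝟎 , 𝟎))

  codeIndex : Code n → Fin (count m)
  codeIndex D = index m (red (D ∘ ψ bs))

  selfDual-ψ : ∀ {D : Code n} → IsSelfDual D → SelfDual (D ∘ ψ bs)
  selfDual-ψ {D} sd v = (λ p u q → trans (sym (dot-ψ bs hyp v u)) (proj₁ (sd (ψ bs v)) p (ψ bs u) q)) ,
    λ h → proj₂ (sd (ψ bs v)) λ y q → case ψ-surjective bs span y of λ where
      (u , refl) → trans (dot-ψ bs hyp v u) (h u q)

  -- The corner is the vector e of the first hyperbolic pair. A self-dual code containing it has no
  -- pivot, so it is the preimage of its reduction, and the reduction is determined by its index.
  codeIndex-injective : ∀ {D D′ : Code n} → IsSelfDual D → IsSelfDual D′ → corner ∈C D → corner ∈C D′ →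
    codeIndex D ≡ codeIndex D′ → ∀ x → D x ≡ D′ x
  codeIndex-injective {D} {D′} sd sd′ c c′ e x with ψ-surjective bs span x
  ... | u , refl = bool-ext
      (Fibre.contains-e (selfDual-ψ sd) (selfDual-ψ sd′) (none sd c) (none sd′ c′) reds u)
      (Fibre.contains-e (selfDual-ψ sd′) (selfDual-ψ sd) (none sd′ c′) (none sd c) (sym ∘ reds) u)
    where
    reds = index-injective m (red-SD (selfDual-ψ sd)) (red-SD (selfDual-ψ sd′)) e
    none : ∀ {D : Code n} → IsSelfDual D → corner ∈C D → pivot (D ∘ ψ bs) ≡ nothing
    none {D} s c with pivot (D ∘ ψ bs) in eq
    ... | nothing = refl
    ... | just (a , p) = case trans (sym (cong (𝟏 +₃_) (form-zeroˡ p)))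
        (SD.orth (selfDual-ψ s) c (pivot-just (D ∘ ψ bs) eq)) of λ ()

selfDual-pull : ∀ {C : Code n} (g : Mono n) → IsSelfDual C → IsSelfDual (C ∘ pullW g)
selfDual-pull {C = C} g sd x =
  (λ p y q → trans (sym (SymWords.dot-h (pullSym g) x y)) (proj₁ (sd (pullW g x)) p (pullW g y) q)) ,
  λ h → proj₂ (sd (pullW g x)) λ y q → trans
    (cong (dot (pullW g x)) (sym (pull-push neg-involutive g y)))
    (trans (SymWords.dot-h (pullSym g) x (pushW g y)) (h (pushW g y) (trans (cong C (pull-push neg-involutive g y)) q)))

-- Monomial transformations with a prescribed value

zeros : Word n → ℕ
zeros [] = 0
zeros (𝟎 ∷ x) = suc (zeros x)
zeros (𝟏 ∷ x) = zeros x
zeros (𝟐 ∷ x) = zeros x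

matches : F3 → F3 → List Bool
matches 𝟎 𝟎 = false ∷ true ∷ []
matches 𝟏 𝟏 = false ∷ []
matches 𝟐 𝟐 = false ∷ []
matches 𝟏 𝟐 = true ∷ []
matches 𝟐 𝟏 = true ∷ []
matches _ _ = []

matches-sound : ∀ x a {s} → s ∈ matches x a → flip neg s x ≡ a
matches-sound 𝟎 𝟎 (here refl) = refl
matches-sound 𝟎 𝟎 (there (here refl)) = refl
matches-sound 𝟏 𝟏 (here refl) = refl
matches-sound 𝟏 𝟐 (here refl) = refl
matches-sound 𝟐 𝟏 (here refl) = refl
matches-sound 𝟐 𝟐 (here refl) = refl

matches-unique : ∀ x a → Unique (matches x a)
matches-unique 𝟎 𝟎 = ((λ ()) ∷ []) ∷ [] ∷ []
matches-unique 𝟎 𝟏 = []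
matches-unique 𝟎 𝟐 = []
matches-unique 𝟏 𝟎 = []
matches-unique 𝟏 𝟏 = [] ∷ []
matches-unique 𝟏 𝟐 = [] ∷ []
matches-unique 𝟐 𝟎 = []
matches-unique 𝟐 𝟏 = [] ∷ []
matches-unique 𝟐 𝟐 = [] ∷ []

Choice : ℕ → Set
Choice n = Fin n × Bool

choices : Word n → F3 → List (Choice n)
choices [] a = []
choices (x ∷ xs) a = List.map (zero ,_) (matches x a) ++ List.map (λ (j , s) → suc j , s) (choices xs a)

choices-sound : ∀ (y : Word n) a {j s} → (j , s) ∈ choices y a → flip neg s (lookup y j) ≡ a
choices-sound (x ∷ y) a i with ∈-++⁻ (List.map (zero ,_) (matches x a)) i
... | inj₁ i′ with ∈-map⁻ (zero ,_) i′
... | s , k , refl = matches-sound x a k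
choices-sound (x ∷ y) a i | inj₂ i′ with ∈-map⁻ (λ (j , s) → suc j , s) i′
... | (j , s) , k , refl = choices-sound y a k

choices-unique : ∀ (y : Word n) a → Unique (choices y a)
choices-unique [] a = []
choices-unique (x ∷ y) a = ++⁺ (Unique-map (λ _ _ → λ { refl → refl }) (matches-unique x a))
  (Unique-map (λ _ _ → λ { refl → refl }) (choices-unique y a))
  λ (i , j) → case ∈-map⁻ (zero ,_) i of λ where
    (s , _ , refl) → case ∈-map⁻ (λ (j , s) → suc j , s) j of λ where
      (_ , _ , ())

length-choices-zero : ∀ (y : Word n) → length (choices y 𝟎) ≡ zeros y * 2
length-choices-zero [] = refl
length-choices-zero (𝟎 ∷ y) = cong (2 +_) (trans (Listₚ.length-map _ (choices y 𝟎)) (length-choices-zero y))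
length-choices-zero (𝟏 ∷ y) = trans (Listₚ.length-map _ (choices y 𝟎)) (length-choices-zero y)
length-choices-zero (𝟐 ∷ y) = trans (Listₚ.length-map _ (choices y 𝟎)) (length-choices-zero y)

length-choices-one : ∀ (y : Word n) → length (choices y 𝟏) ≡ wt y
length-choices-one [] = refl
length-choices-one (𝟎 ∷ y) = trans (Listₚ.length-map _ (choices y 𝟏)) (length-choices-one y)
length-choices-one (𝟏 ∷ y) = cong suc (trans (Listₚ.length-map _ (choices y 𝟏)) (length-choices-one y))
length-choices-one (𝟐 ∷ y) = cong suc (trans (Listₚ.length-map _ (choices y 𝟏)) (length-choices-one y))

length-choices-two : ∀ (y : Word n) → length (choices y 𝟐) ≡ wt y
length-choices-two [] = refl
length-choices-two (𝟎 ∷ y) = trans (Listₚ.length-map _ (choices y 𝟐)) (length-choices-two y)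
length-choices-two (𝟏 ∷ y) = cong suc (trans (Listₚ.length-map _ (choices y 𝟐)) (length-choices-two y))
length-choices-two (𝟐 ∷ y) = cong suc (trans (Listₚ.length-map _ (choices y 𝟐)) (length-choices-two y))

solutions : Word n → Word n → List (Mono n)
solutions {zero} y w = tt ∷ []
solutions {suc n} y (a ∷ w) =
  List.concatMap (λ (j , s) → List.map (λ g → j , s , g) (solutions (removeAt y j) w)) (choices y a)

∈-concatMap-origin : ∀ {A B : Set} (f : A → List B) xs {y} → y ∈ List.concatMap f xs → ∃ λ x → x ∈ xs × y ∈ f x
∈-concatMap-origin f xs i = find (∈-concatMap⁻ f {xs = xs} i)

solutions-sound : ∀ (y w : Word n) {g} → g ∈ solutions y w → pullW g y ≡ w
solutions-sound {zero} [] [] i = refl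
solutions-sound {suc n} y (a ∷ w) i
  with ∈-concatMap-origin (λ (j , s) → List.map (λ g → j , s , g) (solutions (removeAt y j) w)) (choices y a) i
... | (j , s) , c , k with ∈-map⁻ (λ g → j , s , g) k
... | g , l , refl = cong₂ _∷_ (choices-sound y a c) (solutions-sound (removeAt y j) w l)

Unique-concatMap : ∀ {A B : Set} (f : A → List B) {xs} → Unique xs → (∀ x → Unique (f x)) →
  (∀ {x y z} → z ∈ f x → z ∈ f y → x ≡ y) → Unique (List.concatMap f xs)
Unique-concatMap f [] u d = []
Unique-concatMap f {x ∷ xs} (ne ∷ us) u d = ++⁺ (u x) (Unique-concatMap f us u d)
  λ (i , j) → clash xs (λ k → All.lookup ne k) i j
  where
  clash : ∀ {z} ys → (∀ {y} → y ∈ ys → x ≢ y) → z ∈ f x → z ∈ List.concatMap f ys → ⊥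
  clash (y ∷ ys) ne i j with ∈-++⁻ (f y) j
  ... | inj₁ k = ne (here refl) (d i k)
  ... | inj₂ k = clash ys (ne ∘ there) i k

solutions-unique : ∀ (y w : Word n) → Unique (solutions y w)
solutions-unique {zero} y w = [] ∷ []
solutions-unique {suc n} y (a ∷ w) = Unique-concatMap _ (choices-unique y a)
  (λ (j , s) → Unique-map (λ _ _ → λ { refl → refl }) (solutions-unique (removeAt y j) w))
  λ i k → case ∈-map⁻ _ i of λ where
    (_ , _ , refl) → case ∈-map⁻ _ k of λ where
      (_ , _ , refl) → refl

length-concatMap : ∀ {A B : Set} (f : A → List B) {c} xs → (∀ {x} → x ∈ xs → length (f x) ≡ c) →
  length (List.concatMap f xs) ≡ length xs * c
length-concatMap f [] h = refl
length-concatMap f (x ∷ xs) h = trans (Listₚ.length-++ (f x)) (cong₂ _+_ (h (here refl)) (length-concatMap f xs (h ∘ there)))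

opaque
  -- The number of monomial transformations between two given words with `t` nonzero and `z` zero
  -- entries. It is opaque so that the factorials are not expanded inside the proofs.
  fixers : ℕ → ℕ → ℕ
  fixers t z = t ! * (z ! * 2 ^ z)

  fixers-0 : fixers 0 0 ≡ 1
  fixers-0 = refl

  fixers-t : ∀ t z → suc t * fixers t z ≡ fixers (suc t) z
  fixers-t t z = sym (ℕₚ.*-assoc (suc t) (t !) _)

  fixers-z : ∀ t z → suc z * 2 * fixers t z ≡ fixers t (suc z)
  fixers-z t z = begin
    suc z * 2 * (t ! * (z ! * 2 ^ z)) ≡⟨ solve 5 (λ a b c d e → a :* b :* (c :* (d :* e)) := c :* (a :* d :* (b :* e))) refl (suc z) 2 (t !) (z !) (2 ^ z) ⟩
    t ! * (suc z * z ! * (2 * 2 ^ z)) ∎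
    where
    open ≡-Reasoning
    open import Data.Nat.Solver using (module +-*-Solver)
    open +-*-Solver

wt-removeAt : ∀ (y : Word (suc n)) j → lookup y j ≢ 𝟎 → wt y ≡ suc (wt (removeAt y j)) × zeros y ≡ zeros (removeAt y j)
wt-removeAt (𝟎 ∷ y) zero ne = ⊥-elim (ne refl)
wt-removeAt (𝟏 ∷ y) zero ne = refl , refl
wt-removeAt (𝟐 ∷ y) zero ne = refl , refl
wt-removeAt (𝟎 ∷ y@(_ ∷ _)) (suc j) ne = let p , q = wt-removeAt y j ne in p , cong suc q
wt-removeAt (𝟏 ∷ y@(_ ∷ _)) (suc j) ne = let p , q = wt-removeAt y j ne in cong suc p , q
wt-removeAt (𝟐 ∷ y@(_ ∷ _)) (suc j) ne = let p , q = wt-removeAt y j ne in cong suc p , q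

zeros-removeAt : ∀ (y : Word (suc n)) j → lookup y j ≡ 𝟎 → wt y ≡ wt (removeAt y j) × zeros y ≡ suc (zeros (removeAt y j))
zeros-removeAt (𝟎 ∷ y) zero e = refl , refl
zeros-removeAt (𝟎 ∷ y@(_ ∷ _)) (suc j) e = let p , q = zeros-removeAt y j e in p , cong suc q
zeros-removeAt (𝟏 ∷ y@(_ ∷ _)) (suc j) e = let p , q = zeros-removeAt y j e in cong suc p , q
zeros-removeAt (𝟐 ∷ y@(_ ∷ _)) (suc j) e = let p , q = zeros-removeAt y j e in cong suc p , q

flip-𝟎 : ∀ s x → flip neg s x ≡ 𝟎 → x ≡ 𝟎
flip-𝟎 false x e = e
flip-𝟎 true 𝟎 e = refl

flip-≢ : ∀ s x {a} → flip neg s x ≡ a → a ≢ 𝟎 → x ≢ 𝟎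
flip-≢ false x refl ne = ne
flip-≢ true 𝟎 refl ne = ne
flip-≢ true 𝟏 e ne ()
flip-≢ true 𝟐 e ne ()

-- A nonzero entry of `w` can come from any remaining nonzero entry of `y`, with forced sign; a zero
-- entry can come from any remaining zero, with either sign.
length-solutions : ∀ (y w : Word n) → wt y ≡ wt w → zeros y ≡ zeros w → length (solutions y w) ≡ fixers (wt w) (zeros w)
length-solutions {zero} [] [] e e′ = sym fixers-0
length-solutions {suc n} y (𝟎 ∷ w) e e′ = trans
  (length-concatMap _ (choices y 𝟎) λ { {j , s} i → trans (Listₚ.length-map _ (solutions (removeAt y j) w))
    (let p , q = zeros-removeAt y j (flip-𝟎 s _ (choices-sound y 𝟎 i)) in
      length-solutions (removeAt y j) w (trans (sym p) e) (ℕₚ.suc-injective (trans (sym q) e′))) })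
  (trans (cong (_* fixers (wt w) (zeros w)) (trans (length-choices-zero y) (cong (_* 2) e′))) (fixers-z (wt w) (zeros w)))
length-solutions {suc n} y (𝟏 ∷ w) e e′ = trans
  (length-concatMap _ (choices y 𝟏) λ { {j , s} i → trans (Listₚ.length-map _ (solutions (removeAt y j) w))
    (let p , q = wt-removeAt y j (flip-≢ s _ (choices-sound y 𝟏 i) λ ()) in
      length-solutions (removeAt y j) w (ℕₚ.suc-injective (trans (sym p) e)) (trans (sym q) e′)) })
  (trans (cong (_* fixers (wt w) (zeros w)) (trans (length-choices-one y) e)) (fixers-t (wt w) (zeros w)))
length-solutions {suc n} y (𝟐 ∷ w) e e′ = trans
  (length-concatMap _ (choices y 𝟐) λ { {j , s} i → trans (Listₚ.length-map _ (solutions (removeAt y j) w))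
    (let p , q = wt-removeAt y j (flip-≢ s _ (choices-sound y 𝟐 i) λ ()) in
      length-solutions (removeAt y j) w (ℕₚ.suc-injective (trans (sym p) e)) (trans (sym q) e′)) })
  (trans (cong (_* fixers (wt w) (zeros w)) (trans (length-choices-two y) e)) (fixers-t (wt w) (zeros w)))

wt+zeros : ∀ (x : Word n) → wt x + zeros x ≡ n
wt+zeros [] = refl
wt+zeros (𝟎 ∷ x) = trans (+-suc (wt x) (zeros x)) (cong suc (wt+zeros x))
wt+zeros (𝟏 ∷ x) = cong suc (wt+zeros x)
wt+zeros (𝟐 ∷ x) = cong suc (wt+zeros x)

zeros-wt : ∀ (x : Word n) → zeros x ≡ n ∸ wt x
zeros-wt {n} x = trans (sym (ℕₚ.m+n∸m≡n (wt x) (zeros x))) (cong (_∸ wt x) (wt+zeros x))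

length-solutions′ : ∀ {t} (y w : Word n) → wt y ≡ t → wt w ≡ t → length (solutions y w) ≡ fixers t (n ∸ t)
length-solutions′ y w e refl = trans (length-solutions y w e (trans (zeros-wt y) (trans (cong (_ ∸_) e) (sym (zeros-wt w)))))
  (cong (fixers (wt w)) (zeros-wt w))

-- Isomorphism and its invariants

-- Equivalence is handled through `Sym` instead of matrices, because colourings have to be
-- transported along with words.
record Iso (C C′ : Code n) : Set₁ where
  field
    to from : Sym n
  open Invariance to public using () renaming (hW to toW)
  open Invariance from public using () renaming (hW to fromW)
  field
    from-to : ∀ x → fromW (toW x) ≡ x
    to-from : ∀ x → toW (fromW x) ≡ x
    carries : ∀ x → C′ (toW x) ≡ C x

pull-iso : ∀ {C C′ : Code n} (g g′ : Mono n) → (∀ x → C (pullW g x) ≡ C′ (pullW g′ x)) → Iso C C′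
pull-iso {C = C} {C′} g g′ e = record
  { to = pullSym g′ ∘ˢ pushSym g
  ; from = pullSym g ∘ˢ pushSym g′
  ; from-to = λ x → trans (cong (pullW g) (push-pull neg-involutive g′ (pushW g x))) (pull-push neg-involutive g x)
  ; to-from = λ x → trans (cong (pullW g′) (push-pull neg-involutive g (pushW g′ x))) (pull-push neg-involutive g′ x)
  ; carries = λ x → trans (sym (e (pushW g x))) (cong C (pull-push neg-involutive g x)) }

sumOver : (A → ℕ) → List A → ℕ
sumOver f [] = 0
sumOver f (x ∷ xs) = f x + sumOver f xs

sumOver-↭ : ∀ (f : A → ℕ) {xs ys} → xs ↭ ys → sumOver f xs ≡ sumOver f ys
sumOver-↭ f Perm.refl = refl
sumOver-↭ f (Perm.prep x p) = cong (f x +_) (sumOver-↭ f p)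
sumOver-↭ f (Perm.swap x y p) = trans (sym (+-assoc (f x) (f y) _))
  (trans (cong₂ _+_ (+-comm (f x) (f y)) (sumOver-↭ f p)) (+-assoc (f y) (f x) _))
sumOver-↭ f (Perm.trans p q) = trans (sumOver-↭ f p) (sumOver-↭ f q)

sumOver-map : ∀ {B : Set} (f : A → ℕ) (g : B → ℕ) (h : A → B) → (∀ x → g (h x) ≡ f x) →
  ∀ xs → sumOver g (List.map h xs) ≡ sumOver f xs
sumOver-map f g h e [] = refl
sumOver-map f g h e (x ∷ xs) = cong₂ _+_ (e x) (sumOver-map f g h e xs)

points-unique : ∀ n → Unique (points n)
points-unique zero = []
points-unique (suc n) = ((λ ()) ∷ nope (λ i → case ∈-map⁻ (𝟎 ∷_) i of λ { (_ , _ , ()) })) ∷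
  nope (λ i → case ∈-map⁻ (𝟎 ∷_) i of λ { (_ , _ , ()) }) ∷
  Unique-map (λ _ _ → Vecₚ.∷-injectiveʳ) (points-unique n)
  where
  nope : ∀ {x : Word (suc n)} {ys} → (x ∈ ys → ⊥) → All (x ≢_) ys
  nope f = All.tabulate λ { i refl → f i }

signature : List (Word n) → ℕ
signature H = hash (steps 2 (weighted H) start)

-- Each signed coordinate is individualized in turn. The sum is invariant because an isomorphism
-- permutes the signed coordinates; it can separate codes that refinement from the uniform colouring
-- does not.
fineSignature : List (Word n) → ℕ
fineSignature {n} H = go (weighted H)
  where
  go : Graph n → ℕ
  go W = sumOver (λ p → hash (steps 2 W (mark 0 p start))) (points n)

module _ {r} {C C′ : Code n} {H H′} (M : Minors r C H) (M′ : Minors r C′ H′) (iso : Iso C C′) where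
  open Iso iso
  open Invariance to

  private
    H↭ = minors-↭ to from M M′ from-to to-from carries

  signature-iso : signature H ≡ signature H′
  signature-iso = sym (begin
    hash (steps 2 (weighted H′) start)      ≡⟨ cong (λ z → hash (steps 2 (weighted H′) z)) (sym start-h) ⟩
    hash (steps 2 (weighted H′) (hS start)) ≡⟨ cong hash (steps-h H H′ H↭ 2 start) ⟩
    hash (hS (steps 2 (weighted H) start))  ≡⟨ hash-h _ ⟩
    hash (steps 2 (weighted H) start) ∎)
    where open ≡-Reasoning

  fineSignature-iso : fineSignature H ≡ fineSignature H′
  fineSignature-iso = sym (trans (sumOver-↭ _ (↭-sym pts)) (sumOver-map _ _ hW one (points n)))
    where
    pts : List.map hW (points n) ↭ points n
    pts = Unique-same-↭ (Unique-map (λ {x} {y} _ _ e → trans (sym (from-to x)) (trans (cong fromW e) (from-to y))) (points-unique n))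
      (points-unique n)
      (λ i → case ∈-map⁻ hW i of λ where
        (p , j , refl) → points-complete (hW p) (trans (wt-hW p) (points-sound j)))
      (λ {x} i → subst (_∈ List.map hW (points n)) (to-from x)
        (∈-map⁺ hW (points-complete (fromW x) (trans (Invariance.wt-hW from x) (points-sound i)))))
    one : ∀ p → hash (steps 2 (weighted H′) (mark 0 (hW p) start)) ≡ hash (steps 2 (weighted H) (mark 0 p start))
    one p = begin
      hash (steps 2 (weighted H′) (mark 0 (hW p) start))
        ≡⟨ cong (λ z → hash (steps 2 (weighted H′) (mark 0 (hW p) z))) (sym start-h) ⟩
      hash (steps 2 (weighted H′) (mark 0 (hW p) (hS start)))
        ≡⟨ cong (hash ∘ steps 2 (weighted H′)) (sym (mark-h 0 p start)) ⟩
      hash (steps 2 (weighted H′) (hS (mark 0 p start))) ≡⟨ cong hash (steps-h H H′ H↭ 2 (mark 0 p start)) ⟩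
      hash (hS (steps 2 (weighted H) (mark 0 p start)))  ≡⟨ hash-h _ ⟩
      hash (steps 2 (weighted H) (mark 0 p start)) ∎
      where open ≡-Reasoning

-- Isomorphism and monomial equivalence

lookup-ext : ∀ {xs ys : Vec X n} → (∀ i → lookup xs i ≡ lookup ys i) → xs ≡ ys
lookup-ext {xs = xs} {ys} e = trans (sym (Vecₚ.tabulate∘lookup xs)) (trans (Vecₚ.tabulate-cong e) (Vecₚ.tabulate∘lookup ys))

×M-linComb : ∀ (x : Word n) (P : Matrix n) → x ×M P ≡ linComb x P
×M-linComb x P = lookup-ext λ j → trans (Vecₚ.lookup∘tabulate _ j)
  (trans (cong sumF (sym (zip x P j))) (sym (lookup-linComb x P j)))
  where
  zip : ∀ {k n} (x : Word k) (P : Vec (Word n) k) j →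
    zipWith _*₃_ x (map (λ v → lookup v j) P) ≡ tabulate λ i → lookup x i *₃ lookup (lookup P i) j
  zip [] [] j = refl
  zip (x ∷ xs) (v ∷ P) j = cong (_ ∷_) (zip xs P j)

dot-unit : ∀ (x : Word n) j → dot x (lookup (units n) j) ≡ lookup x j
dot-unit (x ∷ xs) zero = trans (cong₂ _+₃_ (*₃-identityʳ x) (dot-zeroʳ xs)) (+₃-identityʳ x)
dot-unit {suc n} (x ∷ xs) (suc j) = trans (cong (dot (x ∷ xs)) (Vecₚ.lookup-map j (𝟎 ∷_) (units n)))
  (trans (cong (_+₃ dot xs (lookup (units n) j)) (*₃-zeroʳ x)) (dot-unit xs j))

wt-unit : ∀ i → wt (lookup (units n) i) ≡ 1
wt-unit {suc n} zero = cong suc (wt-zeroW n)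
wt-unit {suc n} (suc i) = trans (cong wt (Vecₚ.lookup-map i (𝟎 ∷_) (units n))) (wt-unit i)

unit-position : ∀ (x : Word n) → wt x ≡ 1 → Σ (Fin n) λ j → lookup x j ≢ 𝟎 × (∀ j′ → lookup x j′ ≢ 𝟎 → j′ ≡ j)
unit-position (𝟎 ∷ x) e with unit-position x e
... | j , ne , u = suc j , ne , λ { zero z → ⊥-elim (z refl) ; (suc j′) z → cong suc (u j′ z) }
unit-position (𝟏 ∷ x) e rewrite wt≡0 x (ℕₚ.suc-injective e) =
  zero , (λ ()) , λ { zero z → refl ; (suc j′) z → ⊥-elim (z (Vecₚ.lookup-replicate j′ 𝟎)) }
unit-position (𝟐 ∷ x) e rewrite wt≡0 x (ℕₚ.suc-injective e) =
  zero , (λ ()) , λ { zero z → refl ; (suc j′) z → ⊥-elim (z (Vecₚ.lookup-replicate j′ 𝟎)) }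

-- The rows of the matrix are the images of the unit vectors, and these have weight 1.
iso⇒equivalent : ∀ {C C′ : Code n} → Iso C C′ → Equivalent C C′
iso⇒equivalent {n} {C} {C′} iso = P , (rows , cols) , λ y →
    (λ p → fromW y , trans (sym (carries (fromW y))) (trans (cong C′ (to-from y)) p) ,
      trans (sym (to-from y)) (sym (×M-to (fromW y)))) ,
    λ { (x , p , refl) → trans (cong C′ (×M-to x)) (trans (carries x) p) }
  where
  open Iso iso
  module T = SymWords to
  P : Matrix n
  P = map toW (units n)
  row : ∀ i → lookup P i ≡ toW (lookup (units n) i)
  row i = Vecₚ.lookup-map i toW (units n)
  -- The map is an isometry, so its inverse is its transpose. The columns of `P` are thus images of
  -- unit vectors under `from` and have weight 1 as well.
  entry-from : ∀ i j → entry P i j ≡ lookup (fromW (lookup (units n) j)) i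
  entry-from i j = begin
    lookup (lookup P i) j                                        ≡⟨ cong (λ v → lookup v j) (row i) ⟩
    lookup (toW (lookup (units n) i)) j                          ≡⟨ sym (dot-unit (toW (lookup (units n) i)) j) ⟩
    dot (toW (lookup (units n) i)) (lookup (units n) j)          ≡⟨ cong (dot (toW (lookup (units n) i))) (sym (to-from (lookup (units n) j))) ⟩
    dot (toW (lookup (units n) i)) (toW (fromW (lookup (units n) j))) ≡⟨ T.dot-h (lookup (units n) i) (fromW (lookup (units n) j)) ⟩
    dot (lookup (units n) i) (fromW (lookup (units n) j))        ≡⟨ dot-sym (lookup (units n) i) _ ⟩
    dot (fromW (lookup (units n) j)) (lookup (units n) i)        ≡⟨ dot-unit (fromW (lookup (units n) j)) i ⟩
    lookup (fromW (lookup (units n) j)) i ∎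
    where open ≡-Reasoning
  rows : ∀ i → Σ (Fin n) λ j → entry P i j ≢ 𝟎 × (∀ j′ → entry P i j′ ≢ 𝟎 → j′ ≡ j)
  rows i = unit-position (lookup P i) (trans (cong wt (row i)) (trans (Invariance.wt-hW to _) (wt-unit i)))
  cols : ∀ j → Σ (Fin n) λ i → entry P i j ≢ 𝟎 × (∀ i′ → entry P i′ j ≢ 𝟎 → i′ ≡ i)
  cols j with unit-position (fromW (lookup (units n) j)) (trans (Invariance.wt-hW from _) (wt-unit j))
  ... | i , ne , u = i , ne ∘ trans (sym (entry-from i j)) , λ i′ z → u i′ (z ∘ trans (entry-from i′ j))
  ×M-to : ∀ x → x ×M P ≡ toW x
  ×M-to x = trans (×M-linComb x P) (trans (sym (linComb-map T.hW-zero T.hW-⊕ T.hW-· x (units n))) (cong toW (linComb-units x)))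

module _ (τ σ : Fin n → Fin n) (τσ : ∀ i → τ (σ i) ≡ i) (στ : ∀ j → σ (τ j) ≡ j) (s : Fin n → Bool) where

  private
    act : (X → X) → Vec X n → Vec X n
    act i xs = tabulate λ j → flip i (s j) (lookup xs (τ j))

    lookup-act : ∀ (i : X → X) xs l → lookup (act i xs) l ≡ flip i (s l) (lookup xs (τ l))
    lookup-act i xs l = Vecₚ.lookup∘tabulate (λ j → flip i (s j) (lookup xs (τ j))) l

  permSym : Sym n
  permSym = record
    { app = act
    ; app-zipWith = λ {_} {_} {_} {i} {j} {k} f h xs ys → lookup-ext λ l → trans (lookup-act k (zipWith f xs ys) l)
        (trans (trans (cong (flip k (s l)) (Vecₚ.lookup-zipWith f (τ l) xs ys)) (flip-zip i j k f h (s l) _ _))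
        (sym (trans (Vecₚ.lookup-zipWith f l (act i xs) (act j ys)) (cong₂ f (lookup-act i xs l) (lookup-act j ys l)))))
    ; app-map = λ {_} {_} {i} {j} f h xs → lookup-ext λ l → trans (lookup-act j (map f xs) l)
        (trans (trans (cong (flip j (s l)) (Vecₚ.lookup-map (τ l) f xs)) (flip-map i j f h (s l) _))
        (sym (trans (Vecₚ.lookup-map l f (act i xs)) (cong f (lookup-act i xs l)))))
    ; app-replicate = λ {_} {i} x h → lookup-ext λ l → trans (Vecₚ.lookup∘tabulate _ l)
        (trans (cong (flip i (s l)) (Vecₚ.lookup-replicate (τ l) x)) (trans (flip-fixed i (s l) x h) (sym (Vecₚ.lookup-replicate l x))))
    ; app-sum = λ xs → trans (cong sum (Vecₚ.tabulate-cong λ l → flip-id (s l) (lookup xs (τ l))))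
        (trans (sum-tabulate (lookup xs ∘ τ)) (trans (sym (sumᶠ-permute ℕₚ.+-0-commutativeMonoid (lookup xs) (permutation τ σ τσ στ)))
        (trans (sym (sum-tabulate (lookup xs))) (cong sum (Vecₚ.tabulate∘lookup xs))))) }
    where
    sum-tabulate : ∀ {n} (f : Fin n → ℕ) → sum (tabulate f) ≡ sumᶠ ℕₚ.+-0-commutativeMonoid f
    sum-tabulate {zero} f = refl
    sum-tabulate {suc n} f = cong (f zero +_) (sum-tabulate (f ∘ suc))

sumF-single : ∀ (f : Fin n → F3) k → (∀ i → i ≢ k → f i ≡ 𝟎) → sumF (tabulate f) ≡ f k
sumF-single f zero h = trans (cong (f zero +₃_) (none (f ∘ suc) λ i → h (suc i) λ ())) (+₃-identityʳ (f zero))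
  where
  none : ∀ {n} (f : Fin n → F3) → (∀ i → f i ≡ 𝟎) → sumF (tabulate f) ≡ 𝟎
  none {zero} f h = refl
  none {suc n} f h = cong₂ _+₃_ (h zero) (none (f ∘ suc) (h ∘ suc))
sumF-single f (suc k) h = trans (cong (_+₃ sumF (tabulate (f ∘ suc))) (h zero λ ()))
  (sumF-single (f ∘ suc) k λ i ne → h (suc i) (ne ∘ Finₚ.suc-injective))

isTwo : F3 → Bool
isTwo 𝟐 = true
isTwo _ = false

*-nonzero : ∀ x c → c ≢ 𝟎 → x *₃ c ≡ flip neg (isTwo c) x
*-nonzero x 𝟎 ne = ⊥-elim (ne refl)
*-nonzero x 𝟏 ne = *₃-identityʳ x
*-nonzero x 𝟐 ne = trans (*₃-comm x 𝟐) (sym (neg-as-* x))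

-- `σ` sends a row to the column of its nonzero entry and `τ` is its inverse. Each column has one
-- entry, so `x ×M P` permutes the coordinates by `τ` and negates those whose entry is `𝟐`.
equivalent⇒iso : ∀ {C C′ : Code n} → Equivalent C C′ → Iso C C′
equivalent⇒iso {n} {C} {C′} (P , (rows , cols) , e) = record
  { to = to ; from = from ; from-to = from-to ; to-from = to-from
  ; carries = λ x → bool-ext
      (λ p → case proj₁ (e (T.hW x)) p of λ where
        (x′ , q , eq) → trans (cong C (trans (sym (from-to x)) (trans (cong F.hW (trans eq (×M-to x′))) (from-to x′)))) q)
      (λ p → proj₂ (e (T.hW x)) (x , p , sym (×M-to x))) }
  where
  σ τ : Fin n → Fin n
  σ i = proj₁ (rows i)
  τ j = proj₁ (cols j)
  στ : ∀ j → σ (τ j) ≡ j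
  στ j = sym (proj₂ (proj₂ (rows (τ j))) j (proj₁ (proj₂ (cols j))))
  τσ : ∀ i → τ (σ i) ≡ i
  τσ i = sym (proj₂ (proj₂ (cols (σ i))) i (proj₁ (proj₂ (rows i))))
  s : Fin n → Bool
  s j = isTwo (entry P (τ j) j)
  to from : Sym n
  to = permSym τ σ τσ στ s
  from = permSym σ τ στ τσ (s ∘ σ)
  module T = Invariance to
  module F = Invariance from
  ×M-to : ∀ x → x ×M P ≡ T.hW x
  ×M-to x = Vecₚ.tabulate-cong λ j → trans
    (sumF-single (λ i → lookup x i *₃ entry P i j) (τ j) λ i ne →
      trans (cong (lookup x i *₃_) (vanish i j ne)) (*₃-zeroʳ (lookup x i)))
    (*-nonzero (lookup x (τ j)) (entry P (τ j) j) (proj₁ (proj₂ (cols j))))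
    where
    vanish : ∀ i j → i ≢ τ j → entry P i j ≡ 𝟎
    vanish i j ne with entry P i j ≟F 𝟎
    ... | yes z = z
    ... | no z = ⊥-elim (ne (proj₂ (proj₂ (cols j)) i z))
  from-to : ∀ x → F.hW (T.hW x) ≡ x
  from-to x = lookup-ext λ i → trans (Vecₚ.lookup∘tabulate _ i) (trans
    (cong (flip neg (s (σ i))) (trans (Vecₚ.lookup∘tabulate _ (σ i)) (cong (λ z → flip neg (s (σ i)) (lookup x z)) (τσ i))))
    (flip-involutive neg neg-involutive (s (σ i)) (lookup x i)))
  to-from : ∀ y → T.hW (F.hW y) ≡ y
  to-from y = lookup-ext λ j → trans (Vecₚ.lookup∘tabulate _ j) (trans
    (cong (flip neg (s j)) (trans (Vecₚ.lookup∘tabulate _ (τ j)) (cong (λ z → flip neg (s z) (lookup y z)) (στ j))))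
    (flip-involutive neg neg-involutive (s j) (lookup y j)))

-- The matrix A of a generator matrix [I | A], with ternary digits for entries,
-- and a chain for the order of the automorphism group.  A wide chain refines
-- with the words of weight ≤ 9, a narrow one with the words of weight ≤ 6.
data Rep : Set where
  narrow : (rounds number : ℕ) → List Level → Rep
  wide : (number : ℕ) → List Level → Rep

matrixOf : Rep → Vec (Word 12) 12
matrixOf (narrow _ N _) = matrix 12 N
matrixOf (wide N _) = matrix 12 N

levelsOf : Rep → List Level
levelsOf (narrow _ _ ls) = ls
levelsOf (wide _ ls) = ls

codeOf : Rep → Code 24
codeOf r = code (matrixOf r)

wordsOf : Rep → List (Word 24)
wordsOf r = smallWords 3 2 (matrixOf r)

-- Auditing a list of representatives

-- The value at denominator 0 is a dummy: the audit requires a positive bound, and `exact` requires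
-- the division to leave no remainder.
quotient : ℕ → ℕ → ℕ
quotient a zero = 0
quotient a (suc b) = a / suc b

ofWeight : ℕ → List (Word n) → List (Word n)
ofWeight t = List.filter (λ x → wt x ℕ.≟ t)

-- The number of transformations that carry a fixed word of weight `t` into the code. The factor 2
-- accounts for the negatives of the listed words.
pointed : ℕ → List (Word 24) → ℕ
pointed t H = length (ofWeight t H) * 2 * fixers t (24 ∸ t)

certified : Rep → Graph 24 → Bool
certified (narrow R N ls) W = Chain.chain R (code (matrix 12 N)) W 3 0 start ls
certified (wide N ls) _ = go (smallWords 4 4 (matrix 12 N))
  where
  go : List (Word 24) → Bool
  go H = verified 4 4 (matrix 12 N) H ∧ Chain.chain 2 (code (matrix 12 N)) (weighted H) 2 0 start ls

minimal : ℕ → List (Word 24) → Bool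
minimal d H = all (λ x → d ≤ᵇ wt x) H ∧ any (λ x → wt x ≡ᵇ d) H

exact : ℕ → List Level → Bool
exact a ls = (quotient a (bound ls) * bound ls) ≡ᵇ a

record Summary : Set where
  constructor summary
  field
    ok : Bool
    -- A share is the number of codes in the orbit through a fixed word of weight 3 or 6, as far as
    -- certified.
    coarse fine share₃ share₆ : ℕ
open Summary

summarize : ℕ → Rep → Summary
summarize d r = share′ (matrixOf r) (wordsOf r)
  where
  share : Vec (Word 12) 12 → List (Word 24) → Graph 24 → ℕ → ℕ → Summary
  share A H W a₃ a₆ = summary
    (orthogonal A ∧ (verified 3 2 A H ∧ (minimal d H ∧ (certified r W ∧
      ((1 ≤ᵇ bound (levelsOf r)) ∧ (exact a₃ (levelsOf r) ∧ exact a₆ (levelsOf r)))))))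
    (hash (steps 2 W start))
    (fineSignature H)
    (quotient a₃ (bound (levelsOf r)))
    (quotient a₆ (bound (levelsOf r)))
  share′ : Vec (Word 12) 12 → List (Word 24) → Summary
  share′ A H = share A H (weighted H) (pointed 3 H) (pointed 6 H)

below : Summary → Summary → Bool
below x y = (coarse x <ᵇ coarse y) ∨ ((coarse x ≡ᵇ coarse y) ∧ (fine x <ᵇ fine y))

-- The representatives are listed in strictly increasing lexicographic order of their invariants. By
-- transitivity, comparing neighbours then separates all pairs.
ascending : List Summary → Bool
ascending [] = true
ascending (x ∷ []) = true
ascending (x ∷ y ∷ ss) = below x y ∧ ascending (y ∷ ss)

judge : List Summary → ℕ → ℕ → Bool
judge ss q₃ q₆ = all ok ss ∧ (ascending ss ∧ ((sumOver share₃ ss ≡ᵇ q₃) ∧ (sumOver share₆ ss ≡ᵇ q₆)))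

audit : ℕ → List Rep → ℕ → ℕ → Bool
audit d rs q₃ q₆ = judge (List.map (summarize d) rs) q₃ q₆

-- Soundness of the audit

_≺_ : Summary → Summary → Set
x ≺ y = coarse x < coarse y ⊎ (coarse x ≡ coarse y × fine x < fine y)

≺-trans : ∀ {x y z} → x ≺ y → y ≺ z → x ≺ z
≺-trans (inj₁ p) (inj₁ q) = inj₁ (ℕₚ.<-trans p q)
≺-trans (inj₁ p) (inj₂ (e , q)) = inj₁ (subst (_ <_) e p)
≺-trans (inj₂ (e , p)) (inj₁ q) = inj₁ (subst (_< _) (sym e) q)
≺-trans (inj₂ (e , p)) (inj₂ (e′ , q)) = inj₂ (trans e e′ , ℕₚ.<-trans p q)

<ᵇ-true : ∀ {a b} → (a <ᵇ b) ≡ true → a < b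
<ᵇ-true {a} {b} e = ℕₚ.<ᵇ⇒< a b (subst T (sym e) _)

below-sound : ∀ x y → below x y ≡ true → x ≺ y
below-sound x y e with coarse x <ᵇ coarse y in l
... | true = inj₁ (<ᵇ-true l)
... | false = let p , q = ∧-split {coarse x ≡ᵇ coarse y} e in inj₂ (≡ᵇ-true p , <ᵇ-true q)

ascending-sound : ∀ ss → ascending ss ≡ true → Linked _≺_ ss
ascending-sound [] e = []
ascending-sound (x ∷ []) e = [-]
ascending-sound (x ∷ y ∷ ss) e = let p , q = ∧-split {below x y} e in below-sound x y p ∷ ascending-sound (y ∷ ss) q

iso-sym : ∀ {C C′ : Code n} → Iso C C′ → Iso C′ C
iso-sym {C = C} {C′} i = record
  { to = from ; from = to ; from-to = to-from ; to-from = from-to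
  ; carries = λ x → trans (sym (carries (fromW x))) (cong C′ (to-from x)) }
  where open Iso i

fixers-positive : ∀ t z → 0 < fixers t z
fixers-positive zero zero = subst (0 <_) (sym fixers-0) (s≤s z≤n)
fixers-positive zero (suc z) = subst (0 <_) (fixers-z zero z) (ℕₚ.*-mono-≤ {1} {suc z * 2} (s≤s z≤n) (fixers-positive zero z))
fixers-positive (suc t) z = subst (0 <_) (fixers-t t z) (ℕₚ.*-mono-≤ {1} {suc t} (s≤s z≤n) (fixers-positive t z))

-- Every monomial transformation fixes the uniform colouring, so all transformations that carry the
-- code to `D` belong to the coset at the top of the chain.
certified-bound : ∀ r → orthogonal (matrixOf r) ≡ true → Minors 6 (codeOf r) (wordsOf r) →
  certified r (weighted (wordsOf r)) ≡ true → ∀ (D : Code 24) ys → Unique ys →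
  (∀ {g} → g ∈ ys → ∀ z → codeOf r (pullW g z) ≡ D z) → length ys ≤ bound (levelsOf r)
certified-bound (narrow R N ls) o M c D ys u e =
  ChainSound.chain-bound R M 3 0 start ls D ys c u e λ {g} {g′} _ _ →
    trans (Invariance.start-h (pushSym g)) (sym (Invariance.start-h (pushSym g′)))
certified-bound (wide N ls) o M c D ys u e with ∧-split {verified 4 4 (matrix 12 N) (smallWords 4 4 (matrix 12 N))} c
... | v , c′ = ChainSound.chain-bound 2 (Systematic.minors (matrix 12 N) o 4 4 v) 2 0 start ls D ys c′ u e λ {g} {g′} _ _ →
    trans (Invariance.start-h (pushSym g)) (sym (Invariance.start-h (pushSym g′)))

module Good (d : ℕ) (r : Rep) (good : ok (summarize d r) ≡ true) where
  A₀ = matrixOf r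
  C = codeOf r
  H = wordsOf r
  ls = levelsOf r

  private
    s₁ = ∧-split {orthogonal A₀} good
    s₂ = ∧-split {verified 3 2 A₀ H} (proj₂ s₁)
    s₃ = ∧-split {minimal d H} (proj₂ s₂)
    s₄ = ∧-split {certified r (weighted H)} (proj₂ s₃)
    s₅ = ∧-split {1 ≤ᵇ bound ls} (proj₂ s₄)
    s₆ = ∧-split {exact (pointed 3 H) ls} (proj₂ s₅)

  module S = Systematic A₀ (proj₁ s₁)

  minors : Minors 6 C H
  minors = S.minors 3 2 (proj₁ s₂)

  properties : d ≤ 7 → SelfDualCode 24 12 d C
  properties l = S.linear , S.hasDim , S.MinWt.hasMinWt (proj₁ s₂) d l (proj₁ s₃) , S.selfDual

  fibre-bound : ∀ (D : Code 24) ys → Unique ys → (∀ {g} → g ∈ ys → ∀ z → C (pullW g z) ≡ D z) → length ys ≤ bound ls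
  fibre-bound = certified-bound r (proj₁ s₁) minors (proj₁ s₄)

  bound-positive : 0 < bound ls
  bound-positive = ≤ᵇ-true (proj₁ s₅)

  exact₃ : quotient (pointed 3 H) (bound ls) * bound ls ≡ pointed 3 H
  exact₃ = ≡ᵇ-true (proj₁ s₆)

  exact₆ : quotient (pointed 6 H) (bound ls) * bound ls ≡ pointed 6 H
  exact₆ = ≡ᵇ-true (proj₂ s₆)

non-isomorphic : ∀ d r d′ r′ → ok (summarize d r) ≡ true → ok (summarize d′ r′) ≡ true →
  summarize d r ≺ summarize d′ r′ → ¬ Iso (codeOf r) (codeOf r′)
non-isomorphic d r d′ r′ g g′ lt iso with lt
... | inj₁ p = ℕₚ.<-irrefl (signature-iso (Good.minors d r g) (Good.minors d′ r′ g′) iso) p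
... | inj₂ (_ , p) = ℕₚ.<-irrefl (fineSignature-iso (Good.minors d r g) (Good.minors d′ r′ g′) iso) p

-- Keeps the listed words of a given weight disjoint from their negatives.
normalized-negW : ∀ {x : Word n} → normalize x ≡ x → normalize (negW x) ≡ negW x → x ≡ zeroW
normalized-negW {x = x} e e′ = go x (trans (sym e′) (trans (normalize-neg x) e))
  where
  go : ∀ {n} (x : Word n) → negW x ≡ x → x ≡ zeroW
  go [] e = refl
  go (𝟎 ∷ x) e = cong (𝟎 ∷_) (go x (Vecₚ.∷-injectiveʳ e))

-- Orbits of codes through a fixed word

-- At least q codes in the orbit of C contain w₀.
record Orbit (C : Code 24) (N : ℕ) (w₀ : Word 24) (ix : Code 24 → Fin N) (q : ℕ) : Set where
  field
    indices : List (Fin N)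
    unique : Unique indices
    many : q ≤ length indices
    sound : ∀ {x} → x ∈ indices → ∃ λ g → C (pullW g w₀) ≡ true × ix (C ∘ pullW g) ≡ x

module Count {m} (bs : Pairs 24 (suc m)) (hyp : hyperbolic bs ≡ true) (span : spanning bs ≡ true)
  (t : ℕ) (wt-corner : wt (CodeIndex.corner bs hyp span) ≡ t) where
  open CodeIndex bs hyp span
  open import Data.List.Relation.Unary.Unique.DecPropositional.Properties (Finₚ._≟_ {count m}) using (deduplicate-!)

  -- The transformations that carry the corner into `C` are spread over the codes they produce. Each
  -- code is reached at most `bound` times, so division gives at least `q` different indices.
  orbit : ∀ d r (good : ok (summarize d r) ≡ true) → ∀ q → q * bound (levelsOf r) ≡ pointed t (wordsOf r) →
    Orbit (codeOf r) (count m) corner codeIndex q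
  orbit d r good q e = record
    { indices = I ; unique = deduplicate-! (List.map f G)
    ; many = ℕₚ.*-cancelʳ-≤ q (length I) (bound ls) {{ℕ.>-nonZero bound-positive}} (begin
        q * bound ls        ≡⟨ e ⟩
        pointed t H         ≡⟨ sym length-G ⟩
        length G            ≤⟨ fibres-bound {f = f} Finₚ._≟_ I G unique-G (λ i → ∈-deduplicate⁺ Finₚ._≟_ (∈-map⁺ f i)) fibre ⟩
        length I * bound ls ∎)
    ; sound = λ i → case ∈-map⁻ f (∈-deduplicate⁻ Finₚ._≟_ (List.map f G) i) of λ where
        (g , j , refl) → g , contains j , refl }
    where
    open ℕₚ.≤-Reasoning
    open Good d r good
    f : Mono 24 → Fin (count m)
    f g = codeIndex (C ∘ pullW g)
    Hₜ L : List (Word 24)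
    Hₜ = ofWeight t H
    L = Hₜ ++ List.map negW Hₜ
    in-H : ∀ {x} → x ∈ Hₜ → x ∈ H × wt x ≡ t
    in-H i = ∈-filter⁻ (λ x → wt x ℕ.≟ t) i
    in-L : ∀ {x} → x ∈ L → C x ≡ true × wt x ≡ t
    in-L i with ∈-++⁻ Hₜ i
    ... | inj₁ j = let p , w = in-H j in proj₁ (Minors.sound minors p) , w
    ... | inj₂ j with ∈-map⁻ negW j
    ... | x , k , refl = let p , w = in-H k in
      trans (Minors.even minors x) (proj₁ (Minors.sound minors p)) , trans (wt-neg x) w
    unique-L : Unique L
    unique-L = ++⁺ (filter⁺ (λ x → wt x ℕ.≟ t) (Minors.unique minors))
      (Unique-map (λ {x} {y} _ _ e → trans (sym (negW-involutive x)) (trans (cong negW e) (negW-involutive y)))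
        (filter⁺ (λ x → wt x ℕ.≟ t) (Minors.unique minors)))
      λ (i , j) → case ∈-map⁻ negW j of λ where
        (x , k , refl) → let s = Minors.sound minors (proj₁ (in-H k)) ; s′ = Minors.sound minors (proj₁ (in-H i)) in
          proj₂ (proj₂ (proj₂ s)) (normalized-negW (proj₁ (proj₂ (proj₂ s))) (proj₁ (proj₂ (proj₂ s′))))
    -- `g` takes the corner to a word of `C`, which is the same as the corner lying in
    -- `C ∘ pullW g`.
    G : List (Mono 24)
    G = List.concatMap (solutions corner) L
    I : List (Fin (count m))
    I = List.deduplicate Finₚ._≟_ (List.map f G)
    unique-G : Unique G
    unique-G = Unique-concatMap (solutions corner) unique-L (solutions-unique corner)
      λ i j → trans (sym (solutions-sound corner _ i)) (solutions-sound corner _ j)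
    length-L : length L ≡ length Hₜ * 2
    length-L = trans (Listₚ.length-++ Hₜ) (trans (cong (length Hₜ +_) (Listₚ.length-map negW Hₜ)) (double (length Hₜ)))
      where
      double : ∀ a → a + a ≡ a * 2
      double a = trans (cong (a +_) (sym (ℕₚ.+-identityʳ a))) (ℕₚ.*-comm 2 a)
    length-G : length G ≡ pointed t H
    length-G = trans (length-concatMap (solutions corner) L λ {w} i → length-solutions′ corner w wt-corner (proj₂ (in-L i)))
      (cong (_* fixers t (24 ∸ t)) length-L)
    contains : ∀ {g} → g ∈ G → C (pullW g corner) ≡ true
    contains i with ∈-concatMap-origin (solutions corner) L i
    ... | w , j , k = trans (cong C (solutions-sound corner w k)) (proj₁ (in-L j))
    fibre : ∀ s ys → Unique ys → (∀ {g} → g ∈ ys → g ∈ G × f g ≡ s) → length ys ≤ bound ls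
    fibre s [] u h = z≤n
    -- Equal indices mean pointwise equal codes, since all of them are self-dual and contain the
    -- corner.
    fibre s ys@(g₀ ∷ _) u h = fibre-bound (C ∘ pullW g₀) ys u λ {g} i →
      codeIndex-injective (selfDual-pull g S.selfDual) (selfDual-pull g₀ S.selfDual)
        (contains (proj₁ (h i))) (contains (proj₁ (h (here refl)))) (trans (proj₂ (h i)) (sym (proj₂ (h (here refl)))))

  record Entry : Set where
    constructor entry-of
    field
      {weight} : ℕ
      rep : Rep
      good : ok (summarize weight rep) ≡ true
      share : ℕ
      exact-share : share * bound (levelsOf rep) ≡ pointed t (wordsOf rep)
  open Entry

  entryCode : Entry → Code 24
  entryCode e = codeOf (rep e)

  entryOrbit : ∀ e → Orbit (entryCode e) (count m) corner codeIndex (share e)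
  entryOrbit e = orbit (weight e) (rep e) (good e) (share e) (exact-share e)

  entry-selfDual : ∀ e → IsSelfDual (entryCode e)
  entry-selfDual e = Good.S.selfDual (weight e) (rep e) (good e)

  indicesOf : List Entry → List (Fin (count m))
  indicesOf = List.concatMap (λ e → Orbit.indices (entryOrbit e))

  locate : ∀ es {x} → x ∈ indicesOf es → ∃ λ e → e ∈ es × x ∈ Orbit.indices (entryOrbit e)
  locate = ∈-concatMap-origin (λ e → Orbit.indices (entryOrbit e))

  same-index-iso : ∀ {C C′ : Code 24} → IsSelfDual C → IsSelfDual C′ → ∀ g g′ →
    C (pullW g corner) ≡ true → C′ (pullW g′ corner) ≡ true →
    codeIndex (C ∘ pullW g) ≡ codeIndex (C′ ∘ pullW g′) → Iso C C′
  same-index-iso s s′ g g′ c c′ e = pull-iso g g′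
    (codeIndex-injective (selfDual-pull g s) (selfDual-pull g′ s′) c c′ e)

  -- An index common to two orbits would be one code equivalent to both representatives.
  indices-unique : ∀ es → AllPairs (λ e e′ → ¬ Iso (entryCode e) (entryCode e′)) es → Unique (indicesOf es)
  indices-unique [] [] = []
  indices-unique (e ∷ es) (ne ∷ nes) = ++⁺ (Orbit.unique (entryOrbit e)) (indices-unique es nes) λ (i , j) →
    let e′ , k , l = locate es j
        g , c , p = Orbit.sound (entryOrbit e) i
        g′ , c′ , p′ = Orbit.sound (entryOrbit e′) l
    in All.lookup ne k (same-index-iso (entry-selfDual e) (entry-selfDual e′) g g′ c c′ (trans p (sym p′)))

  indices-many : ∀ es → sumOver share es ≤ length (indicesOf es)
  indices-many [] = z≤n
  indices-many (e ∷ es) = subst (sumOver share (e ∷ es) ≤_) (sym (Listₚ.length-++ (Orbit.indices (entryOrbit e))))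
    (ℕₚ.+-mono-≤ (Orbit.many (entryOrbit e)) (indices-many es))

  -- The identity map into all of `Fin N` has fibres of at most one element.
  unique-length : ∀ {N} (xs : List (Fin N)) → Unique xs → length xs ≤ N
  unique-length {N} xs u = subst (length xs ≤_) (trans (ℕₚ.*-identityʳ _) (Listₚ.length-tabulate id))
    (fibres-bound {f = id} Finₚ._≟_ (List.allFin N) xs u (λ _ → ∈-allFin _) λ s ys v h → single ys v (λ i → proj₂ (h i)))
    where
    single : ∀ {s} (ys : List (Fin N)) → Unique ys → (∀ {y} → y ∈ ys → y ≡ s) → length ys ≤ 1
    single [] u h = z≤n
    single (y ∷ []) u h = s≤s z≤n
    single (y ∷ z ∷ ys) ((ne ∷ _) ∷ _) h = ⊥-elim (ne (trans (h (here refl)) (sym (h (there (here refl))))))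

  -- The orbits exhaust all codes through the corner, since their sizes add up to the number of such codes.
  complete : ∀ es → AllPairs (λ e e′ → ¬ Iso (entryCode e) (entryCode e′)) es → sumOver share es ≡ count m →
    ∀ {D : Code 24} → IsSelfDual D → ∀ z → D z ≡ true → wt z ≡ t → ∃ λ e → e ∈ es × Iso (entryCode e) D
  complete es nes total {D} sd z Dz wz with solutions corner z in eq | length-solutions′ corner z wt-corner wz
  -- The number of solutions is positive, so some transformation carries the corner to `z`; the
  -- corresponding image of `D` contains the corner.
  ... | [] | l = ⊥-elim (ℕₚ.<-irrefl l (fixers-positive t (24 ∸ t)))
  ... | g′ ∷ _ | _ = search (any? (x Finₚ.≟_) (indicesOf es))
    where
    x = codeIndex (D ∘ pullW g′)
    Dc : D (pullW g′ corner) ≡ true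
    Dc = trans (cong D (solutions-sound corner z (subst (g′ ∈_) (sym eq) (here refl)))) Dz
    search : Dec (x ∈ indicesOf es) → ∃ λ e → e ∈ es × Iso (entryCode e) D
    search (yes i) = let e , k , l = locate es i ; g , c , p = Orbit.sound (entryOrbit e) l in
      e , k , same-index-iso (entry-selfDual e) sd g g′ c Dc p
    -- A new index would give more than `count m` distinct elements of `Fin (count m)`.
    search (no ∉) = ⊥-elim (ℕₚ.<-irrefl refl (begin-strict
      count m               ≡⟨ sym total ⟩
      sumOver share es      ≤⟨ indices-many es ⟩
      length (indicesOf es) <⟨ unique-length (x ∷ indicesOf es) (All.tabulate (λ i e → ∉ (subst (_∈ indicesOf es) (sym e) i)) ∷ indices-unique es nes) ⟩
      count m ∎))
      where open ℕₚ.≤-Reasoning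

-- The two lists together

open Summary

sumOver-++ : ∀ (f : A → ℕ) xs ys → sumOver f (xs ++ ys) ≡ sumOver f xs + sumOver f ys
sumOver-++ f [] ys = refl
sumOver-++ f (x ∷ xs) ys = trans (cong (f x +_) (sumOver-++ f xs ys)) (sym (+-assoc (f x) _ _))

found-++ : ∀ (xs ys : List A) {P : A → Set₁} → (∃ λ x → x ∈ xs ++ ys × P x) →
  (∃ λ x → x ∈ xs × P x) ⊎ (∃ λ x → x ∈ ys × P x)
found-++ xs ys (x , i , p) with ∈-++⁻ xs i
... | inj₁ j = inj₁ (x , j , p)
... | inj₂ j = inj₂ (x , j , p)

Audited : ℕ → Rep → Set
Audited d r = ok (summarize d r) ≡ true

Apart : Rep → Rep → Set₁
Apart r r′ = ¬ Iso (codeOf r) (codeOf r′)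

all-sound : ∀ (f : A → Bool) xs → all f xs ≡ true → All (λ x → f x ≡ true) xs
all-sound f xs e = All.tabulate (all-∈ f e)

module Family (d : ℕ) (rs : List Rep) (q₃ q₆ : ℕ) (audited : audit d rs q₃ q₆ ≡ true) where
  private
    ss = List.map (summarize d) rs
    a₁ = ∧-split {all ok ss} audited
    a₂ = ∧-split {ascending ss} (proj₂ a₁)
    a₃ = ∧-split {sumOver share₃ ss ≡ᵇ q₃} (proj₂ a₂)

  goods : All (Audited d) rs
  goods = Allₚ.map⁻ (all-sound ok ss (proj₁ a₁))

  sum₃ : sumOver share₃ ss ≡ q₃
  sum₃ = ≡ᵇ-true {sumOver share₃ ss} {q₃} (proj₁ a₃)

  sum₆ : sumOver share₆ ss ≡ q₆
  sum₆ = ≡ᵇ-true {sumOver share₆ ss} {q₆} (proj₂ a₃)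

  apart : AllPairs Apart rs
  apart = go rs goods (AllPairsₚ.map⁻ (Linked⇒AllPairs (λ {x} {y} {z} → ≺-trans {x} {y} {z}) (ascending-sound ss (proj₁ a₂))))
    where
    go : ∀ rs → All (Audited d) rs → AllPairs (λ r r′ → summarize d r ≺ summarize d r′) rs → AllPairs Apart rs
    go [] [] [] = []
    go (r ∷ rs) (g ∷ gs) (p ∷ ps) =
      All.tabulate (λ {r′} i → non-isomorphic d r d r′ g (All.lookup gs i) (All.lookup p i)) ∷ go rs gs ps

iso-wt : ∀ {C C′ : Code n} (i : Iso C C′) x → C x ≡ true → C′ (Iso.toW i x) ≡ true × wt (Iso.toW i x) ≡ wt x
iso-wt i x c = trans (Iso.carries i x) c , Invariance.wt-hW (Iso.to i) x

min-weight-iso : ∀ {n} {C C′ : Code n} {d d′} → HasMinWt C d → HasMinWt C′ d′ → Iso C C′ → d′ ≤ d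
min-weight-iso {n} {d = d} {d′} ((x , c , nz , w) , _) (_ , lo) i =
  let p , e = iso-wt i x c in
  subst (d′ ≤_) (trans e w) (lo (Iso.toW i x) p λ z → nz (wt≡0 x (trans (sym e) (trans (cong wt z) (wt-zeroW n)))))

minWt : ∀ {C : Code n} {k d} → SelfDualCode n k d C → HasMinWt C d
minWt (_ , _ , h , _) = h

module Classification (rs₆ rs₃ : List Rep) {a₃ a₆ b₃ b₆ : ℕ}
  (audited₆ : audit 6 rs₆ a₃ a₆ ≡ true) (audited₃ : audit 3 rs₃ b₃ b₆ ≡ true) where
  module F₆ = Family 6 rs₆ a₃ a₆ audited₆
  module F₃ = Family 3 rs₃ b₃ b₆ audited₃

  properties₆ : ∀ {r} → r ∈ rs₆ → SelfDualCode 24 12 6 (codeOf r)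
  properties₆ {r} i = Good.properties 6 r (All.lookup F₆.goods i) (ℕₚ.m≤m+n 6 1)

  properties₃ : ∀ {r} → r ∈ rs₃ → SelfDualCode 24 12 3 (codeOf r)
  properties₃ {r} i = Good.properties 3 r (All.lookup F₃.goods i) (ℕₚ.m≤m+n 3 4)

  module Through {m} (bs : Pairs 24 (suc m)) (hyp : hyperbolic bs ≡ true) (span : spanning bs ≡ true)
    (t : ℕ) (wt-corner : wt (CodeIndex.corner bs hyp span) ≡ t)
    (exactₜ : ∀ d r → Audited d r → quotient (pointed t (wordsOf r)) (bound (levelsOf r)) * bound (levelsOf r) ≡ pointed t (wordsOf r))
    where
    open Count bs hyp span t wt-corner

    shareₜ : Rep → ℕ
    shareₜ r = quotient (pointed t (wordsOf r)) (bound (levelsOf r))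

    entries : ∀ d rs → All (Audited d) rs → List Entry
    entries d [] [] = []
    entries d (r ∷ rs) (g ∷ gs) = entry-of r g (shareₜ r) (exactₜ d r g) ∷ entries d rs gs

    origin : ∀ {d rs} gs {e} → e ∈ entries d rs gs → Entry.rep e ∈ rs
    origin (g ∷ gs) (here refl) = here refl
    origin (g ∷ gs) (there i) = there (origin gs i)

    entries-apart : ∀ {d rs} gs → AllPairs Apart rs → AllPairs (λ e e′ → ¬ Iso (entryCode e) (entryCode e′)) (entries d rs gs)
    entries-apart [] [] = []
    entries-apart (g ∷ gs) (p ∷ ps) = All.tabulate (λ i → All.lookup p (origin gs i)) ∷ entries-apart gs ps

    entries-sum : ∀ {d rs} gs → sumOver Entry.share (entries d rs gs) ≡ sumOver shareₜ rs
    entries-sum [] = refl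
    entries-sum {rs = r ∷ rs} (g ∷ gs) = cong (shareₜ r +_) (entries-sum gs)

    es₆ es₃ : List Entry
    es₆ = entries 6 rs₆ F₆.goods
    es₃ = entries 3 rs₃ F₃.goods

    trace : ∀ {d rs} gs {D : Code 24} → (∃ λ e → e ∈ entries d rs gs × Iso (entryCode e) D) → ∃ λ r → r ∈ rs × Iso (codeOf r) D
    trace gs (e , i , iso) = Entry.rep e , origin gs i , iso

    -- Signatures are compared only within each list; between the lists the minimum weight
    -- separates.
    heavier : ∀ {r r′} → r ∈ rs₆ → r′ ∈ rs₃ → Apart r r′
    heavier {r} {r′} i j iso = ℕₚ.<⇒≱ {3} {6} (s≤s (s≤s (s≤s (s≤s z≤n))))
      (min-weight-iso (minWt {C = codeOf r′} {d = 3} (properties₃ j)) (minWt {C = codeOf r} {d = 6} (properties₆ i)) (iso-sym iso))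

    all-apart : AllPairs (λ e e′ → ¬ Iso (entryCode e) (entryCode e′)) (es₆ ++ es₃)
    all-apart = AllPairsₚ.++⁺ (entries-apart F₆.goods F₆.apart) (entries-apart F₃.goods F₃.apart)
      (All.tabulate λ i → All.tabulate λ j → heavier (origin F₆.goods i) (origin F₃.goods j))

    classify : sumOver shareₜ rs₆ + sumOver shareₜ rs₃ ≡ count m →
      ∀ {D : Code 24} → IsSelfDual D → ∀ z → D z ≡ true → wt z ≡ t →
      (∃ λ r → r ∈ rs₆ × Iso (codeOf r) D) ⊎ (∃ λ r → r ∈ rs₃ × Iso (codeOf r) D)
    classify total sd z Dz wz = Sum.map (trace F₆.goods) (trace F₃.goods)
      (found-++ es₆ es₃ (complete (es₆ ++ es₃) all-apart
        (trans (sumOver-++ Entry.share es₆ es₃) (trans (cong₂ _+_ (entries-sum F₆.goods) (entries-sum F₃.goods)) total))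
        sd z Dz wz))

sumOver-list-map : ∀ {B : Set} (f : B → ℕ) (g : A → B) xs → sumOver f (List.map g xs) ≡ sumOver (f ∘ g) xs
sumOver-list-map f g xs = sumOver-map (f ∘ g) f g (λ _ → refl) xs

pairs : ∀ n {m} → Vec (ℕ × ℕ) m → Pairs n m
pairs n = Vec.map λ (a , b) → trits n a , trits n b

-- Pairs of hyperbolic planes from six copies of the tetracode; the first vector
-- is 1³0²¹, respectively 1⁶0¹⁸.
basis₃ basis₆ : Pairs 24 12
basis₃ = pairs 24 ((13 , 74) ∷ (48 , 61) ∷ (1053 , 5994) ∷ (3888 , 4941) ∷ (85293 , 485514) ∷ (314928 , 400221) ∷
  (6908733 , 39326634) ∷ (25509168 , 32417901) ∷ (559607373 , 3185457354) ∷ (2066242608 , 2625849981) ∷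
  (45328197213 , 258022045674) ∷ (167365651248 , 212693848461) ∷ [])
basis₆ = pairs 24 ((364 , 1478) ∷ (750 , 1465) ∷ (351 , 5653) ∷ (2754 , 4563) ∷ (85293 , 485514) ∷ (314928 , 400221) ∷
  (6908733 , 39326634) ∷ (25509168 , 32417901) ∷ (559607373 , 3185457354) ∷ (2066242608 , 2625849981) ∷
  (45328197213 , 258022045674) ∷ (167365651248 , 212693848461) ∷ [])

module Final (v₆ : Vec Rep 166) (v₃ : Vec Rep 170) (a₃ a₆ b₃ b₆ : ℕ)
  (audited₆ : audit 6 (toList v₆) a₃ a₆ ≡ true) (audited₃ : audit 3 (toList v₃) b₃ b₆ ≡ true)
  (total₃ : a₃ + b₃ ≡ count 11) (total₆ : a₆ + b₆ ≡ count 11) where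
  open Classification (toList v₆) (toList v₃) audited₆ audited₃

  module T₃ = Through {11} basis₃ refl refl 3 refl Good.exact₃
  module T₆ = Through {11} basis₆ refl refl 6 refl Good.exact₆

  classify₃ = T₃.classify (trans (cong₂ _+_
    (trans (sym (sumOver-list-map share₃ (summarize 6) (toList v₆))) F₆.sum₃)
    (trans (sym (sumOver-list-map share₃ (summarize 3) (toList v₃))) F₃.sum₃)) total₃)

  classify₆ = T₆.classify (trans (cong₂ _+_
    (trans (sym (sumOver-list-map share₆ (summarize 6) (toList v₆))) F₆.sum₆)
    (trans (sym (sumOver-list-map share₆ (summarize 3) (toList v₃))) F₃.sum₆)) total₆)

  lookup-∈ : ∀ (v : Vec Rep k) i → lookup v i ∈ toList v
  lookup-∈ (r ∷ v) zero = here refl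
  lookup-∈ (r ∷ v) (suc i) = there (lookup-∈ v i)

  index-of : ∀ (v : Vec Rep k) {r} → r ∈ toList v → ∃ λ i → lookup v i ≡ r
  index-of (r ∷ v) (here refl) = zero , refl
  index-of (r ∷ v) (there j) = let i , e = index-of v j in suc i , e

  lookup-apart : ∀ (v : Vec Rep k) → AllPairs Apart (toList v) → ∀ i j → i ≢ j → Apart (lookup v i) (lookup v j)
  lookup-apart (r ∷ v) (p ∷ ps) zero zero ne = ⊥-elim (ne refl)
  lookup-apart (r ∷ v) (p ∷ ps) zero (suc j) ne = All.lookup p (lookup-∈ v j)
  lookup-apart (r ∷ v) (p ∷ ps) (suc i) zero ne = All.lookup p (lookup-∈ v i) ∘ iso-sym
  lookup-apart (r ∷ v) (p ∷ ps) (suc i) (suc j) ne = lookup-apart v ps i j (ne ∘ cong suc)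

  exactly : ∀ {Q : Code 24 → Set} (v : Vec Rep k) → (∀ {r} → r ∈ toList v → Q (codeOf r)) →
    AllPairs Apart (toList v) → (∀ C → Q C → ∃ λ r → r ∈ toList v × Iso (codeOf r) C) → ExactlyUpToEquiv Q k
  exactly {Q = Q} v q ap cl = map codeOf v ,
    (λ i → subst Q (sym (Vecₚ.lookup-map i codeOf v)) (q (lookup-∈ v i))) ,
    (λ i j ne e → lookup-apart v ap i j ne
      (subst₂ Iso (Vecₚ.lookup-map i codeOf v) (Vecₚ.lookup-map j codeOf v) (equivalent⇒iso e))) ,
    λ C QC → let r , i , iso = cl C QC ; l , e = index-of v i in
      l , subst (λ z → Equivalent z C) (sym (trans (Vecₚ.lookup-map l codeOf v) (cong codeOf e))) (iso⇒equivalent iso)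

  theorem : ExactlyUpToEquiv (SelfDualCode 24 12 6) 166 × ExactlyUpToEquiv (SelfDualCode 24 12 3) 170
  theorem = exactly v₆ properties₆ F₆.apart complete₆ , exactly v₃ properties₃ F₃.apart complete₃
    where
    not₃ : ∀ {C} → HasMinWt C 6 → ¬ (∃ λ r → r ∈ toList v₃ × Iso (codeOf r) C)
    not₃ {C} mw (r , i , iso) = ℕₚ.<⇒≱ {3} {6} (s≤s (s≤s (s≤s (s≤s z≤n))))
      (min-weight-iso (minWt {C = codeOf r} {d = 3} (properties₃ i)) mw iso)
    not₆ : ∀ {C} → HasMinWt C 3 → ¬ (∃ λ r → r ∈ toList v₆ × Iso (codeOf r) C)
    not₆ {C} mw (r , i , iso) = ℕₚ.<⇒≱ {3} {6} (s≤s (s≤s (s≤s (s≤s z≤n))))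
      (min-weight-iso mw (minWt {C = codeOf r} {d = 6} (properties₆ i)) (iso-sym iso))
    -- A word of minimum weight is the word through which the code is counted. The count returns a
    -- member of one of the lists, and the minimum weight rules out the other list.
    complete₆ : ∀ C → SelfDualCode 24 12 6 C → ∃ λ r → r ∈ toList v₆ × Iso (codeOf r) C
    complete₆ C (_ , _ , mw@((x , c , _ , w) , _) , sd) = Sum.[ id , ⊥-elim ∘ not₃ mw ] (classify₆ sd x c w)
    complete₃ : ∀ C → SelfDualCode 24 12 3 C → ∃ λ r → r ∈ toList v₃ × Iso (codeOf r) C
    complete₃ C (_ , _ , mw@((x , c , _ , w) , _) , sd) = Sum.[ ⊥-elim ∘ not₆ mw , id ] (classify₃ sd x c w)

-- The representatives and their stabilizer chains

-- With mask 0 nothing is rejected, so the bound is the size of the colour class of the base point.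
free : ℕ → ℕ → Level
free base size = level base [] 0 0 size

opaque
  representatives₆ : Vec Rep 166
  representatives₆ =
    wide 405711416378864418219220782766129495900235318910809357008719364570020 (free 36 48 ∷ level 44 [] 0 1771399578 16 ∷ free 10 4 ∷ []) ∷
    narrow 2 238025419242228590214023327825964680043603803826464712981114328939528 (level 13 (26 ∷ []) 190723832064 214460350270704 24 ∷ level 2 [] 0 2 1 ∷ []) ∷
    narrow 2 225927524783270737177461650948016109471422040772212035717593111702446 (level 0 [] 0 278173170270204 8 ∷ level 10 [] 131038830135 2 1 ∷ []) ∷
    narrow 2 46648643337754805033028515203317853268612825988586762587233403710462 (level 25 (10 ∷ []) 233199289498 67056468754419 12 ∷ level 22 [] 0 2 1 ∷ []) ∷
    narrow 2 478913187712330513107356403222838257156557575373540639207241168600513 (level 3 (20 ∷ []) 125714636764 55016682291 24 ∷ level 11 [] 0 2 1 ∷ []) ∷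
    narrow 1 139581238079180922241089610897448180887081573243073917347084222639862 (free 0 48 ∷ free 6 2 ∷ free 11 4 ∷ free 39 4 ∷ free 42 2 ∷ []) ∷
    narrow 1 83478168754595212081549423622480655537162387285340294008167047912138 (free 0 36 ∷ free 6 4 ∷ free 10 9 ∷ free 21 2 ∷ free 35 2 ∷ free 2 4 ∷ []) ∷
    narrow 2 274677831148610496998783082224731686093356061708948311074919703022510 (level 0 [] 0 267442500468684 16 ∷ level 42 [] 0 2 1 ∷ []) ∷
    narrow 2 65381148067180400104996774594313703501922692147592795683812322216645 (level 23 [] 0 280633217646531 16 ∷ level 10 [] 0 2 1 ∷ []) ∷
    narrow 1 434892071734197933995291270378923628234949477307722061911214566087131 (free 29 48 ∷ free 37 5 ∷ free 21 4 ∷ free 24 3 ∷ level 39 [] 780807037 25 3 ∷ free 46 2 ∷ []) ∷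
    narrow 1 167485928971383731800498184318256965883864156251813492445668153374908 (free 10 24 ∷ free 18 4 ∷ free 2 8 ∷ []) ∷
    narrow 1 287762662782406782947544475889109122063138370647102962965229250747350 (free 8 12 ∷ free 11 2 ∷ free 20 4 ∷ free 3 2 ∷ []) ∷
    narrow 2 277285359112766453842842264879391577810876432881170545516598947673138 (free 2 48 ∷ free 17 20 ∷ level 10 [] 0 2 1 ∷ []) ∷
    narrow 1 343982353058080225535619402843623220927193106045157863514775410525065 (free 12 48 ∷ level 23 [] 0 27 1 ∷ []) ∷
    narrow 1 82793743376424004243120196319142707332825631174290769600323919911214 (free 4 6 ∷ free 11 9 ∷ free 17 2 ∷ free 9 3 ∷ free 28 2 ∷ level 15 [] 135975083021 62 1 ∷ level 44 [] 0 2 1 ∷ []) ∷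
    narrow 1 310608412185321623125378121821675949446445745971093228502897452182566 (free 27 12 ∷ free 38 8 ∷ free 43 2 ∷ free 12 2 ∷ level 1 [] 172979603377 2 1 ∷ []) ∷
    narrow 1 303311191528235936248204669085596266096103722639989164604682755516943 (free 8 4 ∷ free 26 2 ∷ free 13 2 ∷ free 20 2 ∷ []) ∷
    narrow 1 300707089642102394097923887221489881639710355694402946824356724881980 (free 35 16 ∷ level 45 [] 0 1 1 ∷ []) ∷
    narrow 1 266020374397934189129761164223138391064642203646840065650001647746529 (free 2 18 ∷ free 7 2 ∷ free 1 2 ∷ free 5 6 ∷ free 10 4 ∷ []) ∷
    narrow 1 84008128882412841879714337383567531993553496832770339332553791264756 (free 0 18 ∷ free 4 2 ∷ free 2 6 ∷ free 8 3 ∷ level 22 [] 10480904189 6 1 ∷ level 36 [] 117218052284 2 1 ∷ free 18 2 ∷ []) ∷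
    narrow 1 412625494007355898244365566211099226858653006702811490205692941197818 (free 3 8 ∷ free 18 24 ∷ free 47 8 ∷ free 37 2 ∷ []) ∷
    narrow 1 83535838885874157780030173622548104728638651972322786285664569269968 (free 4 16 ∷ level 25 [] 0 2 1 ∷ []) ∷
    narrow 1 182837522129316424525288623117271906810174211417614104610164722683968 (free 10 4 ∷ level 29 [] 0 2 1 ∷ []) ∷
    narrow 2 102295867964972675168892849732748678143890998891436471299512458634597 (free 18 48 ∷ free 36 4 ∷ free 42 2 ∷ []) ∷
    narrow 1 461158675964820272539727345253017619259900630764029707935808533966723 (free 8 12 ∷ free 5 8 ∷ free 20 2 ∷ []) ∷
    narrow 1 463061128178718351123316496373645377106301877823146101689271144449465 (free 12 8 ∷ free 16 4 ∷ []) ∷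
    narrow 1 378933449501143922964654225707852265274560862999260801217365545898429 (free 10 12 ∷ free 2 2 ∷ level 26 [] 0 2 1 ∷ []) ∷
    narrow 1 3744690469171261208554169588578170087812838706666612830376605524695 (free 40 28 ∷ free 4 20 ∷ free 6 6 ∷ free 1 4 ∷ level 39 (2 ∷ []) 117455941670 87718 9 ∷ level 2 [] 178957694800 12 2 ∷ level 44 [] 43352147025 1 1 ∷ []) ∷
    narrow 1 250557797371176317050055784154798834845677114825594238339405519245835 (free 31 8 ∷ free 24 4 ∷ free 18 4 ∷ []) ∷
    narrow 1 360232671509869013200040392562352971642494629577682273091757683944645 (free 43 16 ∷ free 19 4 ∷ free 13 4 ∷ []) ∷
    narrow 1 173542696938121937802106201658149754195191943997896359278792031980609 (free 18 8 ∷ level 5 [] 0 2 1 ∷ []) ∷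
    narrow 1 3782627810749931091226787309159402252435641044554867231197830254676 (free 45 8 ∷ free 11 2 ∷ []) ∷
    narrow 1 3744703172195029774448564599817901953018404625488858784262408042815 (free 0 32 ∷ free 6 4 ∷ free 2 8 ∷ free 20 2 ∷ free 14 4 ∷ []) ∷
    narrow 1 166635377881903293073963709396486748280505403843305796240708651339372 (free 41 18 ∷ free 36 16 ∷ free 0 2 ∷ level 38 (10 ∷ []) 69468727865 1 1 ∷ level 43 [] 112452089770 95 2 ∷ level 16 [] 215689302848 59 1 ∷ level 19 [] 0 1 1 ∷ []) ∷
    narrow 1 161954696558203904761786807987895405018491780311293265331334415777052 (free 4 16 ∷ free 11 2 ∷ []) ∷
    narrow 1 32487108787458412868119090636361153628582796974389360457740892523784 (free 4 16 ∷ level 0 [] 0 2 1 ∷ []) ∷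
    narrow 1 375251921437509848774984608766257338867763554901317405110797735411754 (free 17 16 ∷ free 47 2 ∷ free 28 2 ∷ free 10 4 ∷ []) ∷
    narrow 1 365011848709675149625519469215790019603481123177264934035271395566095 (free 3 4 ∷ level 20 [] 0 2 1 ∷ []) ∷
    narrow 1 814544555846665793602443986233515904946480128302835588002296327455 (free 5 8 ∷ free 2 40 ∷ free 1 4 ∷ free 36 9 ∷ free 26 2 ∷ free 24 20 ∷ free 45 9 ∷ free 11 2 ∷ []) ∷
    narrow 1 180618495723671888508221138323602194405164615357936210481904349799346 (free 6 8 ∷ free 5 4 ∷ free 21 2 ∷ []) ∷
    narrow 1 5380746247573758978538749246523318801618512043310115226804098581407 (free 0 4 ∷ free 17 2 ∷ []) ∷
    narrow 1 77245365399950774485158659328842305664044665756245293823148526200819 (free 21 32 ∷ free 9 2 ∷ free 16 2 ∷ free 5 4 ∷ []) ∷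
    narrow 1 456974542423907022616587236333698459882847169556168301369549630949930 (free 41 12 ∷ free 11 2 ∷ free 43 2 ∷ []) ∷
    narrow 1 479165841361331664422078326097122636048734498943453739331385442248097 (free 0 4 ∷ free 5 4 ∷ free 33 2 ∷ []) ∷
    narrow 1 199359949192577067785342709590592538898540293977434852580271066045101 (free 6 18 ∷ free 26 4 ∷ free 4 18 ∷ free 3 4 ∷ free 18 4 ∷ level 42 [] 91467485206 2 1 ∷ []) ∷
    narrow 1 412237095570900993352662909346239919901296100600900538713840280462594 (free 6 8 ∷ level 22 [] 0 2 1 ∷ []) ∷
    narrow 1 216518179612194029074617856852515560264616445987817603975316822420319 (free 13 12 ∷ level 42 [] 0 2 1 ∷ []) ∷
    narrow 1 105539274293919061312488486671403647516070955691486432000133921142255 (free 9 4 ∷ free 34 2 ∷ []) ∷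
    narrow 1 167517425536189781301472727204239800562125874245138088370944457560186 (free 6 2 ∷ free 14 2 ∷ []) ∷
    narrow 1 435821279808849505464324516355975372717604971648962620109134257707528 (free 18 8 ∷ free 1 6 ∷ free 3 9 ∷ free 11 4 ∷ free 16 2 ∷ []) ∷
    narrow 1 218417427582499511035411283245276951799243040490599878336573963060244 (free 2 8 ∷ free 12 2 ∷ level 9 [] 0 2 1 ∷ []) ∷
    narrow 1 94033443642964151376515716858495306241807109746645834055195313342613 (free 26 8 ∷ free 14 4 ∷ []) ∷
    narrow 1 292558846372994689604952746106515726755543417418511779272499849650603 (free 25 4 ∷ free 45 2 ∷ []) ∷
    narrow 1 482989383839264572540456423810129852018494139187419499909274617263969 (free 3 6 ∷ free 4 4 ∷ free 41 2 ∷ []) ∷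
    narrow 1 478111500268321287122317987165359908302149492732362577468482789552657 (free 45 8 ∷ free 4 2 ∷ free 1 2 ∷ []) ∷
    narrow 1 326783601811517705350763357573720916183017719439902143935383489006159 (free 14 8 ∷ free 2 4 ∷ free 23 2 ∷ []) ∷
    narrow 1 5690734063657878471333581137947088956702280429770671310677476423679 (free 10 4 ∷ free 32 2 ∷ []) ∷
    narrow 1 19242177347493679038903852814633230579881847126218229226092226009614 (free 20 16 ∷ free 47 2 ∷ free 28 6 ∷ free 22 2 ∷ level 11 [] 14287381659 2 1 ∷ level 8 [] 274225783751 2 1 ∷ []) ∷
    narrow 1 358233364563900646139942164372538757757200472552478592279791785955817 (free 42 48 ∷ free 32 2 ∷ free 3 9 ∷ free 9 2 ∷ level 14 [] 192079965257 10049942 12 ∷ free 12 9 ∷ free 17 4 ∷ []) ∷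
    narrow 1 506196579935296642062631311961659032080519028488065080916101535309530 (free 38 32 ∷ free 41 4 ∷ free 6 2 ∷ free 5 2 ∷ []) ∷
    narrow 1 215117421876990924163306324422575284044133398525563323645127928159156 (free 18 4 ∷ free 23 2 ∷ free 9 2 ∷ []) ∷
    narrow 1 5381313858779212416529820575074351521109196235278679864445969958499 (free 10 8 ∷ free 4 2 ∷ []) ∷
    narrow 1 328093152744306504845198193000022545178915813526954747258830058540345 (free 6 12 ∷ level 43 [] 0 12 2 ∷ level 23 [] 0 2 1 ∷ []) ∷
    narrow 1 167517462022634141265445465263809659952553944982633047372612974813039 (free 6 4 ∷ level 25 [] 0 1 1 ∷ []) ∷
    narrow 1 121886700413010974125355140938218317279480896434185420505250538060846 (free 44 4 ∷ free 3 2 ∷ free 0 2 ∷ []) ∷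
    narrow 1 412237095571135377200788666605744790720840308744122805350478151482841 (free 27 4 ∷ level 19 [] 0 1 1 ∷ []) ∷
    narrow 1 418811563360068776026740575334919063669890367584479854329411779600043 (free 14 6 ∷ free 40 2 ∷ free 8 2 ∷ []) ∷
    narrow 1 287762914015701511662372962264676921226196331362559327490870630162660 (free 4 8 ∷ free 28 4 ∷ free 14 16 ∷ free 11 2 ∷ []) ∷
    narrow 1 84008112515271485150354397695273920641855627620388335738970175871520 (free 2 16 ∷ free 14 2 ∷ free 34 2 ∷ []) ∷
    narrow 1 3782521986809505473956516537285397877521362279267078554907121375044 (free 26 4 ∷ free 5 2 ∷ []) ∷
    narrow 1 82504487365652848813927849162302727971177450615027110052810937747288 (free 35 4 ∷ free 27 2 ∷ []) ∷
    narrow 1 90346155364513459398086719180949563756248701254531969152322722345846 (free 39 12 ∷ level 25 [] 0 2 1 ∷ []) ∷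
    narrow 1 471481264972808442418715609840385978719235952895222554325973230707997 (free 8 4 ∷ level 13 [] 0 2 1 ∷ []) ∷
    narrow 1 366613065726087986009634197617796036144129590036333305506730031027450 (free 4 8 ∷ level 20 [] 0 2 1 ∷ []) ∷
    narrow 1 421896732058756403082709345909769975611478301272332695967135362691461 (free 6 8 ∷ free 4 2 ∷ []) ∷
    narrow 1 243670086499718526935453394281720064855108716833515715240427221033662 (free 20 4 ∷ level 14 [] 0 2 1 ∷ []) ∷
    narrow 1 503134215135262411127664073209680795320396226281853795860880459378424 (free 8 8 ∷ free 32 4 ∷ []) ∷
    narrow 1 360863632579737773391788327303342473915574407625468534291020686764719 (free 18 4 ∷ level 27 [] 0 1 1 ∷ []) ∷
    narrow 1 163839167305830164729057540569369917010759738533459180952419209757271 (free 9 16 ∷ free 33 2 ∷ []) ∷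
    narrow 1 298782838738464095329660871244327414307844779005845249171565392747218 (free 16 4 ∷ free 5 2 ∷ []) ∷
    narrow 1 110208577713728894841486595364540357640667121238601561582378110878651 (free 37 6 ∷ free 12 2 ∷ []) ∷
    narrow 1 341372262030720631676114804351493837154102166680378702306388883224100 (free 4 8 ∷ free 24 2 ∷ []) ∷
    narrow 1 110208927624401639962253392614386126731244080581977672519684654395752 (free 46 12 ∷ free 41 4 ∷ free 4 2 ∷ []) ∷
    narrow 2 328527091538550767812762526665195569013114491091173582540672153555786 (free 15 48 ∷ free 0 2 ∷ free 38 3 ∷ free 26 2 ∷ level 28 [] 261654241044 25 3 ∷ []) ∷
    narrow 1 359928907465817541750138145962218563458747009974254472669394463949614 (free 4 8 ∷ free 37 2 ∷ free 18 2 ∷ []) ∷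
    narrow 1 434892630822305117183241751605744154415606833573109450582817965809414 (free 2 24 ∷ free 5 8 ∷ free 9 4 ∷ []) ∷
    narrow 1 83477956970348364116689553212268079246305911330963689626026482231749 (free 10 8 ∷ free 19 4 ∷ free 21 2 ∷ free 3 9 ∷ free 5 4 ∷ []) ∷
    narrow 1 164934117308352722011716202447619204639569860960259127280989458542872 (free 8 8 ∷ level 15 [] 187182829129 2 1 ∷ free 30 2 ∷ []) ∷
    narrow 1 49808535202389439024637738987102827352833718699296312494909559392318 (free 2 4 ∷ free 20 4 ∷ free 13 2 ∷ free 6 2 ∷ []) ∷
    narrow 1 503134755851651652565592944804139196722657313652872647241409612385637 (free 20 6 ∷ free 32 2 ∷ free 24 2 ∷ []) ∷
    narrow 1 462972085358987836577724009757888883547466124657162919932795970868416 (free 13 8 ∷ free 34 2 ∷ []) ∷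
    narrow 1 365512960940478867960263121784970363139757965607044561190002872891529 (free 19 20 ∷ free 30 12 ∷ free 14 8 ∷ free 4 18 ∷ free 13 4 ∷ free 26 2 ∷ level 22 [] 20923181052 14 1 ∷ level 8 [] 207565530913 2 1 ∷ []) ∷
    narrow 1 288240984591731591480928944062560814996770447830901342462985225360860 (free 12 8 ∷ free 5 2 ∷ level 16 [] 252056575209 2 1 ∷ []) ∷
    narrow 1 21592181831391422491515970600028674081838523228955723942254318555673 (free 10 16 ∷ free 5 2 ∷ free 29 2 ∷ []) ∷
    narrow 1 96491842636153989309106796782612192964392811445261890934220288497063 (free 11 16 ∷ free 22 16 ∷ free 36 2 ∷ free 13 2 ∷ level 40 (17 ∷ []) 263875254940 1 1 ∷ level 18 [] 8982710160 3 2 ∷ level 17 [] 272315569293 2 1 ∷ []) ∷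
    narrow 2 440387556048291808968008994525974638098014891609648006121602946624937 (level 0 [] 0 264917864955900 16 ∷ []) ∷
    narrow 2 503385547367590255432905560962758827101077671271909548931064415586292 (level 38 [] 0 280650330342351 12 ∷ []) ∷
    narrow 1 350391853939486427782385222087929582107846126681543582651083330803418 (free 20 6 ∷ free 4 4 ∷ free 1 4 ∷ []) ∷
    narrow 1 462809693106086309079897200159561632500510143809825566848630431439116 (free 0 16 ∷ free 13 2 ∷ free 2 2 ∷ []) ∷
    narrow 1 105335228502909738130788305345969550860500936439832178706740869568437 (free 0 8 ∷ free 10 4 ∷ free 30 2 ∷ []) ∷
    narrow 1 123614086116493734229909569011412869899238593018667541345108420248784 (free 0 8 ∷ free 29 2 ∷ free 12 8 ∷ free 20 2 ∷ []) ∷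
    narrow 1 216518673753854866363503307275408680515400060013632845173916348790012 (free 8 16 ∷ free 6 4 ∷ []) ∷
    narrow 1 461158837388458502999652767311478689269647323305141728521756806358740 (free 0 12 ∷ free 2 36 ∷ free 8 18 ∷ free 22 2 ∷ free 11 2 ∷ []) ∷
    narrow 1 216518639105018506501536242210719890940332380107020201876747742334578 (free 2 4 ∷ free 0 4 ∷ []) ∷
    narrow 1 501305002468889679171379421030455546360410428384564200176411675083150 (free 4 2 ∷ free 30 2 ∷ free 3 4 ∷ []) ∷
    narrow 1 84406360978066606910452037328241050074148401562536549931044800018783 (free 44 4 ∷ level 33 [] 0 1 1 ∷ []) ∷
    narrow 1 333366344150387744504752983017889607131402599000179583513210319259669 (free 2 2 ∷ free 39 2 ∷ []) ∷
    narrow 1 216518174662007274517769768787229932526329026581709882115519019530788 (free 2 8 ∷ level 8 [] 0 2 1 ∷ []) ∷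
    narrow 1 180324681665132695231145951718644569014128590760855263682051770838673 (free 22 8 ∷ free 11 4 ∷ free 15 4 ∷ []) ∷
    narrow 1 439357349504908191983544511629471379018463962555392793103399481034921 (free 2 8 ∷ free 8 6 ∷ free 18 2 ∷ free 1 4 ∷ []) ∷
    narrow 1 395105930614365874155170017522797663981823051892353353842731846727423 (free 6 24 ∷ free 11 2 ∷ level 26 [] 0 2 1 ∷ []) ∷
    narrow 1 199359874715988043142030919621975268232850908527913734022046165479001 (free 14 24 ∷ free 40 2 ∷ free 27 9 ∷ free 46 4 ∷ free 4 20 ∷ free 12 9 ∷ free 31 2 ∷ level 11 [] 234830686742 2 1 ∷ []) ∷
    narrow 1 422138538139377466640795572267444350886377267346034069939528536915607 (free 28 24 ∷ free 32 2 ∷ []) ∷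
    narrow 1 37127779889158127726238451545382484358692536392059649916557165765185 (free 44 8 ∷ free 18 2 ∷ free 26 8 ∷ free 29 2 ∷ []) ∷
    narrow 1 82493161114214229517829309054302904562620929199293704067875971026056 (free 44 16 ∷ free 4 4 ∷ []) ∷
    narrow 1 109501702430661312517152217006226002302169841394398196971791474776925 (free 6 8 ∷ free 11 2 ∷ free 2 18 ∷ free 14 2 ∷ level 22 [] 231464492578 2 1 ∷ []) ∷
    narrow 1 5381016399664269025425837192304299956227253670233794404740979107957 (free 18 4 ∷ free 35 4 ∷ []) ∷
    narrow 1 462972085358988551648611906146928791867678829963581867852747603244101 (free 4 12 ∷ free 14 6 ∷ free 20 2 ∷ free 13 2 ∷ []) ∷
    narrow 1 166391478564362014994004035822847810627101511158704296972912891949601 (free 14 16 ∷ free 22 2 ∷ free 0 9 ∷ free 26 2 ∷ level 5 [] 208130648017 2 1 ∷ []) ∷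
    narrow 1 164991124152481136372415694180030512825132635613236240958042823712936 (free 0 8 ∷ free 6 9 ∷ free 15 4 ∷ free 4 9 ∷ free 10 2 ∷ []) ∷
    narrow 1 86836050423491281118110629552494957639745044589703511206699706393340 (free 42 16 ∷ level 47 [] 0 1 1 ∷ free 35 2 ∷ []) ∷
    narrow 1 166655762927830329509475935182911865634609275178247999268730248694574 (free 4 8 ∷ free 17 2 ∷ []) ∷
    narrow 1 370610422125226871432250727730661210476034534449905178600077676378115 (free 30 8 ∷ free 26 4 ∷ []) ∷
    narrow 1 370610422125781503375036646095358212319061848081867534876203199236109 (free 4 8 ∷ free 6 8 ∷ free 31 2 ∷ []) ∷
    narrow 1 165881767218380727781729030273708972682874414109960992312973900761812 (free 12 4 ∷ free 6 2 ∷ []) ∷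
    narrow 1 366613292899088912481049215640915715253422488210438045711753204028698 (free 18 4 ∷ level 32 [] 0 2 1 ∷ []) ∷
    narrow 1 439881108102989999173793280475948595861874456228370969801449044701335 (free 4 12 ∷ free 33 2 ∷ free 11 4 ∷ []) ∷
    narrow 1 419232764178328928869783272104993159714580119841661205968401244468130 (free 6 6 ∷ free 5 4 ∷ free 18 2 ∷ []) ∷
    narrow 1 382462297783715232925547863214996288409008921037896943235758121780939 (free 44 2 ∷ free 4 2 ∷ []) ∷
    narrow 1 168600401150409816885520543073542644297677778688141169973235770955555 (free 42 8 ∷ free 47 2 ∷ []) ∷
    narrow 1 163985031233838121882963318474822912642880832912498362566240977452230 (free 4 2 ∷ level 26 [] 0 2 1 ∷ []) ∷
    narrow 1 37127779889280831675996364239411081000291931625974483294826761635200 (free 41 8 ∷ free 19 2 ∷ free 17 2 ∷ []) ∷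
    narrow 1 216518174485872158715450299770281231489497452789443941638804319427611 (free 12 8 ∷ free 0 2 ∷ free 16 2 ∷ []) ∷
    narrow 1 84008131397209666546977057652462789404111948050702144982437644198270 (free 35 12 ∷ free 13 2 ∷ free 15 4 ∷ free 5 9 ∷ free 32 2 ∷ []) ∷
    narrow 1 56115117078971438902745531949082975978772473244874661598213834389993 (free 23 48 ∷ free 35 2 ∷ level 2 (1 ∷ 4 ∷ []) 129652510 42 3 ∷ level 10 [] 7088856287 16776942 3 ∷ free 5 2 ∷ level 24 [] 189132172232 62 1 ∷ level 43 [] 0 1 1 ∷ []) ∷
    narrow 1 58170367182613377814021242119832664278280136652838698906315250341128 (free 10 4 ∷ free 13 4 ∷ free 3 2 ∷ []) ∷
    narrow 1 397452207534343285715782928122596316489062455846944388520722230980634 (free 4 4 ∷ free 11 6 ∷ free 32 4 ∷ free 0 18 ∷ level 26 [] 163453451716 2 1 ∷ free 3 2 ∷ level 7 [] 217828116448 2 1 ∷ []) ∷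
    narrow 1 36916135069949867954734127186035465397552533861912542427022402174621 (free 4 16 ∷ free 39 2 ∷ []) ∷
    narrow 1 4607518529156897597028299326891900214380945673940917278336679970028 (free 32 4 ∷ free 2 2 ∷ []) ∷
    narrow 1 35251883256837118609188925633104220027488889862354500833242379685772 (free 1 8 ∷ free 9 2 ∷ []) ∷
    narrow 1 82472557933153135578293955770771670428200881005795329524900672982215 (free 24 36 ∷ free 35 2 ∷ level 45 [] 56789458849 2 1 ∷ level 38 [] 0 1 1 ∷ []) ∷
    narrow 1 90150613992003394101023235778623716736074363651874498252443460207203 (free 0 24 ∷ free 14 8 ∷ level 8 [] 1033861508 2 1 ∷ free 6 2 ∷ []) ∷
    narrow 1 23309813256175598233493022153753391864144429622589341248428543736703 (free 34 24 ∷ free 13 6 ∷ free 47 2 ∷ []) ∷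
    narrow 1 370610422125226871432250727734503645675852679395707885143417404771643 (free 2 16 ∷ free 33 2 ∷ free 27 2 ∷ []) ∷
    narrow 1 269543365236607045776406927423293732297293500503210900953159143762785 (free 18 8 ∷ free 38 2 ∷ []) ∷
    narrow 1 422737538498699068792751260493298297636419692548582555813404863177876 (free 16 4 ∷ level 8 [] 0 2 1 ∷ []) ∷
    narrow 1 105514288797221419593112336658351462042036362627349747261354630158235 (free 41 12 ∷ free 31 2 ∷ free 19 4 ∷ free 38 2 ∷ []) ∷
    narrow 1 438017922391706655045592215825554463075171980867561018079190817889034 (free 6 6 ∷ free 0 24 ∷ free 25 2 ∷ free 3 9 ∷ level 5 [] 187329782252 58 2 ∷ level 12 [] 116124214324 2 1 ∷ []) ∷
    narrow 1 219383213417701464933334708943185398893347889916354765556800607035936 (free 28 4 ∷ level 12 [] 0 2 1 ∷ []) ∷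
    narrow 1 400744696726365495111428646467378883458492231899340355387359613901444 (free 20 48 ∷ free 44 6 ∷ free 19 4 ∷ free 40 2 ∷ []) ∷
    narrow 1 109303568091036205318606986765601286625676926507152791821156617861940 (free 0 48 ∷ free 12 24 ∷ free 14 22 ∷ free 2 22 ∷ free 4 20 ∷ free 16 20 ∷ free 18 9 ∷ free 36 2 ∷ free 6 9 ∷ free 9 2 ∷ []) ∷
    narrow 2 35252019725606988695779240244696138756830293053825964565460980634062 (free 0 12 ∷ free 23 2 ∷ level 16 [] 86038192209 62 1 ∷ []) ∷
    narrow 1 54651097554433460205576110366853170825305531357854165151056307176189 (free 5 8 ∷ free 10 8 ∷ free 31 4 ∷ []) ∷
    narrow 1 191256000477417741110644790906951988958898979292257321396239511617250 (free 17 12 ∷ free 13 2 ∷ free 41 4 ∷ []) ∷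
    narrow 1 287762914015701511662374633193967065671791179044608736987073139214794 (free 20 32 ∷ free 24 2 ∷ free 39 4 ∷ free 15 2 ∷ []) ∷
    narrow 1 168291287692100366525824182882425354209326708603943833678716923899360 (free 0 24 ∷ level 8 [] 0 2 1 ∷ free 20 2 ∷ []) ∷
    narrow 1 84097167602976548598939895418118510380126619501936801168518409876997 (free 35 24 ∷ free 39 2 ∷ free 0 9 ∷ level 6 [] 29145017414 2 1 ∷ free 13 2 ∷ []) ∷
    narrow 1 157135480982261654724724011046391779836328004424458701957757193789586 (free 14 24 ∷ free 34 2 ∷ []) ∷
    narrow 1 435820895487679647581271023698536093929132249588992295461653716489319 (free 0 48 ∷ free 6 16 ∷ free 30 4 ∷ free 14 8 ∷ free 25 2 ∷ []) ∷
    narrow 1 216518394584549622858835669820111070015913925935527119411633849969794 (free 2 16 ∷ level 6 [] 0 30 2 ∷ free 43 2 ∷ free 1 2 ∷ []) ∷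
    narrow 1 194007785917821955406085078628938578996794446692542664018892576698571 (free 0 48 ∷ free 8 12 ∷ free 10 3 ∷ free 4 2 ∷ []) ∷
    narrow 2 173972181486912183039050714494808034363520841194733029582113245619573 (level 20 [] 0 828673671183 32 ∷ free 12 2 ∷ level 14 (43 ∷ []) 43478851554 254 1 ∷ level 1 [] 191547177422 13 1 ∷ level 6 [] 111347829312 14 1 ∷ []) ∷
    narrow 2 483308395115297233462033023468096070104979604041711022794394795734031 (level 25 [] 0 69269245381824 32 ∷ level 33 [] 0 1 1 ∷ free 23 2 ∷ level 19 (0 ∷ []) 9609024148 247 1 ∷ level 26 [] 16360076895 2 1 ∷ level 1 (28 ∷ []) 46768437290 2 1 ∷ level 9 [] 273879316906 2 1 ∷ []) ∷
    narrow 1 3744794065233307147594059844837292058330653204351928029812593265231 (level 0 [] 0 53862328369212 26 ∷ free 7 12 ∷ free 11 9 ∷ free 14 4 ∷ free 2 22 ∷ free 4 20 ∷ level 16 [] 200523860497 153178 9 ∷ free 20 2 ∷ []) ∷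
    narrow 1 239029057047797877825090082336603723354704048589827420035785269981435 (free 0 48 ∷ free 12 5 ∷ free 16 4 ∷ free 2 18 ∷ free 33 2 ∷ []) ∷
    narrow 1 116732980265258179840380778553837047324323506463105193993561350665959 (free 0 48 ∷ free 6 9 ∷ free 10 4 ∷ free 3 12 ∷ free 5 9 ∷ free 17 2 ∷ free 35 2 ∷ []) ∷ []

  representatives₃ : Vec Rep 170
  representatives₃ =
    narrow 1 3481003526106948730506844788180374297011027332082034782009481526672 (free 20 8 ∷ free 16 4 ∷ free 22 6 ∷ free 0 36 ∷ free 11 4 ∷ free 2 9 ∷ free 9 2 ∷ []) ∷
    narrow 1 166391478062995441368835402207697960599445536741770537094291967049464 (free 4 36 ∷ free 6 4 ∷ free 9 2 ∷ free 0 6 ∷ free 20 6 ∷ free 14 9 ∷ free 18 4 ∷ []) ∷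
    narrow 1 92858562956127549799918068635907953526596237863644461913509552925149 (free 1 12 ∷ free 23 36 ∷ free 46 2 ∷ free 29 6 ∷ level 15 (3 ∷ 11 ∷ []) 115068885286 232 4 ∷ level 40 (2 ∷ []) 258161660514 39 2 ∷ level 12 [] 209465743154 1 1 ∷ level 4 (6 ∷ []) 198884890201 87446 9 ∷ level 33 [] 245905061221 219 2 ∷ level 38 [] 177849547029 31 1 ∷ level 36 [] 0 1 1 ∷ []) ∷
    narrow 1 131012236640698883859492961286229783180825603785689740754179933069249 (free 8 8 ∷ free 11 4 ∷ free 6 2 ∷ free 2 6 ∷ free 12 6 ∷ free 36 2 ∷ []) ∷
    narrow 1 166391478062446093174849826205583829783729517860213328216454680270050 (free 0 18 ∷ free 4 12 ∷ free 18 6 ∷ free 6 4 ∷ free 8 20 ∷ free 20 6 ∷ free 13 9 ∷ free 17 4 ∷ level 37 [] 56937158597 2 1 ∷ []) ∷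
    narrow 1 84007965567517321404734313943040845560046443875208363238846168351423 (free 0 18 ∷ free 2 24 ∷ free 6 12 ∷ free 23 2 ∷ free 20 6 ∷ free 8 9 ∷ free 40 2 ∷ []) ∷
    narrow 1 152854430691332844487558497705532885804369400582957132718280140072956 (free 25 12 ∷ free 18 18 ∷ free 11 6 ∷ free 37 4 ∷ free 15 4 ∷ []) ∷
    narrow 1 451137531890923627297173934664400043616635328291231814880771636771377 (free 20 4 ∷ free 1 4 ∷ free 6 18 ∷ free 2 18 ∷ free 33 2 ∷ free 16 6 ∷ free 10 12 ∷ free 12 6 ∷ free 22 6 ∷ level 45 [] 0 2 1 ∷ []) ∷
    narrow 1 451137542612646487863141581586578356254158792943851847211295445210570 (free 2 24 ∷ free 8 12 ∷ free 14 8 ∷ free 16 6 ∷ free 6 2 ∷ free 22 6 ∷ free 4 9 ∷ free 12 2 ∷ []) ∷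
    narrow 1 451137531890923627297173934667306091489163550362264371556799936897034 (free 6 24 ∷ free 15 2 ∷ free 16 12 ∷ free 8 6 ∷ free 22 6 ∷ free 11 2 ∷ free 2 8 ∷ free 1 4 ∷ []) ∷
    narrow 1 110498710237423652903846014784970166016733991357155533965067969790882 (free 6 24 ∷ free 15 2 ∷ free 0 6 ∷ level 35 [] 196965865591 2 1 ∷ []) ∷
    narrow 1 166391478062446732257921487172998934712670782018723910188534327223522 (free 6 2 ∷ free 16 4 ∷ free 39 6 ∷ free 46 4 ∷ free 35 12 ∷ free 1 6 ∷ free 12 2 ∷ []) ∷
    narrow 1 451137526651364180104406879267381406316575627477425984370950823008115 (free 46 24 ∷ free 23 2 ∷ free 36 12 ∷ free 41 2 ∷ free 16 6 ∷ free 24 6 ∷ free 26 6 ∷ free 7 2 ∷ []) ∷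
    narrow 1 16709155696298586182109570386541786839159205335541747532088544565779 (free 2 24 ∷ free 0 6 ∷ free 32 2 ∷ free 16 6 ∷ free 20 6 ∷ free 22 6 ∷ free 6 18 ∷ free 10 12 ∷ free 12 6 ∷ level 9 [] 73040947061 2 1 ∷ []) ∷
    narrow 1 281960932130043318199669547153050546509767730569047137708631631173377 (free 4 4 ∷ free 22 6 ∷ free 8 6 ∷ free 17 4 ∷ free 19 2 ∷ []) ∷
    narrow 1 87024979656370480939546160368596809014398695642984371793226192751692 (free 8 8 ∷ free 2 12 ∷ free 10 6 ∷ free 7 7 ∷ free 20 6 ∷ free 23 4 ∷ []) ∷
    narrow 1 166391478062446733126277208800736062677282841920430094688602578045626 (free 6 16 ∷ free 0 8 ∷ free 12 12 ∷ free 2 6 ∷ free 4 12 ∷ free 20 6 ∷ free 32 2 ∷ free 18 6 ∷ free 14 2 ∷ []) ∷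
    narrow 1 335788238653579625158739503653858665211576050396169878236192356775065 (free 10 6 ∷ free 0 8 ∷ free 8 4 ∷ free 6 2 ∷ []) ∷
    narrow 1 281960451108236453225163945013065824528522677213096534907318541818647 (free 0 12 ∷ free 8 12 ∷ free 2 24 ∷ free 4 12 ∷ free 18 6 ∷ free 16 2 ∷ free 20 6 ∷ free 22 6 ∷ level 45 [] 0 2 1 ∷ []) ∷
    narrow 1 225569126405433528608689598274551232012798861724624784514443391448443 (free 14 10 ∷ free 22 6 ∷ level 45 [] 48127759962 2 1 ∷ []) ∷
    narrow 1 3481003526106948316321314421188217665848357595634917177637341961980 (free 9 40 ∷ free 23 8 ∷ free 32 20 ∷ free 21 6 ∷ free 14 18 ∷ free 10 18 ∷ free 26 4 ∷ level 44 (6 ∷ []) 118752094293 1 1 ∷ level 46 [] 134623793111 3 2 ∷ level 2 [] 272881655337 2 1 ∷ []) ∷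
    narrow 1 5381313857709327161352250419505234650114282321427055645247783189716 (free 14 8 ∷ free 0 6 ∷ free 3 2 ∷ []) ∷
    narrow 1 303311191528235934004978431614196792484366155124891148440470790769394 (free 14 16 ∷ free 41 2 ∷ free 16 2 ∷ free 28 18 ∷ free 5 6 ∷ level 12 (0 ∷ []) 137317273795 2 1 ∷ level 7 [] 93635125596 243 2 ∷ level 30 [] 45600128573 47 1 ∷ level 32 [] 0 1 1 ∷ []) ∷
    narrow 1 166391467761529215045710510159490757879580049693547066476672734484328 (free 20 6 ∷ free 2 8 ∷ free 0 2 ∷ free 31 4 ∷ []) ∷
    narrow 1 435820335672735387910840015354872751404627654467758985106199237713846 (free 18 8 ∷ free 20 2 ∷ free 5 4 ∷ free 1 2 ∷ free 8 12 ∷ free 16 6 ∷ level 11 [] 73259087841 2 1 ∷ []) ∷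
    narrow 1 84007965566762531380574870909584505609547106569777899542452872477360 (free 4 8 ∷ free 32 12 ∷ free 34 8 ∷ free 0 12 ∷ free 20 6 ∷ free 7 2 ∷ []) ∷
    narrow 1 77992287066601605441131778793590863885156890409366665478487855801594 (free 6 16 ∷ free 8 6 ∷ level 19 [] 0 2 1 ∷ []) ∷
    narrow 1 5569752254064200565383305576275559304892611840825327960300164933687 (free 10 18 ∷ free 0 26 ∷ free 15 2 ∷ free 19 2 ∷ free 16 6 ∷ free 3 12 ∷ free 7 9 ∷ free 22 6 ∷ free 12 4 ∷ []) ∷
    narrow 1 163838902843590257013884930598308048642485879691817597557511445306394 (free 0 8 ∷ free 8 8 ∷ free 19 4 ∷ free 4 9 ∷ free 2 6 ∷ free 14 6 ∷ free 6 4 ∷ []) ∷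
    narrow 1 87024979656370480939613068082841876490350321588291351663931311856929 (free 8 18 ∷ free 13 2 ∷ free 10 12 ∷ free 0 14 ∷ free 14 6 ∷ free 4 12 ∷ free 18 8 ∷ level 36 [] 128004152990 2 1 ∷ []) ∷
    narrow 1 275805281430625707569695153545044586829697051857641329065523689018300 (free 10 16 ∷ free 0 4 ∷ free 6 6 ∷ free 8 4 ∷ free 19 2 ∷ []) ∷
    narrow 1 241856275513489773375266395023510300741449670395838557960045146440390 (free 0 18 ∷ free 12 12 ∷ free 30 4 ∷ free 8 6 ∷ free 21 2 ∷ []) ∷
    narrow 1 75189480159252943123645339074722403212085293500993821497039338465610 (free 22 6 ∷ free 0 6 ∷ free 8 4 ∷ free 7 4 ∷ free 17 9 ∷ free 19 2 ∷ []) ∷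
    narrow 1 206771012919320190199272339627431654205419485656351353171862936319837 (free 6 8 ∷ free 15 4 ∷ free 22 6 ∷ free 10 2 ∷ []) ∷
    narrow 1 281960932130043316843711290111918295585108696085095249305264829242412 (free 45 6 ∷ free 11 4 ∷ free 4 4 ∷ free 3 2 ∷ []) ∷
    narrow 1 281960937126776119223830287930088347703112124599612230795046595978813 (free 2 24 ∷ free 16 12 ∷ free 28 4 ∷ free 22 6 ∷ free 15 2 ∷ free 5 2 ∷ free 8 6 ∷ level 10 [] 0 2 1 ∷ []) ∷
    narrow 1 163838902907878908267251831019823804061106865878201012751475113040555 (free 0 6 ∷ free 17 2 ∷ free 18 6 ∷ free 13 2 ∷ []) ∷
    narrow 1 39683480818910698919955690780531357225859821684724189737212011706146 (free 0 8 ∷ free 22 6 ∷ free 4 2 ∷ []) ∷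
    narrow 1 83498937782712677772097190501723111012707125343673072999951725569946 (free 2 12 ∷ free 10 6 ∷ level 28 [] 189679828621 2 1 ∷ []) ∷
    narrow 1 243448907294776305120916047654348739149233768648288922179678940232758 (free 32 6 ∷ free 31 2 ∷ free 29 18 ∷ free 42 2 ∷ []) ∷
    narrow 1 3481003527128803033049495542967523255391394924920966930791454232187 (free 20 8 ∷ free 8 12 ∷ free 22 6 ∷ free 11 2 ∷ free 12 6 ∷ free 2 7 ∷ free 4 6 ∷ free 19 4 ∷ []) ∷
    narrow 1 3481003527394071266483708300623331632040432301933321533275677475983 (free 21 8 ∷ free 37 6 ∷ free 4 32 ∷ free 35 4 ∷ free 31 2 ∷ free 45 2 ∷ []) ∷
    narrow 1 2552747044358833337569796515410777160653867500957538901879580035085 (free 43 12 ∷ free 35 6 ∷ free 4 6 ∷ free 21 8 ∷ free 10 4 ∷ []) ∷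
    narrow 1 166391478564362014973904312514299368716679313859872839472745576434795 (free 34 6 ∷ free 15 4 ∷ free 8 6 ∷ free 1 9 ∷ free 4 2 ∷ level 2 [] 74972041603 2 1 ∷ []) ∷
    narrow 1 5569763721675444179736577590730621684488641758262158250237432151297 (free 33 4 ∷ free 28 2 ∷ free 5 12 ∷ free 23 6 ∷ free 10 20 ∷ free 21 18 ∷ level 9 (40 ∷ []) 52005565845 6 2 ∷ level 17 [] 41636570184 1 1 ∷ level 2 [] 4137584394 3267 6 ∷ free 26 6 ∷ level 46 [] 0 1 1 ∷ []) ∷
    narrow 1 5569902469350688298151824416195388237572777709511993151683213987791 (free 22 6 ∷ free 0 36 ∷ free 3 2 ∷ free 13 2 ∷ free 11 9 ∷ free 16 4 ∷ []) ∷
    narrow 1 84007985152101523611269355217402137955950336177812159374355498510477 (free 0 12 ∷ free 20 6 ∷ free 18 6 ∷ free 31 2 ∷ free 7 2 ∷ free 8 18 ∷ free 14 4 ∷ []) ∷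
    narrow 1 281961285591409191140206228360205281159550504009707208274906638965670 (free 0 48 ∷ free 2 6 ∷ free 4 40 ∷ free 6 6 ∷ free 8 32 ∷ free 12 24 ∷ free 16 16 ∷ free 20 8 ∷ free 22 6 ∷ free 18 6 ∷ free 14 6 ∷ level 37 [] 0 2 1 ∷ free 10 6 ∷ level 33 [] 0 2 1 ∷ []) ∷
    narrow 1 2553568013905378418243608918333481268618371723674506930175067631227 (free 4 6 ∷ free 0 8 ∷ free 22 6 ∷ free 20 2 ∷ free 17 2 ∷ []) ∷
    narrow 1 51672427169067872319512426108282517464851784470743061989059208830786 (free 0 8 ∷ free 14 6 ∷ free 8 4 ∷ []) ∷
    narrow 1 2552876951564920016340829144326940864591042296087807194220224174986 (free 22 6 ∷ free 0 12 ∷ free 24 2 ∷ free 5 2 ∷ []) ∷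
    narrow 1 75189450175822989048001722895562414685682246437500522203933861047275 (free 4 24 ∷ free 0 6 ∷ free 9 4 ∷ free 22 6 ∷ free 16 6 ∷ free 20 6 ∷ level 31 [] 0 2 1 ∷ []) ∷
    narrow 1 504022797966520977121453558675934596617734699515359226797560680084004 (free 14 8 ∷ free 0 6 ∷ free 32 2 ∷ []) ∷
    narrow 1 110498046895368247457938914836454306950455247227255203217961067038058 (free 2 8 ∷ free 7 2 ∷ free 1 6 ∷ level 42 [] 30868722561 1 1 ∷ []) ∷
    narrow 1 166391478063458737014122555771054514264617224012476023947636702844051 (free 14 8 ∷ free 30 4 ∷ free 20 6 ∷ free 0 6 ∷ free 6 6 ∷ free 8 4 ∷ free 4 6 ∷ free 36 2 ∷ []) ∷
    narrow 1 373163325659103227821001529488507914550274140399055556724265746562717 (free 8 6 ∷ free 0 10 ∷ free 14 8 ∷ free 20 3 ∷ free 43 2 ∷ []) ∷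
    narrow 1 5569902470091853671341471112975169671616628494092947525963296508741 (free 12 12 ∷ free 0 8 ∷ free 8 2 ∷ free 22 6 ∷ free 11 9 ∷ free 18 2 ∷ []) ∷
    narrow 1 3480993435060910940486180881683092886094437989379319092191125214332 (free 20 12 ∷ free 16 6 ∷ free 22 6 ∷ free 34 2 ∷ free 2 2 ∷ free 26 2 ∷ free 0 2 ∷ []) ∷
    narrow 1 2553460552689445262222956056110915185876092557474878102386679448351 (free 27 4 ∷ free 15 6 ∷ free 38 6 ∷ free 42 3 ∷ free 20 2 ∷ []) ∷
    narrow 1 216518638603920850075442111523807501731807757606527468510879759234759 (free 4 6 ∷ free 21 4 ∷ free 6 6 ∷ free 0 6 ∷ free 17 2 ∷ []) ∷
    narrow 1 2553595969953311597676715031295706504390830015456970674566915386423 (free 2 12 ∷ free 28 2 ∷ free 4 6 ∷ free 22 6 ∷ free 32 2 ∷ []) ∷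
    narrow 1 206771006562239812920414134477513993135835409849124051970111832815389 (free 0 30 ∷ free 6 24 ∷ free 9 2 ∷ free 10 18 ∷ free 18 8 ∷ free 16 12 ∷ free 20 6 ∷ free 22 6 ∷ level 43 [] 0 2 1 ∷ []) ∷
    narrow 1 206770987091360922095993882947282989752883545672492402411995419233766 (free 20 12 ∷ free 29 2 ∷ free 22 6 ∷ free 6 4 ∷ free 11 9 ∷ free 13 2 ∷ level 17 [] 214180847649 2 1 ∷ []) ∷
    narrow 1 5569589051961953972271283461430986247080821996340067929545777631575 (free 12 12 ∷ free 14 12 ∷ free 4 18 ∷ free 34 2 ∷ free 22 6 ∷ free 0 6 ∷ free 6 6 ∷ free 20 6 ∷ level 29 [] 0 2 1 ∷ []) ∷
    narrow 1 166391467761440392851501443337304915171581809239149080211327870793075 (free 40 4 ∷ free 0 8 ∷ free 20 6 ∷ free 10 2 ∷ []) ∷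
    narrow 1 2553607889567239201595995700897659713391130415519689990460468214444 (free 14 2 ∷ free 6 12 ∷ free 22 6 ∷ free 10 2 ∷ free 5 2 ∷ []) ∷
    narrow 1 3744703171717017208273673242094962278635642758849291921534151350119 (free 2 20 ∷ free 8 12 ∷ free 6 8 ∷ free 10 6 ∷ free 1 4 ∷ free 19 2 ∷ free 4 9 ∷ free 23 2 ∷ []) ∷
    narrow 1 3481305946500153783613209876068577193494789777165660574327670831785 (free 0 8 ∷ free 22 6 ∷ free 14 3 ∷ free 28 2 ∷ []) ∷
    narrow 1 74519167846677666732311856056338457993889764852252817285982899209666 (free 1 24 ∷ free 10 2 ∷ free 40 24 ∷ free 13 18 ∷ free 47 12 ∷ level 9 (17 ∷ []) 188286896549 2 1 ∷ free 2 22 ∷ free 22 20 ∷ level 42 [] 243458580699 1 1 ∷ free 28 6 ∷ level 27 [] 180134160867 1 1 ∷ free 31 9 ∷ free 39 2 ∷ []) ∷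
    narrow 1 163838902907878906724170759743644075797737553054432784531675344884356 (free 14 8 ∷ free 0 12 ∷ free 2 2 ∷ free 16 3 ∷ free 18 6 ∷ free 13 2 ∷ []) ∷
    narrow 1 42975352492434926575041288766072687071058859393282089032813904278 (free 20 8 ∷ free 8 6 ∷ free 22 6 ∷ free 0 8 ∷ free 34 2 ∷ free 2 6 ∷ free 6 4 ∷ []) ∷
    narrow 1 216518080276680560862885724740627401697362912342417666090100676609827 (free 0 4 ∷ free 16 6 ∷ free 15 2 ∷ free 8 4 ∷ []) ∷
    narrow 1 84936394067376036838741934167365159288261250210124223691041676271948 (free 0 18 ∷ free 30 2 ∷ free 3 3 ∷ free 12 6 ∷ free 20 6 ∷ free 17 2 ∷ []) ∷
    narrow 1 281961332703714340605461395633686610061410205311694296666970678028483 (free 4 18 ∷ free 18 6 ∷ free 14 4 ∷ free 8 6 ∷ free 22 6 ∷ level 45 [] 0 2 1 ∷ []) ∷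
    narrow 1 451137285670808110248059369039032094525548966160479934650081266527058 (free 4 4 ∷ free 22 6 ∷ free 19 2 ∷ []) ∷
    narrow 1 3481003527128801071007274124921113888240019450568277903034138600078 (free 22 8 ∷ free 36 6 ∷ free 27 40 ∷ free 17 4 ∷ free 30 6 ∷ free 41 2 ∷ []) ∷
    narrow 1 216518174663083624242287331487417316198646410400621026504029841235744 (free 8 6 ∷ free 4 8 ∷ level 11 [] 0 2 1 ∷ []) ∷
    narrow 1 218417725393329425204225105117102504304055797569709811921412288052993 (free 14 6 ∷ free 8 8 ∷ free 18 2 ∷ free 4 9 ∷ free 12 4 ∷ []) ∷
    narrow 1 451137526651364180104139646723558834655119772454312492905560394998231 (free 12 8 ∷ free 8 12 ∷ free 14 6 ∷ free 22 6 ∷ free 4 8 ∷ free 0 8 ∷ free 11 3 ∷ free 17 2 ∷ []) ∷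
    narrow 1 317945877061688941788954367142424068884863742916642546486304211061938 (free 33 6 ∷ free 42 24 ∷ free 3 2 ∷ free 13 6 ∷ free 21 2 ∷ []) ∷
    narrow 1 166392004972367688467805292656142444941240422986212596578147182414291 (free 29 12 ∷ free 12 6 ∷ free 36 2 ∷ []) ∷
    narrow 1 166391670199326727030101004077108221210591163404854215800153563511085 (free 0 16 ∷ free 6 6 ∷ free 23 2 ∷ []) ∷
    narrow 1 101193863914341057607080479386875611588719130708410705804541889432389 (free 18 6 ∷ free 2 8 ∷ free 5 4 ∷ []) ∷
    narrow 1 5569991023433100995325877077662915399369995030900218237254534762951 (free 6 8 ∷ free 22 6 ∷ free 0 40 ∷ free 10 16 ∷ free 9 2 ∷ free 16 2 ∷ free 3 4 ∷ []) ∷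
    narrow 1 451137531890981418669975398754664288183676861584566067945272517577097 (free 0 8 ∷ free 2 24 ∷ free 14 18 ∷ free 41 2 ∷ free 18 6 ∷ free 6 16 ∷ free 22 6 ∷ free 10 8 ∷ free 8 6 ∷ free 12 6 ∷ level 31 [] 0 2 1 ∷ []) ∷
    narrow 1 82529864693120632194139302914849382821253538150752747253886617189044 (free 12 8 ∷ free 4 8 ∷ free 3 4 ∷ free 0 6 ∷ free 17 2 ∷ []) ∷
    narrow 1 166666516125739317613937620446590941716763755542301652376501658493119 (free 6 12 ∷ free 20 4 ∷ free 8 6 ∷ free 5 2 ∷ []) ∷
    narrow 1 2553621231268036043146506561963678783801221219919541639111228070199 (free 42 12 ∷ free 12 4 ∷ free 22 6 ∷ free 37 6 ∷ free 0 9 ∷ free 41 6 ∷ free 30 2 ∷ []) ∷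
    narrow 1 3481305946500153783610262570375176633616837405594326431540399326665 (free 6 8 ∷ free 22 6 ∷ free 8 6 ∷ free 11 2 ∷ []) ∷
    narrow 1 227201699231806627858501056763383780226214285859951345407491736748495 (free 29 8 ∷ free 25 6 ∷ free 6 2 ∷ []) ∷
    narrow 1 163838749634902579388551271962791425819169150738205386816444467253799 (free 18 6 ∷ free 6 4 ∷ free 11 4 ∷ []) ∷
    narrow 1 206771006562216534102209101118239276618179094130582191798762631606856 (free 38 6 ∷ free 43 12 ∷ free 0 6 ∷ free 25 6 ∷ free 7 2 ∷ free 4 2 ∷ free 34 2 ∷ []) ∷
    narrow 1 435820493068787744391815090331390281156533040379256689520498242760677 (free 27 16 ∷ free 10 6 ∷ free 12 8 ∷ free 29 6 ∷ free 32 32 ∷ level 23 [] 0 214908108 14 ∷ free 6 4 ∷ free 17 6 ∷ free 46 4 ∷ []) ∷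
    narrow 1 166391478062995440610576449475294449770350691594104075621176523774568 (free 0 18 ∷ free 20 6 ∷ free 3 8 ∷ free 6 2 ∷ free 10 8 ∷ free 36 2 ∷ level 26 [] 257193866882 2 1 ∷ []) ∷
    narrow 1 313075284056483964698992585337240184352064157394219286659554879818347 (free 20 8 ∷ free 0 6 ∷ free 10 2 ∷ free 19 4 ∷ []) ∷
    narrow 1 3008272464037281705238835989963139952152134809483844799210627867812 (free 6 18 ∷ free 23 4 ∷ free 4 6 ∷ free 0 2 ∷ level 16 [] 1409388158 2 1 ∷ free 3 9 ∷ free 40 2 ∷ level 24 [] 46159044661 2 1 ∷ []) ∷
    narrow 1 166391473938328362000424019137625001831969865345286958872949048910697 (free 4 4 ∷ free 34 3 ∷ free 14 2 ∷ free 0 6 ∷ free 6 6 ∷ free 9 2 ∷ free 18 6 ∷ free 12 2 ∷ []) ∷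
    narrow 1 2982491216471709443436158007363626847744100828916876071567785399092 (free 10 4 ∷ free 0 12 ∷ free 20 6 ∷ free 9 2 ∷ free 5 2 ∷ []) ∷
    narrow 1 462972085358717306939375342210116873957247843892091399080728905772639 (free 8 4 ∷ free 0 6 ∷ free 14 2 ∷ []) ∷
    narrow 1 434362634498224455435858815346799444000456069099310281040028074364516 (free 0 16 ∷ free 16 6 ∷ free 9 2 ∷ free 41 2 ∷ free 10 6 ∷ free 13 2 ∷ []) ∷
    narrow 1 83477945517208389125887583627922551627890281110988525241590641322741 (free 2 12 ∷ free 8 6 ∷ free 12 2 ∷ free 10 8 ∷ free 1 4 ∷ free 5 4 ∷ free 6 2 ∷ []) ∷
    narrow 1 281960451108236077640773226780934848923110368906561227338465774530260 (free 4 8 ∷ free 20 6 ∷ free 8 12 ∷ free 36 2 ∷ free 22 6 ∷ level 44 [] 45328494972 2 1 ∷ free 28 3 ∷ free 6 2 ∷ []) ∷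
    narrow 1 35251260306235950914746202636751343243401730486213501210364500145487 (free 2 6 ∷ free 0 16 ∷ free 11 4 ∷ []) ∷
    narrow 1 434362418378791298079501754335883695643560634188911760286176155594417 (free 15 16 ∷ free 6 2 ∷ free 22 6 ∷ free 25 2 ∷ []) ∷
    narrow 1 303311068853166792702284221476036848287312995303016788477619820791677 (free 2 4 ∷ free 4 12 ∷ free 1 4 ∷ free 8 6 ∷ free 18 6 ∷ free 13 9 ∷ free 21 4 ∷ []) ∷
    narrow 1 84008393053991760466974293892153461606300243698463224440257471269367 (free 14 12 ∷ free 18 6 ∷ free 4 8 ∷ free 20 2 ∷ free 0 6 ∷ level 2 [] 0 2 1 ∷ []) ∷
    narrow 1 164933963491366555942828670126826439181921101442732048171481987773708 (free 11 16 ∷ free 32 6 ∷ free 8 2 ∷ free 0 4 ∷ level 22 [] 5801761259 1 1 ∷ []) ∷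
    narrow 1 348675877214876456056061658834924138190240486287109602105150272772925 (free 28 2 ∷ free 2 6 ∷ free 8 2 ∷ []) ∷
    narrow 1 241581375875885927360160004361546577265428655620385068764104717321726 (free 42 6 ∷ free 26 8 ∷ free 29 2 ∷ free 7 2 ∷ free 23 6 ∷ free 41 2 ∷ []) ∷
    narrow 1 3745078754015462381442060234932343898152960732511924790072050996483 (free 5 20 ∷ free 10 4 ∷ free 43 6 ∷ level 9 [] 0 2 1 ∷ free 39 18 ∷ level 35 (17 ∷ []) 187755388130 3 2 ∷ level 16 [] 102005952424 2 1 ∷ free 15 9 ∷ level 24 [] 208776225110 10 2 ∷ []) ∷
    narrow 1 164964690316433952456165591664033828294235604597936155102414556337421 (free 0 12 ∷ free 20 6 ∷ free 6 18 ∷ free 8 8 ∷ level 4 [] 799293207 2 1 ∷ free 16 6 ∷ free 10 4 ∷ []) ∷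
    narrow 1 281961285591409191140206228360205281149037468599979934752590398525433 (free 39 24 ∷ free 36 6 ∷ free 30 24 ∷ free 41 16 ∷ free 43 6 ∷ free 35 22 ∷ free 21 8 ∷ free 45 6 ∷ free 9 20 ∷ free 11 9 ∷ free 24 2 ∷ []) ∷
    narrow 1 167517425536680873921104790248947813198780297211860515558020199691375 (free 16 6 ∷ free 6 8 ∷ free 8 2 ∷ []) ∷
    narrow 1 2553440370470422136426141727143780601712222438666014849923545284251 (free 46 32 ∷ free 40 12 ∷ free 15 2 ∷ level 21 (4 ∷ []) 52419914514 2 1 ∷ level 27 [] 198835020315 1 1 ∷ free 39 6 ∷ level 35 [] 259984645269 1 1 ∷ []) ∷
    narrow 1 168290981146717464955286294008948329502929859897161944006832043794206 (free 0 6 ∷ free 40 4 ∷ free 20 2 ∷ []) ∷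
    narrow 1 419232764177227022060159132107475623137255714388175817614273837207298 (free 6 18 ∷ free 4 6 ∷ free 10 4 ∷ free 16 2 ∷ []) ∷
    narrow 1 451136715554073966114629455745645794040359126017514889025609923339277 (free 6 6 ∷ free 32 4 ∷ free 2 12 ∷ free 16 6 ∷ free 22 6 ∷ free 8 6 ∷ level 13 [] 0 2 1 ∷ []) ∷
    narrow 1 2971029534357484688488702076212057584735556959306710213176555450151 (free 0 12 ∷ free 4 12 ∷ free 22 2 ∷ free 18 6 ∷ free 27 2 ∷ []) ∷
    narrow 1 3481629511094010846946720688640476689274730821758900052076862110581 (free 22 6 ∷ free 40 2 ∷ free 1 2 ∷ []) ∷
    narrow 1 438017891808362122136335030419997855558897321225897631265260524545114 (free 8 4 ∷ free 43 18 ∷ free 37 4 ∷ free 41 6 ∷ free 22 20 ∷ free 10 9 ∷ free 12 2 ∷ level 33 [] 182612396943 2 1 ∷ []) ∷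
    narrow 1 5569752253665697923686686375596908480659002810902426256036837091144 (free 22 6 ∷ free 0 24 ∷ free 2 9 ∷ free 10 9 ∷ free 14 4 ∷ free 8 4 ∷ []) ∷
    narrow 1 227201699231817390849214348294576104372178375314888010905995961733533 (free 42 4 ∷ free 18 6 ∷ free 22 2 ∷ []) ∷
    narrow 1 216518178787455439039591384970826675558468194845986606502492645807944 (free 0 16 ∷ free 8 12 ∷ free 20 6 ∷ free 13 3 ∷ free 35 2 ∷ []) ∷
    narrow 1 451137512305366998533986427087902733802728240614506560381597098296576 (free 8 18 ∷ free 10 4 ∷ free 1 4 ∷ free 22 6 ∷ free 2 2 ∷ []) ∷
    narrow 1 166391478063378078920943738920043911065882625529652506049056281681685 (free 8 16 ∷ free 20 6 ∷ free 11 4 ∷ free 2 6 ∷ free 12 2 ∷ []) ∷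
    narrow 1 57088741044018582314698830321818986047468421190415080091957350790417 (free 0 8 ∷ free 9 2 ∷ free 6 6 ∷ free 2 9 ∷ free 22 6 ∷ free 17 2 ∷ []) ∷
    narrow 1 166391473762015507360654674467943499363945555407702957924277963794752 (free 36 4 ∷ free 14 4 ∷ free 4 4 ∷ free 9 9 ∷ free 0 6 ∷ free 13 4 ∷ []) ∷
    narrow 1 369768083958909250065014204404952092476338298800021464828337735174895 (free 0 16 ∷ free 6 6 ∷ free 3 4 ∷ free 26 2 ∷ free 12 6 ∷ free 17 2 ∷ []) ∷
    narrow 1 281961340613882688044383939491207150744380161345000452639784760699327 (free 0 36 ∷ free 6 30 ∷ free 9 2 ∷ free 10 24 ∷ free 14 18 ∷ free 38 2 ∷ free 22 6 ∷ free 18 6 ∷ level 21 [] 0 2 1 ∷ []) ∷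
    narrow 1 2553350219576951825563172562949825422713539983620778727807559358886 (free 39 6 ∷ free 23 2 ∷ free 40 4 ∷ free 8 12 ∷ free 25 4 ∷ []) ∷
    narrow 1 166391478062447096417950271825118581901081681748417015087865632096025 (free 4 12 ∷ free 8 2 ∷ free 0 16 ∷ free 2 6 ∷ free 16 8 ∷ free 18 6 ∷ free 6 20 ∷ free 10 9 ∷ free 14 4 ∷ level 40 [] 118903028090 2 1 ∷ free 20 6 ∷ level 36 [] 154561945599 2 1 ∷ []) ∷
    narrow 1 218322801467909781666534533447983734785040057170523659916386301421346 (free 42 6 ∷ free 44 4 ∷ free 25 6 ∷ free 29 2 ∷ free 40 2 ∷ []) ∷
    narrow 1 435821035417278320825845336238094332630795322661997946236633577702567 (free 33 8 ∷ free 29 12 ∷ free 40 8 ∷ free 11 6 ∷ free 36 3 ∷ free 7 2 ∷ []) ∷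
    narrow 1 163839031774802528710607029178038095023917514422461475972945904684639 (free 0 12 ∷ free 16 6 ∷ free 18 8 ∷ free 41 2 ∷ []) ∷
    narrow 1 75189466622325877822774129592231964605630170140385719249141516163220 (free 8 8 ∷ free 6 2 ∷ free 14 12 ∷ free 0 6 ∷ free 18 6 ∷ free 22 6 ∷ level 42 [] 0 2 1 ∷ []) ∷
    narrow 1 57088531955303384065821492599929724164853280745802865374511676627470 (free 22 6 ∷ free 2 8 ∷ free 0 8 ∷ free 13 2 ∷ []) ∷
    narrow 1 2552738519567602977699896847732417306119407994346364378085572727399 (free 23 12 ∷ free 24 6 ∷ free 28 18 ∷ free 17 2 ∷ free 33 6 ∷ free 13 2 ∷ []) ∷
    narrow 1 451136719921326610844223211115238649414836589034601860713791787130142 (free 0 24 ∷ free 3 9 ∷ free 4 2 ∷ free 39 2 ∷ free 22 6 ∷ free 8 18 ∷ free 12 12 ∷ free 14 6 ∷ level 16 [] 4647485484 2 1 ∷ []) ∷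
    narrow 1 365512960940494692857124660363468211012878963007937016004193365089996 (free 0 6 ∷ free 28 2 ∷ free 2 22 ∷ free 4 20 ∷ free 10 18 ∷ free 26 2 ∷ free 6 20 ∷ free 9 9 ∷ level 20 [] 38619369184 12 2 ∷ level 14 [] 39989026443 2 1 ∷ []) ∷
    narrow 1 157094873129132331137846684345630395230567341611811127898951676545565 (free 8 18 ∷ free 7 4 ∷ free 0 6 ∷ free 19 4 ∷ free 37 2 ∷ []) ∷
    narrow 1 451136785993239237510366773149756230697019941552690378411103546766871 (free 2 12 ∷ free 9 4 ∷ free 22 6 ∷ free 14 2 ∷ []) ∷
    narrow 1 435820482831705858784872110684969039786350151786316116094510409188828 (free 20 6 ∷ free 6 2 ∷ free 8 12 ∷ free 11 2 ∷ level 0 [] 63798490244 10 2 ∷ free 14 6 ∷ free 37 2 ∷ []) ∷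
    narrow 1 105942709876612630802426823618479839937669063010223340972994838875909 (free 0 8 ∷ free 8 6 ∷ free 2 22 ∷ free 4 20 ∷ free 14 18 ∷ free 37 2 ∷ free 6 18 ∷ free 10 12 ∷ level 41 [] 6200737589 2 1 ∷ free 16 6 ∷ level 29 [] 0 2 1 ∷ []) ∷
    narrow 1 168875443465934005646542700111768151912561631676313898180047883626782 (free 20 12 ∷ free 39 2 ∷ free 9 20 ∷ free 34 18 ∷ free 6 4 ∷ free 29 2 ∷ level 23 (13 ∷ []) 86540025195 1 1 ∷ level 47 [] 199441955061 5 2 ∷ free 2 6 ∷ level 13 [] 69079728512 2 1 ∷ []) ∷
    narrow 1 284894386676993787959083703105821587937733861186690812055072409951592 (free 4 16 ∷ free 8 6 ∷ free 1 2 ∷ free 10 4 ∷ []) ∷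
    narrow 1 166391467647704108157483511021312113412335838405775460120530201673599 (free 36 4 ∷ free 0 18 ∷ free 4 12 ∷ free 20 6 ∷ free 8 20 ∷ free 13 9 ∷ free 18 2 ∷ level 23 [] 117794776494 2 1 ∷ []) ∷
    narrow 1 3744794064237941419263379311705526094897676957558214539337559449767 (free 2 22 ∷ free 4 20 ∷ free 8 18 ∷ free 17 2 ∷ free 10 12 ∷ free 12 2 ∷ free 14 18 ∷ free 20 2 ∷ level 7 [] 195005138705 2 1 ∷ free 18 6 ∷ level 29 [] 0 2 1 ∷ []) ∷
    narrow 1 3481003526396684678249355209408039046539276270329053790346139428729 (free 4 4 ∷ free 6 6 ∷ free 11 2 ∷ free 20 8 ∷ free 22 6 ∷ free 0 12 ∷ free 16 6 ∷ free 8 9 ∷ free 29 2 ∷ []) ∷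
    narrow 1 75189469436502434956029655912968076040870324927810142099743504134811 (free 45 24 ∷ free 42 2 ∷ free 0 24 ∷ free 25 6 ∷ level 26 [] 0 1 1 ∷ free 38 16 ∷ free 31 18 ∷ free 41 6 ∷ free 6 12 ∷ free 17 8 ∷ free 14 6 ∷ level 13 (33 ∷ []) 225237326267 1 1 ∷ level 33 [] 158213971902 2 1 ∷ free 28 6 ∷ level 8 [] 157511855598 1 1 ∷ []) ∷
    narrow 1 167517425536075124646491286978826916703593620440672258625365069475265 (free 4 16 ∷ free 6 2 ∷ free 0 6 ∷ free 31 2 ∷ []) ∷
    narrow 1 57088958014326363757730630537748445517043517981816767545074487965653 (free 24 24 ∷ free 41 4 ∷ free 23 12 ∷ free 46 2 ∷ free 11 6 ∷ free 16 9 ∷ free 30 2 ∷ []) ∷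
    narrow 1 166391973787916426843321819438197550562110965105528614484937691745895 (free 8 16 ∷ free 6 6 ∷ free 1 2 ∷ free 21 2 ∷ []) ∷
    narrow 1 166391478062446093178801059036655808863146913647203558451526223803476 (free 7 12 ∷ free 11 2 ∷ free 36 6 ∷ free 20 2 ∷ free 8 18 ∷ free 15 2 ∷ free 18 18 ∷ free 34 12 ∷ free 0 6 ∷ level 4 [] 37824471724 2 1 ∷ []) ∷
    narrow 1 75189464196419304905178733072643776968904665983833883774926737557317 (free 34 48 ∷ free 2 2 ∷ free 32 18 ∷ free 37 12 ∷ level 19 (21 ∷ []) 7145854107 1 1 ∷ free 44 24 ∷ free 43 2 ∷ level 20 [] 88504543890 2 1 ∷ free 24 6 ∷ free 8 18 ∷ level 1 [] 5252283892 2 1 ∷ free 7 12 ∷ level 10 (31 ∷ []) 124706593845 2 1 ∷ level 30 [] 202237720948 2 1 ∷ free 14 6 ∷ level 12 [] 201830068685 2 1 ∷ []) ∷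
    narrow 1 75189464196402049694709068477539882262584774535804414182804027261877 (free 4 36 ∷ free 14 18 ∷ free 16 12 ∷ free 6 4 ∷ free 20 6 ∷ free 0 8 ∷ free 9 2 ∷ free 22 6 ∷ free 10 6 ∷ free 2 6 ∷ level 25 [] 0 2 1 ∷ []) ∷
    narrow 1 281960937126776119223830287930088345768166724955591955700019362590655 (free 16 12 ∷ free 2 12 ∷ free 12 4 ∷ free 8 6 ∷ free 22 6 ∷ free 26 2 ∷ []) ∷
    narrow 1 168317591207760412362135146015912109568881190267201220921226394190160 (free 15 6 ∷ free 25 8 ∷ free 38 18 ∷ free 7 2 ∷ level 22 [] 228762365586 1 1 ∷ []) ∷
    narrow 1 163838739591398864928113394077148571289277585067768410784686434491517 (free 23 6 ∷ free 16 26 ∷ free 9 12 ∷ free 35 2 ∷ free 18 16 ∷ free 31 6 ∷ free 2 8 ∷ free 36 9 ∷ free 24 6 ∷ free 7 2 ∷ []) ∷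
    narrow 1 5569754375146705263883709997916833103032769135261614357964800096384 (free 37 8 ∷ free 6 6 ∷ free 4 8 ∷ free 0 12 ∷ free 45 20 ∷ free 14 6 ∷ free 12 2 ∷ free 10 9 ∷ free 42 2 ∷ []) ∷
    narrow 1 281961340613882686295708004428093826960481261045841907686371471959495 (free 8 18 ∷ free 10 2 ∷ free 18 12 ∷ free 22 6 ∷ free 2 2 ∷ free 4 12 ∷ free 16 6 ∷ free 1 2 ∷ []) ∷
    narrow 1 163839046137728674422967314159605545110054738404668766172737407132230 (free 2 12 ∷ free 8 6 ∷ free 0 8 ∷ free 5 2 ∷ free 18 2 ∷ []) ∷
    narrow 1 373163325659103227821003179398087931465416716212101498923711128226056 (free 2 12 ∷ free 8 6 ∷ free 10 2 ∷ free 7 4 ∷ free 19 3 ∷ free 23 2 ∷ []) ∷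
    narrow 1 84936240794421890548100490043095947736171867721325449879696787613693 (free 0 6 ∷ free 16 12 ∷ free 7 12 ∷ free 20 6 ∷ free 2 6 ∷ free 8 9 ∷ free 12 4 ∷ []) ∷
    narrow 1 431231092467890405473408100722155103631465890119516659546272156440825 (free 44 12 ∷ free 24 2 ∷ free 15 6 ∷ free 42 4 ∷ free 19 2 ∷ []) ∷
    narrow 1 75189464196419304830964509734914006666118729288376681889937174495028 (free 19 6 ∷ free 24 12 ∷ free 34 6 ∷ free 21 6 ∷ free 45 6 ∷ free 8 9 ∷ free 10 4 ∷ []) ∷
    narrow 1 281960448116252270192911525088758777112835582439889715131249764100899 (free 2 8 ∷ free 22 6 ∷ free 0 40 ∷ free 4 24 ∷ free 12 2 ∷ free 16 2 ∷ []) ∷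
    narrow 1 5570517878379038455730154462206822906043034421317014005814448276395 (free 4 12 ∷ free 6 2 ∷ free 22 6 ∷ free 9 9 ∷ free 0 12 ∷ free 16 2 ∷ level 27 [] 95380551396 2 1 ∷ free 2 6 ∷ free 41 2 ∷ []) ∷
    narrow 1 164933963491366555909406517033859267479970186259873076608728990358294 (free 4 4 ∷ free 6 12 ∷ free 10 4 ∷ free 18 6 ∷ free 14 8 ∷ free 3 2 ∷ []) ∷
    narrow 1 3481305946479612726055679141665522735175144947182769301738261729252 (free 4 8 ∷ free 6 12 ∷ free 8 4 ∷ free 0 6 ∷ free 22 6 ∷ free 18 6 ∷ free 14 6 ∷ level 34 [] 0 2 1 ∷ []) ∷
    narrow 1 5569749310836796275127768333248434471355561951353188756842874795468 (free 16 12 ∷ free 31 2 ∷ free 22 6 ∷ free 6 12 ∷ free 8 4 ∷ free 4 2 ∷ []) ∷ []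

opaque
  unfolding scramble label square negTranspose smallWords matrix fixers representatives₆ representatives₃

  -- The first number is 0 because these codes have no words of weight 3. Together with the numbers
  -- for the second list the weight 3 shares and the weight 6 shares each add up to `count 11`,
  -- which is 545998386365598870609920000.
  audited₆ : audit 6 (toList representatives₆) 0 512748049657991090562662400 ≡ true
  audited₆ = refl

  audited₃ : audit 3 (toList representatives₃) 545998386365598870609920000 33250336707607780047257600 ≡ true
  audited₃ = refl

theorem1p1 : ExactlyUpToEquiv (SelfDualCode 24 12 6) 166 × ExactlyUpToEquiv (SelfDualCode 24 12 3) 170
theorem1p1 = Final.theorem representatives₆ representatives₃ _ _ _ _ audited₆ audited₃ refl refl
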